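{- For every integer $m\ge1$, the smallest weighted efficiency $\rho_{2,m}$ of triangulations of $I^2\times\Delta^{m-1}$ is $$\rho_{2,m}=\sqrt{\frac{\lceil 3m^2/4\rceil}{m^2}} .$$ That is, $\rho_{2,m}=\sqrt{3/4}$ for even $m$ and $\rho_{2,m}=\sqrt{3/4}+\Theta(m^{ -2})$ for odd $m$.
   Context: $I^2=[0,1]^2$ and $\Delta^{m-1}$ is an $(m-1)$-simplex with vertices $v_1,\dots,v_m$. A triangulation of a $d$-dimensional polytope is a decomposition of it into $d$-simplices that use as vertices only vertices of the polytope and that intersect face to face. Simplices are identified with their vertex sets. An $(m+1)$-dimensional simplex $\tau$ with vertices among the vertices of $I^2\times\Delta^{m-1}$ decomposes as $\tau=\tau_1\cup\dots\cup\tau_m$ with $\tau_i\subset I^2\times\{v_i\}$; its type is $(t_1,\dots,t_m)=(|\tau_1|-1,\dots,|\tau_m|-1)$ and its weight is $\operatorname{weight}(\tau)=\frac1{\prod_{i=1}^m t_i!}$. The weighted efficiency of a triangulation $T$ of $I^2\times\Delta^{m-1}$ is $\sqrt{\frac{\sum_{\tau\in T}\operatorname{weight}(\tau)}{m^2}}$, the sum being over the full-dimensional simplices of $T$, and $\rho_{2,m}$ is the minimum of this number over all triangulations $T$ of $I^2\times\Delta^{m-1}$. -}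

module Defs where

open import Data.Fin.Base using (Fin; combine; remQuot)
open import Data.Fin.Patterns using (0F; 1F; 2F; 3F)
open import Data.Fin.Properties using (_≟_)
open import Data.Fin.Subset using (Subset; _∉_; _⊆_; ∣_∣)
open import Data.Integer.Base using (+_)
open import Data.List.Base as List using (List)
import Data.List.Membership.Propositional as List∈
open import Data.List.Relation.Unary.All.Properties using (tabulate⁺)
open import Data.List.Relation.Unary.Any using (Any)
open import Data.List.Relation.Unary.Unique.Propositional using (Unique)
open import Data.Nat.Base as ℕ using (ℕ; suc; NonZero; _!; _∸_)
open import Data.Nat.ListAction using (product)
open import Data.Nat.ListAction.Properties using (product≢0)
open import Data.Nat.Properties using (m^n≢0; _!≢0)
open import Data.Product.Base using (∃; ∃-syntax; _×_; _,_)
open import Data.Rational.Base as ℚ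
  using (ℚ; 0ℚ; 1ℚ; _+_; _*_; _-_; -_; _≤_; _<_; _/_; _÷_)
open import Data.Rational.Properties as ℚₚ using (+-0-commutativeMonoid)
open import Data.Rational.Solver using (module +-*-Solver)
open import Data.Sum.Base using (_⊎_; inj₁; inj₂)
import Data.Vec.Base as Vec
open import Data.Vec.Functional using (Vector; _∷_; []; _++_; take; drop)
open import Algebra.Properties.CommutativeMonoid.Sum +-0-commutativeMonoid using (sum)
open import Function.Bundles using (_⇔_)
open import Level using (0ℓ)
open import Relation.Binary.PropositionalEquality
  using (_≡_; refl; sym; trans; cong; subst; subst₂)
open import Relation.Nullary using (¬_; yes; no; does)
open import Relation.Unary using (Pred)
open import Data.Bool.Base using (if_then_else_)

record ℝ : Set₁ where
  field
    L U         : Pred ℚ 0ℓ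
    L-inhabited : ∃ L
    U-inhabited : ∃ U
    L-lower     : ∀ {p r} → p < r → L r → L p
    U-upper     : ∀ {p r} → p < r → U p → U r
    L-open      : ∀ {p} → L p → ∃[ r ] (p < r × L r)
    U-open      : ∀ {p} → U p → ∃[ r ] (r < p × U r)
    disjoint    : ∀ {p} → L p → ¬ U p
    located     : ∀ {p r} → p < r → L p ⊎ U r

infix 4 _≤ᴿ_ _≈ᴿ_

_≤ᴿ_ : ℝ → ℝ → Set
x ≤ᴿ y = ∀ {p} → ℝ.L x p → ℝ.L y p

_≈ᴿ_ : ℝ → ℝ → Set
x ≈ᴿ y = x ≤ᴿ y × y ≤ᴿ x

module Shift (x : ℝ) (c : ℚ) where
  open ℝ x

  L′ U′ : Pred ℚ 0ℓ
  L′ p = L (p - c)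
  U′ p = U (p - c)

  add-sub : ∀ p → (p + c) - c ≡ p
  add-sub p = solve 2 (λ p c → (p :+ c) :- c := p) refl p c
    where open +-*-Solver

  sub-add : ∀ p → (p - c) + c ≡ p
  sub-add p = solve 2 (λ p c → (p :- c) :+ c := p) refl p c
    where open +-*-Solver

  shift : ∀ {p r} → p < r → p - c < r - c
  shift = ℚₚ.+-monoˡ-< (- c)

  result : ℝ
  result = record
    { L           = L′
    ; U           = U′
    ; L-inhabited = let (p , l) = L-inhabited in p + c , subst L (sym (add-sub p)) l
    ; U-inhabited = let (p , u) = U-inhabited in p + c , subst U (sym (add-sub p)) u
    ; L-lower     = λ p<r → L-lower (shift p<r)
    ; U-upper     = λ p<r → U-upper (shift p<r)
    ; L-open      = λ {p} l → let (r , p-c<r , lr) = L-open l in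
        r + c , subst (_< r + c) (sub-add p) (ℚₚ.+-monoˡ-< c p-c<r)
              , subst L (sym (add-sub r)) lr
    ; U-open      = λ {p} u → let (r , r<p-c , ur) = U-open u in
        r + c , subst (r + c <_) (sub-add p) (ℚₚ.+-monoˡ-< c r<p-c)
              , subst U (sym (add-sub r)) ur
    ; disjoint    = disjoint
    ; located     = λ p<r → located (shift p<r)
    }

infixl 6 _+ᴿ_

_+ᴿ_ : ℝ → ℚ → ℝ
x +ᴿ c = Shift.result x c

-- For q < 0 the cut below is that of the real number 0.
module Sqrt (q : ℚ) where
  L′ U′ : Pred ℚ 0ℓ
  L′ p = p < 0ℚ ⊎ p * p < q
  U′ p = 0ℚ < p × q < p * p

  0<1 : 0ℚ < 1ℚ
  0<1 = ℚₚ.positive⁻¹ 1ℚ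

  0<* : ∀ {p r} → 0ℚ < p → 0ℚ < r → 0ℚ < p * r
  0<* {p} {r} 0<p 0<r =
    ℚₚ.positive⁻¹ (p * r) {{ℚₚ.pos*pos⇒pos p {{ℚ.positive 0<p}} r {{ℚ.positive 0<r}}}}

  0<+ : ∀ {p r} → 0ℚ < p → 0ℚ < r → 0ℚ < p + r
  0<+ = ℚₚ.+-mono-<

  0≤+ : ∀ {p r} → 0ℚ ≤ p → 0ℚ ≤ r → 0ℚ ≤ p + r
  0≤+ = ℚₚ.+-mono-≤

  0≤* : ∀ {p r} → 0ℚ ≤ p → 0ℚ ≤ r → 0ℚ ≤ p * r
  0≤* {p} {r} 0≤p 0≤r = ℚₚ.nonNegative⁻¹ (p * r)
    {{ℚₚ.nonNeg*nonNeg⇒nonNeg p {{ℚ.nonNegative 0≤p}} r {{ℚ.nonNegative 0≤r}}}}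

  p<p+δ : ∀ p {δ} → 0ℚ < δ → p < p + δ
  p<p+δ p {δ} 0<δ = subst (_< p + δ) (ℚₚ.+-identityʳ p) (ℚₚ.+-monoʳ-< p 0<δ)

  0<r-p : ∀ {p r} → p < r → 0ℚ < r - p
  0<r-p {p} {r} p<r = subst (_< r - p) (ℚₚ.+-inverseʳ p) (ℚₚ.+-monoˡ-< (- p) p<r)

  p<r : ∀ {p r} δ → 0ℚ < δ → p + δ ≡ r → p < r
  p<r {p} δ 0<δ eq = subst (p <_) eq (p<p+δ p 0<δ)

  square-< : ∀ {p r} → 0ℚ ≤ p → p < r → p * p < r * r
  square-< {p} {r} 0≤p p<r = ℚₚ.≤-<-trans
    (ℚₚ.*-monoˡ-≤-nonNeg p {{ℚ.nonNegative 0≤p}} (ℚₚ.<⇒≤ p<r))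
    (ℚₚ.*-monoˡ-<-pos r {{ℚ.positive (ℚₚ.≤-<-trans 0≤p p<r)}} p<r)

  fraction : ∀ {g a} → 0ℚ < g → 0ℚ < a →
             ∃[ t ] (0ℚ < t × t < 1ℚ × t * (a + g) ≡ g)
  fraction {g} {a} 0<g 0<a = t , 0<t , t<1 , t*s≡g
    where
    s = a + g
    0<s = 0<+ 0<a 0<g
    instance
      _ = ℚ.positive 0<s
      s≢0 = ℚₚ.pos⇒nonZero s
    t = g ÷ s
    0<t : 0ℚ < t
    0<t = 0<* 0<g (ℚₚ.positive⁻¹ (ℚ.1/ s) {{ℚₚ.1/pos⇒pos s}})
    t*s≡g : t * s ≡ g
    t*s≡g = trans (ℚₚ.*-assoc g (ℚ.1/ s) s)
      (trans (cong (g *_) (ℚₚ.*-inverseˡ s)) (ℚₚ.*-identityʳ g))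
    t<1 : t < 1ℚ
    t<1 = ℚₚ.*-cancelʳ-<-nonNeg s {{ℚₚ.pos⇒nonNeg s}}
      (subst₂ _<_ (sym t*s≡g) (trans (ℚₚ.+-comm g a) (sym (ℚₚ.*-identityˡ s)))
        (p<p+δ g 0<a))

  L-lower : ∀ {p r} → p < r → L′ r → L′ p
  L-lower {p} p<r (inj₁ r<0)  = inj₁ (ℚₚ.<-trans p<r r<0)
  L-lower {p} p<r (inj₂ r²<q) with p ℚₚ.<? 0ℚ
  ... | yes p<0 = inj₁ p<0
  ... | no  p≮0 = inj₂ (ℚₚ.<-trans (square-< (ℚₚ.≮⇒≥ p≮0) p<r) r²<q)

  U-upper : ∀ {p r} → p < r → U′ p → U′ r
  U-upper p<r (0<p , q<p²) =
    ℚₚ.<-trans 0<p p<r , ℚₚ.<-trans q<p² (square-< (ℚₚ.<⇒≤ 0<p) p<r)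

  L-open-nonNeg : ∀ {p} → 0ℚ ≤ p → p * p < q → ∃[ r ] (p < r × L′ r)
  L-open-nonNeg {p} 0≤p p²<q =
    let g = q - p * p
        a = p + p + 1ℚ
        (t , 0<t , t<1 , t*s≡g) = fraction (0<r-p p²<q) (ℚₚ.+-mono-≤-< (0≤+ 0≤p 0≤p) 0<1)
        -- q - (p + t)² = t (1 - t) + t g
        gap = t * (1ℚ - t) + t * g
        eq : (p + t) * (p + t) + gap ≡ q
        eq = trans
          (solve 3 (λ p t g → (p :+ t) :* (p :+ t) :+ (t :* (con 1ℚ :- t) :+ t :* g)
             := p :* p :+ t :* (p :+ p :+ con 1ℚ :+ g)) refl p t g)
          (trans (cong (λ z → p * p + z) t*s≡g)
            (solve 2 (λ x q → x :+ (q :- x) := q) refl (p * p) q))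
    in p + t , p<p+δ p 0<t
     , inj₂ (p<r gap (0<+ (0<* 0<t (0<r-p t<1)) (0<* 0<t (0<r-p p²<q))) eq)
    where open +-*-Solver

  L-open : ∀ {p} → L′ p → ∃[ r ] (p < r × L′ r)
  L-open {p} (inj₁ p<0) = let (r , p<r , r<0) = ℚₚ.<-dense p<0 in r , p<r , inj₁ r<0
  L-open {p} (inj₂ p²<q) with p ℚₚ.<? 0ℚ
  ... | yes p<0 = L-open (inj₁ p<0)
  ... | no  p≮0 = L-open-nonNeg (ℚₚ.≮⇒≥ p≮0) p²<q

  U-open : ∀ {p} → U′ p → ∃[ r ] (r < p × U′ r)
  U-open {p} (0<p , q<p²) =
    let g = p * p - q
        a = p * p + p * p
        0<p² = 0<* 0<p 0<p
        0<g = 0<r-p q<p²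
        (t , 0<t , t<1 , t*s≡g) = fraction 0<g (0<+ 0<p² 0<p²)
        r = p * (1ℚ - t)
        -- r² - q = p² t² + t g
        gap = p * p * (t * t) + t * g
        eq : q + gap ≡ r * r
        eq = trans
          (solve 4 (λ p q t g → q :+ (p :* p :* (t :* t) :+ t :* g)
             := p :* (con 1ℚ :- t) :* (p :* (con 1ℚ :- t))
                :+ (t :* (p :* p :+ p :* p :+ g) :- (p :* p :- q))) refl p q t g)
          (trans (cong (λ z → r * r + (z - g)) t*s≡g)
            (solve 2 (λ x y → x :+ (y :- y) := x) refl (r * r) g))
    in r
     , p<r (p * t) (0<* 0<p 0<t)
         (solve 2 (λ p t → p :* (con 1ℚ :- t) :+ p :* t := p) refl p t)
     , 0<* 0<p (0<r-p t<1)
     , p<r gap (0<+ (0<* 0<p² (0<* 0<t 0<t)) (0<* 0<t 0<g)) eq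
    where open +-*-Solver

  disjoint : ∀ {p} → L′ p → ¬ U′ p
  disjoint (inj₁ p<0)  (0<p , _)  = ℚₚ.<-asym p<0 0<p
  disjoint (inj₂ p²<q) (_ , q<p²) = ℚₚ.<-asym p²<q q<p²

  located : ∀ {p r} → p < r → L′ p ⊎ U′ r
  located {p} p<r with p ℚₚ.<? 0ℚ | p * p ℚₚ.<? q
  ... | yes p<0 | _        = inj₁ (inj₁ p<0)
  ... | no  _   | yes p²<q = inj₁ (inj₂ p²<q)
  ... | no  p≮0 | no  p²≮q =
    let 0≤p = ℚₚ.≮⇒≥ p≮0 in
    inj₂ (ℚₚ.≤-<-trans 0≤p p<r , ℚₚ.≤-<-trans (ℚₚ.≮⇒≥ p²≮q) (square-< 0≤p p<r))

  U-inhabited : ∃ U′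
  U-inhabited with q ℚₚ.<? 1ℚ
  ... | yes q<1 = 1ℚ , 0<1 , q<1
  ... | no  q≮1 =
    let 1≤q = ℚₚ.≮⇒≥ q≮1
        0<q = ℚₚ.<-≤-trans 0<1 1≤q
    in q + 1ℚ , 0<+ 0<q 0<1
     , p<r (q * q + q + 1ℚ) (0<+ (0<+ (0<* 0<q 0<q) 0<q) 0<1)
         (solve 1 (λ q → q :+ (q :* q :+ q :+ con 1ℚ) := (q :+ con 1ℚ) :* (q :+ con 1ℚ)) refl q)
    where open +-*-Solver

  result : ℝ
  result = record
    { L           = L′
    ; U           = U′
    ; L-inhabited = - 1ℚ , inj₁ (ℚₚ.negative⁻¹ (- 1ℚ))
    ; U-inhabited = U-inhabited
    ; L-lower     = L-lower
    ; U-upper     = U-upper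
    ; L-open      = L-open
    ; U-open      = U-open
    ; disjoint    = disjoint
    ; located     = located
    }

√ : ℚ → ℝ
√ q = Sqrt.result q

-- All the polytopes and simplices considered have integral vertices, so
-- inclusions among them and their intersections are determined by their
-- rational points.
Point : ℕ → Set
Point e = Vector ℚ e

module _ {n e : ℕ} (A : Fin n → Point e) where

  _∈conv_ : Point e → Subset n → Set
  x ∈conv S = ∃[ c ]
    ( (∀ k → 0ℚ ≤ c k)
    × (∀ k → k ∉ S → c k ≡ 0ℚ)
    × sum c ≡ 1ℚ
    × (∀ j → sum (λ k → c k * A k j) ≡ x j) )

  AffinelyIndependent : Subset n → Set
  AffinelyIndependent S = ∀ (c : Vector ℚ n)
    → (∀ k → k ∉ S → c k ≡ 0ℚ)
    → sum c ≡ 0ℚ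
    → (∀ j → sum (λ k → c k * A k j) ≡ 0ℚ)
    → ∀ k → c k ≡ 0ℚ

  IsSimplex : ℕ → Subset n → Set
  IsSimplex d S = ∣ S ∣ ≡ suc d × AffinelyIndependent S

  -- The faces of a simplex are the hulls of the subsets of its vertex set,
  -- the empty one included.
  MeetFaceToFace : Subset n → Subset n → Set
  MeetFaceToFace S T = ∃[ F ]
    (F ⊆ S × F ⊆ T × (∀ x → (x ∈conv S × x ∈conv T) ⇔ x ∈conv F))

  record IsTriangulation (P : Pred (Point e) 0ℓ) (d : ℕ) (T : List (Subset n)) : Set where
    field
      unique     : Unique T
      simplices  : ∀ {τ} → τ List∈.∈ T → IsSimplex d τ
      union      : ∀ x → P x ⇔ Any (x ∈conv_) T
      faceToFace : ∀ {σ τ} → σ List∈.∈ T → τ List∈.∈ T → MeetFaceToFace σ τ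

I² : Pred (Point 2) 0ℓ
I² x = ∀ i → 0ℚ ≤ x i × x i ≤ 1ℚ

Δ : ∀ m → Pred (Point m) 0ℓ
Δ m y = (∀ i → 0ℚ ≤ y i) × sum y ≡ 1ℚ

I²×Δ : ∀ m → Pred (Point (2 ℕ.+ m)) 0ℓ
I²×Δ m x = I² (take 2 x) × Δ m (drop 2 x)

corner : Fin 4 → Point 2
corner 0F = 0ℚ ∷ 0ℚ ∷ []
corner 1F = 1ℚ ∷ 0ℚ ∷ []
corner 2F = 0ℚ ∷ 1ℚ ∷ []
corner 3F = 1ℚ ∷ 1ℚ ∷ []

basis : ∀ {m} → Fin m → Point m
basis i j = if does (i ≟ j) then 1ℚ else 0ℚ

-- The vertex with index combine i c is (corner c , vᵢ).
vertex : ∀ m → Fin (m ℕ.* 4) → Point (2 ℕ.+ m)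
vertex m k = let (i , c) = remQuot 4 k in corner c ++ basis i

VertexSet : ℕ → Set
VertexSet m = Subset (m ℕ.* 4)

Triangulates : ∀ m → List (VertexSet m) → Set
Triangulates m = IsTriangulation (vertex m) (I²×Δ m) (suc m)

level : ∀ m → VertexSet m → Fin m → Subset 4
level m τ i = Vec.tabulate (λ c → Vec.lookup τ (combine {m} i c))

-- A simplex of dimension m + 1 meets every I² × {vᵢ}, so that the truncated
-- subtraction is the usual one for the simplices of a triangulation.
simplexType : ∀ m → VertexSet m → Fin m → ℕ
simplexType m τ i = ∣ level m τ i ∣ ∸ 1

weight : ∀ m → VertexSet m → ℚ
weight m τ = + 1 / product ts!
  where
  ts! = List.tabulate (λ i → simplexType m τ i !)
  instance
    _ = product≢0 (tabulate⁺ (λ i → simplexType m τ i !≢0))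

totalWeight : ∀ m → List (VertexSet m) → ℚ
totalWeight m T = List.foldr _+_ 0ℚ (List.map (weight m) T)

weightedEfficiency : ∀ m → .{{NonZero m}} → List (VertexSet m) → ℝ
weightedEfficiency m T = √ (totalWeight m T * (+ 1 / m ℕ.^ 2))
  where
  instance
    _ = m^n≢0 m 2

-- ρ₂,ₘ as a relation: ρ is attained by some triangulation and is a lower
-- bound for all of them.
IsRho : ∀ m → .{{NonZero m}} → ℝ → Set
IsRho m ρ =
    (∃[ T ] (Triangulates m T × ρ ≈ᴿ weightedEfficiency m T))
  × (∀ T → Triangulates m T → ρ ≤ᴿ weightedEfficiency m T)

{-# OPTIONS --safe #-}

-- By the Cayley trick, a triangulation of I² × Δᵐ⁻¹ is a mixed subdivision of a
-- sum of m squares.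
--
-- Lower bound. Level i carries two triangles, each of weight 1/2, and a diagonal.
-- For levels i ≠ j consider the four points q + c, c a corner, of the sum of the
-- two squares, with q generic. At most one of them lies in a translated triangle
-- of level i and at most one in a translated triangle of level j, so two lie in
-- parallelograms; these coincide only if the parallelogram has area 2, that is if
-- the diagonals of i and j cross. With k diagonals of one kind and l of the other,
-- the total weight is at least m + 2 m (m - 1) / 2 - k l = k² + k l + l².
--
-- Upper bound. Let the diagonals alternate. In the sum of the squares, the two
-- families of parallel diagonals span a rectangle, cut into k l parallelograms; the
-- four remaining corner triangles are subdivided by staircases. The resulting
-- cells are the zero sets of the slacks of a convex height function, which makes
-- them meet face to face.
module Submission where

open import Defs
import Algebra.Properties.CommutativeMonoid.Sum as Sum
open import Data.Bool.Base using (Bool; true; false; not; if_then_else_; _∧_) renaming (T to So)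
open import Data.Bool.Properties using (∧-zeroʳ; ¬-not) renaming (_≟_ to _≟ᵇ_)
open import Data.Empty using (⊥; ⊥-elim)
open import Data.Fin.Base using (Fin; zero; suc; combine; remQuot; toℕ)
open import Data.Fin.Patterns using (0F; 1F; 2F; 3F)
open import Data.Fin.Properties
  using (_≟_; suc-injective; remQuot-combine; combine-remQuot; all?; any?; ¬∀⟶∃¬; toℕ<n; toℕ-injective)
open import Data.Fin.Subset using (Subset; _∉_; _∈_; _⊆_; ∣_∣; _∩_) renaming (_-_ to _∖_)
open import Data.Fin.Subset.Properties
  using (_∈?_; ∣p∣≡n⇒p≡⊤; ∣p∣≤n; ∈⊤; x∈p⇒∣p-x∣<∣p∣; x∈p∧x≢y⇒x∈p-y; p∩q⊆p; p∩q⊆q; x∈p∩q⁺)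
open import Data.Integer.Base as ℤ using (+_)
import Data.Integer.DivMod as ℤDivMod
open import Data.Integer.GCD using () renaming (gcd to ℤgcd)
import Data.Integer.Properties as ℤₚ
open import Data.Integer.Solver using () renaming (module +-*-Solver to ℤ-Solver)
open import Data.List.Base as List using (List; []; _∷_; deduplicate; filter)
open import Data.List.Membership.Propositional using (find; lose) renaming (_∈_ to _∈ˡ_)
open import Data.List.Membership.Propositional.Properties
  using (∈-map⁻; ∈-deduplicate⁻; ∈-deduplicate⁺; ∈-concat⁺′; ∈-tabulate⁺; ∈-++⁺ʳ)
open import Data.List.Properties using (map-++)
open import Data.List.Relation.Unary.All.Properties using (tabulate⁺)
open import Data.List.Relation.Unary.Any using (Any; here; there)
open import Data.List.Relation.Unary.Unique.DecPropositional.Properties using (deduplicate-!)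
open import Data.Nat.Base as ℕ using (ℕ; zero; suc; z≤n; s≤s; NonZero; _^_; _!; _∸_) renaming (_*_ to _*ℕ_)
open import Data.Nat.Divisibility using (_∣_; _∤_; divides; m%n≡0⇒n∣m)
import Data.Nat.DivMod as ℕDivMod
open import Data.Nat.ListAction using (product)
open import Data.Nat.ListAction.Properties using (product≢0)
import Data.Nat.Properties as ℕₚ
open import Data.Nat.Properties using (m^n≢0)
open import Data.Nat.Solver using () renaming (module +-*-Solver to ℕ-Solver)
open import Data.Product.Base using (_×_; _,_; ∃; ∃-syntax; proj₁; proj₂)
open import Data.Rational.Base as ℚ
  using (ℚ; 0ℚ; 1ℚ; ½; _<_; _≤_; _*_; _+_; _-_; -_; _/_; ceiling; floor; ↥_; ↧_)
open import Data.Rational.Properties as ℚₚ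
  using (≤-refl; ≤-trans; *-zeroʳ; +-identityʳ; ≤-reflexive; +-identityˡ; nonNegative⁻¹;
    *-identityʳ; <-≤-trans; +-mono-≤; positive⁻¹; *-identityˡ; ≮⇒≥; +-monoʳ-≤; +-comm;
    *-zeroˡ; *-monoˡ-≤-nonNeg; <⇒≤; ≰⇒>; 1≢0; *-distribˡ-+; normalize-nonNeg; <-irrefl;
    *-monoʳ-≤-nonNeg; +-inverseʳ; *-assoc; neg-antimono-≤; ≤-<-trans)
open import Data.Rational.Solver using (module +-*-Solver)
import Data.Rational.Unnormalised.Base as ℚᵘ
import Data.Rational.Unnormalised.Properties as ℚᵘₚ
open import Data.Sum.Base using (_⊎_; inj₁; inj₂; map; map₁)
open import Data.Vec.Base as Vec using ([]; _∷_; here; there)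
open import Data.Vec.Functional using (Vector; _++_) renaming (_∷_ to _∷ᵛ_)
open import Data.Vec.Properties using (≡-dec; lookup∘tabulate; lookup⇒[]=; []=⇒lookup; tabulate-cong)
open import Function.Base using (_∘_)
open import Function.Bundles using (Equivalence; mk⇔)
open import Level using (0ℓ)
open import Relation.Binary.Definitions using (DecidableEquality; tri<; tri≈; tri>)
open import Relation.Binary.PropositionalEquality hiding (J)
open import Relation.Nullary using (¬_; Dec; yes; no; does)
open import Relation.Nullary.Decidable
  using (toWitness; _×-dec_; _→-dec_; _⊎-dec_; ¬?; dec-true; dec-false; decidable-stable)
open import Relation.Unary using (Pred; Decidable)

open Sum ℚₚ.+-0-commutativeMonoid using (sum; ∑-distrib-+; sum-cong-≗)
open Sum ℕₚ.+-0-commutativeMonoid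
  using () renaming (sum to sumℕ; sum-cong-≗ to sumℕ-cong; ∑-distrib-+ to ℕ∑-distrib-+)
open +-*-Solver using (solve; _:=_; _:+_; _:-_; _:*_; :-_; con)
open ℤ-Solver using ()
  renaming (solve to solveℤ; _:=_ to _ℤ:=_; _:+_ to _ℤ:+_; _:*_ to _ℤ:*_; :-_ to ℤ:-_; con to ℤcon)
open ℕ-Solver using () renaming (solve to solveℕ; _:=_ to _:=ℕ_; _:+_ to _⊕_; _:*_ to _⊗_; con to #_)

-- Neither volumes nor the Cayley trick occur. A mixed cell is met only as the simplex that holds a
-- given point over a vertex or an edge of the second factor, and simplices are compared through
-- `coordinates-unique`: the barycentric coordinates of a point do not depend on the simplex of the
-- triangulation in which they are taken. Weights are compared with counts of ordered pairs of
-- levels: a triangle of one level serves one pair and has weight 1/2, a parallelogram serves two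
-- and has weight 1. The height behind the upper bound gives the ends `hi` and `lo` of the diagonal
-- of level i the values i and -i, and the two other corners the value m, which exceeds every i. It
-- is never written down: explicit tables of slacks are checked to differ from it by affine
-- functions. Complementary slackness then does the work of convexity. That the cells fill the
-- polytope is shown by coordinates for each point, found by filling the levels greedily in their
-- order.

true≢false : true ≢ false
true≢false ()

-- Rational arithmetic and finite sums

0≤+ : ∀ {p q} → 0ℚ ≤ p → 0ℚ ≤ q → 0ℚ ≤ p + q
0≤+ = +-mono-≤

0≤* : ∀ {p q} → 0ℚ ≤ p → 0ℚ ≤ q → 0ℚ ≤ p * q
0≤* = Sqrt.0≤* 0ℚ

0≤1 : 0ℚ ≤ 1ℚ
0≤1 = nonNegative⁻¹ 1ℚ

≤-by : ∀ {p q} d → 0ℚ ≤ d → q ≡ p + d → p ≤ q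
≤-by {p} d 0≤d refl = subst (_≤ p + d) (+-identityʳ p) (+-monoʳ-≤ p 0≤d)

0≤- : ∀ {p q} → p ≤ q → 0ℚ ≤ q - p
0≤- {p} {q} p≤q = subst (_≤ q - p) (+-inverseʳ p) (ℚₚ.+-monoˡ-≤ (- p) p≤q)

-- Equations are combined linearly: an identity proved by the ring solver whose
-- right-hand side contains multiples of l - r, where l ≡ r is a hypothesis.
by₁ : ∀ {a b} k {l r} → l ≡ r → a ≡ b + k * (l - r) → a ≡ b
by₁ {b = b} k {l} refl e = trans e (solve 3 (λ b k l → b :+ k :* (l :- l) := b) refl b k l)

by₂ : ∀ {a b} k {l r} → l ≡ r → ∀ k′ {l′ r′} → l′ ≡ r′ →
      a ≡ b + k * (l - r) + k′ * (l′ - r′) → a ≡ b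
by₂ k p k′ p′ e = by₁ k p (by₁ k′ p′ e)

by₃ : ∀ {a b} k {l r} → l ≡ r → ∀ k′ {l′ r′} → l′ ≡ r′ → ∀ k″ {l″ r″} → l″ ≡ r″ →
      a ≡ b + k * (l - r) + k′ * (l′ - r′) + k″ * (l″ - r″) → a ≡ b
by₃ k p k′ p′ k″ p″ e = by₂ k p k′ p′ (by₁ k″ p″ e)

p-q≡0 : ∀ {p q : ℚ} → p ≡ q → p - q ≡ 0ℚ
p-q≡0 {p} refl = +-inverseʳ p

p-q≡0⁻¹ : ∀ {p q : ℚ} → p - q ≡ 0ℚ → p ≡ q
p-q≡0⁻¹ {p} {q} e = by₁ 1ℚ e (solve 2 (λ p q → p := q :+ con 1ℚ :* (p :- q :- con 0ℚ)) refl p q)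

0≤-antisym : ∀ {p} → 0ℚ ≤ p → p ≤ 0ℚ → p ≡ 0ℚ
0≤-antisym 0≤p p≤0 = ℚₚ.≤-antisym p≤0 0≤p

+-zero-split : ∀ {p q} → 0ℚ ≤ p → 0ℚ ≤ q → p + q ≡ 0ℚ → p ≡ 0ℚ × q ≡ 0ℚ
+-zero-split {p} {q} 0≤p 0≤q e =
  0≤-antisym 0≤p (≤-by q 0≤q (sym e)) ,
  0≤-antisym 0≤q (≤-by p 0≤p (trans (sym e) (+-comm p q)))

Σ₄ : (Fin 4 → ℚ) → ℚ
Σ₄ f = f 0F + (f 1F + (f 2F + f 3F))

Σ₄-cong : ∀ {f g} → (∀ c → f c ≡ g c) → Σ₄ f ≡ Σ₄ g
Σ₄-cong h = cong₂ _+_ (h 0F) (cong₂ _+_ (h 1F) (cong₂ _+_ (h 2F) (h 3F)))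

sum-zero : ∀ {n} {f : Fin n → ℚ} → (∀ i → f i ≡ 0ℚ) → sum f ≡ 0ℚ
sum-zero {ℕ.zero}  h = refl
sum-zero {ℕ.suc n} h = cong₂ _+_ (h zero) (sum-zero (λ i → h (suc i)))

sum-only : ∀ {n} i {f : Fin n → ℚ} → (∀ k → k ≢ i → f k ≡ 0ℚ) → sum f ≡ f i
sum-only {ℕ.suc n} zero {f} h = trans
  (cong (λ z → f zero + z) (sum-zero (λ k → h (suc k) λ ()))) (+-identityʳ (f zero))
sum-only {ℕ.suc n} (suc i) {f} h = trans
  (cong₂ _+_ (h zero λ ()) (sum-only i λ k k≢i → h (suc k) λ { refl → k≢i refl }))
  (+-identityˡ (f (suc i)))

sum-nonneg : ∀ {n} {f : Fin n → ℚ} → (∀ i → 0ℚ ≤ f i) → 0ℚ ≤ sum f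
sum-nonneg {ℕ.zero}  h = ≤-refl
sum-nonneg {ℕ.suc n} h = 0≤+ (h zero) (sum-nonneg (λ i → h (suc i)))

sum-nonneg-zero : ∀ {n} {f : Fin n → ℚ} → (∀ i → 0ℚ ≤ f i) → sum f ≡ 0ℚ → ∀ i → f i ≡ 0ℚ
sum-nonneg-zero {ℕ.suc n} h e zero =
  proj₁ (+-zero-split (h zero) (sum-nonneg (λ i → h (suc i))) e)
sum-nonneg-zero {ℕ.suc n} h e (suc i) = sum-nonneg-zero (λ i → h (suc i))
  (proj₂ (+-zero-split (h zero) (sum-nonneg (λ i → h (suc i))) e)) i

sum-*ˡ : ∀ {n} k (f : Fin n → ℚ) → sum (λ i → k * f i) ≡ k * sum f
sum-*ˡ {ℕ.zero}  k f = sym (*-zeroʳ k)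
sum-*ˡ {ℕ.suc n} k f = trans (cong (λ z → k * f zero + z) (sum-*ˡ k (λ i → f (suc i))))
  (sym (*-distribˡ-+ k (f zero) _))

sum-- : ∀ {n} (f g : Fin n → ℚ) → sum (λ i → f i - g i) ≡ sum f - sum g
sum-- {ℕ.zero}  f g = refl
sum-- {ℕ.suc n} f g = trans (cong (λ z → f zero - g zero + z) (sum-- (λ i → f (suc i)) (λ i → g (suc i))))
  (solve 4 (λ a b c d → a :- b :+ (c :- d) := a :+ c :- (b :+ d)) refl (f zero) (g zero) _ _)

sum-blocks : ∀ m (f : Fin (m ℕ.* 4) → ℚ) →
             sum f ≡ sum (λ i → Σ₄ (λ c → f (combine {m} i c)))
sum-blocks ℕ.zero    f = refl
sum-blocks (ℕ.suc m) f = trans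
  (cong (λ s → f 0F + (f 1F + (f 2F + (f 3F + s)))) (sum-blocks m (λ k → f (suc (suc (suc (suc k)))))))
  (solve 5 (λ a b c d s → a :+ (b :+ (c :+ (d :+ s))) := a :+ (b :+ (c :+ d)) :+ s) refl
    (f 0F) (f 1F) (f 2F) (f 3F) _)

basis-refl : ∀ {m} (i : Fin m) → basis i i ≡ 1ℚ
basis-refl i rewrite dec-true (i ≟ i) refl = refl

basis-≢ : ∀ {m} {i j : Fin m} → i ≢ j → basis i j ≡ 0ℚ
basis-≢ {i = i} {j} i≢j rewrite dec-false (i ≟ j) i≢j = refl

-- Barycentric coordinates, sorted by level

Weights : ℕ → Set
Weights m = Fin m → Fin 4 → ℚ

Supported : ∀ {m} → VertexSet m → Weights m → Set
Supported {m} τ w = ∀ i c → combine {m} i c ∉ τ → w i c ≡ 0ℚ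

sumX sumY : ∀ {m} → Weights m → ℚ
sumX w = sum (λ i → w i 1F + w i 3F)
sumY w = sum (λ i → w i 2F + w i 3F)

-- Normalisation is left out, since the coefficients sum to the sum of `h`; `Rep⇒conv` asks for it
-- separately.
record Rep {m} (τ : VertexSet m) (x y : ℚ) (h : Fin m → ℚ) (w : Weights m) : Set where
  field
    nonneg : ∀ i c → 0ℚ ≤ w i c
    supp   : Supported τ w
    horiz  : sumX w ≡ x
    vert   : sumY w ≡ y
    levels : ∀ i → Σ₄ (w i) ≡ h i

point : ∀ {m} → ℚ → ℚ → (Fin m → ℚ) → Point (2 ℕ.+ m)
point x y h = x ∷ᵛ (y ∷ᵛ h)

module _ {m : ℕ} where

  vertex-combine : ∀ (i : Fin m) c j → vertex m (combine i c) j ≡ (corner c ++ basis i) j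
  vertex-combine i c j = cong
    (λ p → (corner (proj₂ p) ++ basis (proj₁ p)) j) (remQuot-combine {m} i c)

  module _ (c : Vector ℚ (m ℕ.* 4)) where
    private
      w : Weights m
      w i q = c (combine i q)

    Σ-vertex : ∀ j → sum (λ k → c k * vertex m k j) ≡
               sum (λ i → Σ₄ (λ q → w i q * (corner q ++ basis i) j))
    Σ-vertex j = trans (sum-blocks m _)
      (sum-cong-≗ λ i → Σ₄-cong λ q → cong (w i q *_) (vertex-combine i q j))

    Σ-vertex-X : sum (λ k → c k * vertex m k 0F) ≡ sumX w
    Σ-vertex-X = trans (Σ-vertex 0F) (sum-cong-≗ λ i →
      solve 4 (λ a b c d → a :* con 0ℚ :+ (b :* con 1ℚ :+ (c :* con 0ℚ :+ d :* con 1ℚ)) := b :+ d)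
        refl (w i 0F) (w i 1F) (w i 2F) (w i 3F))

    Σ-vertex-Y : sum (λ k → c k * vertex m k 1F) ≡ sumY w
    Σ-vertex-Y = trans (Σ-vertex 1F) (sum-cong-≗ λ i →
      solve 4 (λ a b c d → a :* con 0ℚ :+ (b :* con 0ℚ :+ (c :* con 1ℚ :+ d :* con 1ℚ)) := c :+ d)
        refl (w i 0F) (w i 1F) (w i 2F) (w i 3F))

    Σ-vertex-level : ∀ l → sum (λ k → c k * vertex m k (suc (suc l))) ≡ Σ₄ (w l)
    Σ-vertex-level l = trans (Σ-vertex (suc (suc l))) (trans
      (sum-only l λ i i≢l → trans (fac i)
        (trans (cong (Σ₄ (w i) *_) (basis-≢ i≢l)) (*-zeroʳ (Σ₄ (w i)))))
      (trans (fac l) (trans (cong (Σ₄ (w l) *_) (basis-refl l)) (*-identityʳ (Σ₄ (w l))))))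
      where
      fac : ∀ i → Σ₄ (λ q → w i q * basis i l) ≡ Σ₄ (w i) * basis i l
      fac i = solve 5 (λ a b c d e → a :* e :+ (b :* e :+ (c :* e :+ d :* e))
                := (a :+ (b :+ (c :+ d))) :* e) refl
                (w i 0F) (w i 1F) (w i 2F) (w i 3F) (basis i l)

  private
    join : Weights m → Vector ℚ (m ℕ.* 4)
    join w k = w (proj₁ (remQuot {m} 4 k)) (proj₂ (remQuot {m} 4 k))

    join-combine : ∀ w i c → join w (combine i c) ≡ w i c
    join-combine w i c = cong (λ p → w (proj₁ p) (proj₂ p)) (remQuot-combine {m} i c)

    on-combine : ∀ {P : Fin (m ℕ.* 4) → Set} → (∀ i c → P (combine {m} i c)) → ∀ k → P k
    on-combine {P} h k = subst P (combine-remQuot {m} 4 k) (h _ _)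

    sumX-cong : ∀ {v w : Weights m} → (∀ i c → v i c ≡ w i c) → sumX v ≡ sumX w
    sumX-cong h = sum-cong-≗ λ i → cong₂ _+_ (h i 1F) (h i 3F)

    sumY-cong : ∀ {v w : Weights m} → (∀ i c → v i c ≡ w i c) → sumY v ≡ sumY w
    sumY-cong h = sum-cong-≗ λ i → cong₂ _+_ (h i 2F) (h i 3F)

  conv⇒Rep : ∀ {x τ} → _∈conv_ (vertex m) x τ →
             ∃[ w ] Rep {m} τ (x 0F) (x 1F) (λ i → x (suc (suc i))) w
  conv⇒Rep {x} (c , c≥0 , supp , _ , comb) = (λ i q → c (combine i q)) , record
    { nonneg = λ i q → c≥0 _
    ; supp   = λ i q → supp _
    ; horiz  = trans (sym (Σ-vertex-X c)) (comb 0F)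
    ; vert   = trans (sym (Σ-vertex-Y c)) (comb 1F)
    ; levels = λ i → trans (sym (Σ-vertex-level c i)) (comb (suc (suc i)))
    }

  Rep⇒conv : ∀ {x τ w} → Rep {m} τ (x 0F) (x 1F) (λ i → x (suc (suc i))) w →
             sum (λ i → x (suc (suc i))) ≡ 1ℚ → _∈conv_ (vertex m) x τ
  Rep⇒conv {x} {τ} {w} r Σ≡1 = join w
    , (λ k → nonneg _ _)
    , on-combine {λ k → k ∉ τ → join w k ≡ 0ℚ} (λ i c ∉τ → trans (join-combine w i c) (supp i c ∉τ))
    , trans (sum-blocks m (join w)) (trans
        (sum-cong-≗ λ i → trans (Σ₄-cong (join-combine w i)) (levels i)) Σ≡1)
    , λ { zero → trans (Σ-vertex-X (join w)) (trans (sumX-cong (join-combine w)) horiz)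
        ; (suc zero) → trans (Σ-vertex-Y (join w)) (trans (sumY-cong (join-combine w)) vert)
        ; (suc (suc l)) → trans (Σ-vertex-level (join w) l)
                            (trans (Σ₄-cong (join-combine w l)) (levels l)) }
    where open Rep r

  -- Affine independence without the condition that all coefficients sum to 0, which the level sums
  -- imply.
  Independent : VertexSet m → Set
  Independent τ = ∀ (w : Weights m) → Supported τ w → sumX w ≡ 0ℚ → sumY w ≡ 0ℚ →
                  (∀ i → Σ₄ (w i) ≡ 0ℚ) → ∀ i c → w i c ≡ 0ℚ

  affine⇒Independent : ∀ {τ} → AffinelyIndependent (vertex m) τ → Independent τ
  affine⇒Independent {τ} ai w supp hx hy hl i c = trans (sym (join-combine w i c))
    (ai (join w)
      (on-combine {λ k → k ∉ τ → join w k ≡ 0ℚ} (λ i c ∉τ → trans (join-combine w i c) (supp i c ∉τ)))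
      (trans (sum-blocks m (join w))
        (sum-zero λ i → trans (Σ₄-cong (join-combine w i)) (hl i)))
      (λ { zero → trans (Σ-vertex-X (join w)) (trans (sumX-cong (join-combine w)) hx)
         ; (suc zero) → trans (Σ-vertex-Y (join w)) (trans (sumY-cong (join-combine w)) hy)
         ; (suc (suc l)) → trans (Σ-vertex-level (join w) l)
                             (trans (Σ₄-cong (join-combine w l)) (hl l)) })
      (combine i c))

  Independent⇒affine : ∀ {τ} → Independent τ → AffinelyIndependent (vertex m) τ
  Independent⇒affine {τ} ind c supp _ comb = on-combine λ i q →
    ind (λ i q → c (combine i q)) (λ i q → supp _)
      (trans (sym (Σ-vertex-X c)) (comb 0F))
      (trans (sym (Σ-vertex-Y c)) (comb 1F))
      (λ l → trans (sym (Σ-vertex-level c l)) (comb (suc (suc l)))) i q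

  private
    rearr : ∀ a b c d → (a - c) + (b - d) ≡ (a + b) - (c + d)
    rearr = solve 4 (λ a b c d → (a :- c) :+ (b :- d) := (a :+ b) :- (c :+ d)) refl

  module _ (v w : Weights m) where
    diff : Weights m
    diff i c = v i c - w i c

    diff-X : sumX diff ≡ sumX v - sumX w
    diff-X = trans (sum-cong-≗ λ i → rearr (v i 1F) (v i 3F) (w i 1F) (w i 3F)) (sum-- {m} _ _)

    diff-Y : sumY diff ≡ sumY v - sumY w
    diff-Y = trans (sum-cong-≗ λ i → rearr (v i 2F) (v i 3F) (w i 2F) (w i 3F)) (sum-- {m} _ _)

    diff-Σ₄ : ∀ i → Σ₄ (diff i) ≡ Σ₄ (v i) - Σ₄ (w i)
    diff-Σ₄ i = trans (cong (λ z → v i 0F - w i 0F + z) (trans (cong (λ z → v i 1F - w i 1F + z)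
      (rearr (v i 2F) (v i 3F) (w i 2F) (w i 3F))) (rearr (v i 1F) _ (w i 1F) _)))
      (rearr (v i 0F) _ (w i 0F) _)

  Rep-unique : ∀ {τ x y h v w} → Independent τ → Rep {m} τ x y h v → Rep {m} τ x y h w →
               ∀ i c → v i c ≡ w i c
  Rep-unique {v = v} {w} ind r s i c = p-q≡0⁻¹ (ind (diff v w)
    (λ i c ∉τ → p-q≡0 (trans (Rep.supp r i c ∉τ) (sym (Rep.supp s i c ∉τ))))
    (trans (diff-X v w) (p-q≡0 (trans (Rep.horiz r) (sym (Rep.horiz s)))))
    (trans (diff-Y v w) (p-q≡0 (trans (Rep.vert r) (sym (Rep.vert s)))))
    (λ i → trans (diff-Σ₄ v w i) (p-q≡0 (trans (Rep.levels r i) (sym (Rep.levels s i)))))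
    i c)

  Rep-mono : ∀ {σ τ x y h w} → σ ⊆ τ → Rep {m} σ x y h w → Rep {m} τ x y h w
  Rep-mono σ⊆τ r = record
    { nonneg = nonneg
    ; supp   = λ i c ∉τ → supp i c (λ ∈σ → ∉τ (σ⊆τ ∈σ))
    ; horiz = horiz ; vert = vert ; levels = levels }
    where open Rep r

  -- Meeting face to face makes the coordinates of a point independent of the
  -- simplex of the triangulation in which they are taken.
  module _ {T} (tri : Triangulates m T) where
    open IsTriangulation tri

    independent : ∀ {τ} → τ ∈ˡ T → Independent τ
    independent τ∈T = affine⇒Independent (proj₂ (simplices τ∈T))

    coordinates-unique : ∀ {σ τ x y h v w} → σ ∈ˡ T → τ ∈ˡ T → sum h ≡ 1ℚ →
      Rep {m} σ x y h v → Rep {m} τ x y h w → ∀ i c → v i c ≡ w i c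
    coordinates-unique {x = x} {y} {h} σ∈T τ∈T Σh r s i c =
      let (F , F⊆σ , F⊆τ , meet) = faceToFace σ∈T τ∈T
          (u , t) = conv⇒Rep (Equivalence.to (meet (point x y h)) (Rep⇒conv r Σh , Rep⇒conv s Σh))
      in trans (Rep-unique (independent σ∈T) r (Rep-mono F⊆σ t) i c)
               (Rep-unique (independent τ∈T) (Rep-mono F⊆τ t) s i c)

    covered : ∀ {x y h} → 0ℚ ≤ x → x ≤ 1ℚ → 0ℚ ≤ y → y ≤ 1ℚ → (∀ i → 0ℚ ≤ h i) → sum h ≡ 1ℚ →
      ∃[ τ ] ∃[ w ] (τ ∈ˡ T × Rep {m} τ x y h w)
    covered {x} {y} {h} 0≤x x≤1 0≤y y≤1 0≤h Σh =
      let any = Equivalence.to (union (point x y h))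
                  ((λ { 0F → 0≤x , x≤1 ; 1F → 0≤y , y≤1 }) , 0≤h , Σh)
          (τ , τ∈T , cv) = find any
          (w , r) = conv⇒Rep cv
      in τ , w , τ∈T , r

-- Affine independence bounds the type

module _ {m} {τ : VertexSet m} where
  ∈level : ∀ {i c} → c ∈ level m τ i → combine i c ∈ τ
  ∈level {i} {c} c∈ = lookup⇒[]= (combine i c) τ
    (trans (sym (lookup∘tabulate (λ c → Vec.lookup τ (combine {m} i c)) c)) ([]=⇒lookup c∈))

  ∈level⁻¹ : ∀ {i c} → combine i c ∈ τ → c ∈ level m τ i
  ∈level⁻¹ {i} {c} c∈ = lookup⇒[]= c (level m τ i)
    (trans (lookup∘tabulate (λ c → Vec.lookup τ (combine {m} i c)) c) ([]=⇒lookup c∈))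

pick₁ : ∀ {n} (s : Subset n) → 1 ℕ.≤ ∣ s ∣ → ∃ (_∈ s)
pick₁ (true  ∷ s) h = zero , here
pick₁ (false ∷ s) h = let (a , a∈) = pick₁ s h in suc a , there a∈

pick₂ : ∀ {n} (s : Subset n) → 2 ℕ.≤ ∣ s ∣ → ∃[ a ] ∃[ b ] (a ≢ b × a ∈ s × b ∈ s)
pick₂ (true  ∷ s) (s≤s h) = let (b , b∈) = pick₁ s h in
  zero , suc b , (λ ()) , here , there b∈
pick₂ (false ∷ s) h = let (a , b , a≢b , a∈ , b∈) = pick₂ s h in
  suc a , suc b , (λ e → a≢b (suc-injective e)) , there a∈ , there b∈

pick₃ : ∀ {n} (s : Subset n) → 3 ℕ.≤ ∣ s ∣ →
  ∃[ a ] ∃[ b ] ∃[ c ] (a ≢ b × a ≢ c × b ≢ c × a ∈ s × b ∈ s × c ∈ s)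
pick₃ (true  ∷ s) (s≤s h) = let (b , c , b≢c , b∈ , c∈) = pick₂ s h in
  zero , suc b , suc c , (λ ()) , (λ ()) , (λ e → b≢c (suc-injective e)) , here , there b∈ , there c∈
pick₃ (false ∷ s) h = let (a , b , c , a≢b , a≢c , b≢c , a∈ , b∈ , c∈) = pick₃ s h in
  suc a , suc b , suc c , (λ e → a≢b (suc-injective e)) , (λ e → a≢c (suc-injective e)) ,
  (λ e → b≢c (suc-injective e)) , there a∈ , there b∈ , there c∈

-- Three displacements within levels live in the plane, so they are dependent.
module Dependence {m} {τ : VertexSet m} (ind : Independent {m} τ)
  (u v w : Weights m) (su : Supported τ u) (sv : Supported τ v) (sw : Supported τ w)
  (lu : ∀ i → Σ₄ (u i) ≡ 0ℚ) (lv : ∀ i → Σ₄ (v i) ≡ 0ℚ) (lw : ∀ i → Σ₄ (w i) ≡ 0ℚ)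
  (i j k : Fin m) (a b c : Fin 4)
  (uia : u i a ≡ 1ℚ) (via : v i a ≡ 0ℚ) (wia : w i a ≡ 0ℚ)
  (ujb : u j b ≡ 0ℚ) (vjb : v j b ≡ 1ℚ) (wjb : w j b ≡ 0ℚ)
  (ukc : u k c ≡ 0ℚ) (vkc : v k c ≡ 0ℚ) (wkc : w k c ≡ 1ℚ) where

  private
    X₁ = sumX u
    X₂ = sumX v
    X₃ = sumX w
    Y₁ = sumY u
    Y₂ = sumY v
    Y₃ = sumY w

    module _ (α β γ : ℚ) where
      z : Weights m
      z i c = α * u i c + (β * v i c + γ * w i c)

      lin₂ : ∀ p q → sum (λ i → z i p + z i q) ≡
        α * sum (λ i → u i p + u i q) + (β * sum (λ i → v i p + v i q) + γ * sum (λ i → w i p + w i q))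
      lin₂ p q = trans
        (sum-cong-≗ {m} λ i → solve 9
          (λ α β γ a b c a′ b′ c′ → (α :* a :+ (β :* b :+ γ :* c)) :+ (α :* a′ :+ (β :* b′ :+ γ :* c′))
            := α :* (a :+ a′) :+ (β :* (b :+ b′) :+ γ :* (c :+ c′))) refl
          α β γ (u i p) (v i p) (w i p) (u i q) (v i q) (w i q))
        (trans (∑-distrib-+ {m} (λ i → α * (u i p + u i q)) _)
          (cong₂ _+_ (sum-*ˡ {m} α _) (trans (∑-distrib-+ {m} (λ i → β * (v i p + v i q)) _)
            (cong₂ _+_ (sum-*ˡ {m} β _) (sum-*ˡ {m} γ _)))))

      z-zero : α * X₁ + (β * X₂ + γ * X₃) ≡ 0ℚ → α * Y₁ + (β * Y₂ + γ * Y₃) ≡ 0ℚ →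
               ∀ i c → z i c ≡ 0ℚ
      z-zero hX hY = ind z
        (λ i c ∉τ → trans
          (cong₂ _+_ (cong (α *_) (su i c ∉τ)) (cong₂ _+_ (cong (β *_) (sv i c ∉τ)) (cong (γ *_) (sw i c ∉τ))))
          (solve 3 (λ α β γ → α :* con 0ℚ :+ (β :* con 0ℚ :+ γ :* con 0ℚ) := con 0ℚ) refl α β γ))
        (trans (lin₂ 1F 3F) hX) (trans (lin₂ 2F 3F) hY)
        (λ i → by₃ α (lu i) β (lv i) γ (lw i) (lev i))
        where
        lev : ∀ i → Σ₄ (z i) ≡ 0ℚ + α * (Σ₄ (u i) - 0ℚ) + β * (Σ₄ (v i) - 0ℚ) + γ * (Σ₄ (w i) - 0ℚ)
        lev i = solve 15 (λ α β γ u₀ u₁ u₂ u₃ v₀ v₁ v₂ v₃ w₀ w₁ w₂ w₃ →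
            (α :* u₀ :+ (β :* v₀ :+ γ :* w₀)) :+ ((α :* u₁ :+ (β :* v₁ :+ γ :* w₁))
            :+ ((α :* u₂ :+ (β :* v₂ :+ γ :* w₂)) :+ (α :* u₃ :+ (β :* v₃ :+ γ :* w₃))))
            := con 0ℚ :+ α :* (u₀ :+ (u₁ :+ (u₂ :+ u₃)) :- con 0ℚ)
               :+ β :* (v₀ :+ (v₁ :+ (v₂ :+ v₃)) :- con 0ℚ)
               :+ γ :* (w₀ :+ (w₁ :+ (w₂ :+ w₃)) :- con 0ℚ)) refl
          α β γ (u i 0F) (u i 1F) (u i 2F) (u i 3F) (v i 0F) (v i 1F) (v i 2F) (v i 3F)
          (w i 0F) (w i 1F) (w i 2F) (w i 3F)

      private
        at : ∀ {x y z} p q r → x ≡ p → y ≡ q → z ≡ r → α * x + (β * y + γ * z) ≡ α * p + (β * q + γ * r)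
        at _ _ _ refl refl refl = refl

      trivial : α * X₁ + (β * X₂ + γ * X₃) ≡ 0ℚ → α * Y₁ + (β * Y₂ + γ * Y₃) ≡ 0ℚ →
                α ≡ 0ℚ × β ≡ 0ℚ × γ ≡ 0ℚ
      trivial hX hY =
          trans (solve 3 (λ α β γ → α := α :* con 1ℚ :+ (β :* con 0ℚ :+ γ :* con 0ℚ)) refl α β γ)
            (trans (sym (at 1ℚ 0ℚ 0ℚ uia via wia)) (z-zero hX hY i a))
        , trans (solve 3 (λ α β γ → β := α :* con 0ℚ :+ (β :* con 1ℚ :+ γ :* con 0ℚ)) refl α β γ)
            (trans (sym (at 0ℚ 1ℚ 0ℚ ujb vjb wjb)) (z-zero hX hY j b))
        , trans (solve 3 (λ α β γ → γ := α :* con 0ℚ :+ (β :* con 0ℚ :+ γ :* con 1ℚ)) refl α β γ)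
            (trans (sym (at 0ℚ 0ℚ 1ℚ ukc vkc wkc)) (z-zero hX hY k c))

  -- By `trivial`, every vanishing combination of the three displacements has zero coefficients. The
  -- cofactors give X₁ Y₂ = X₂ Y₁; then (Y₂, -Y₁, 0) and (-X₂, X₁, 0) give Y₁ = 0 and X₁ = 0,
  -- whereupon (1, 0, 0) is itself a vanishing combination.
  absurd : ⊥
  absurd = 1≢0 (proj₁ (trivial 1ℚ 0ℚ 0ℚ (unit X₂ X₃ X₁≡0) (unit Y₂ Y₃ Y₁≡0)))
    where
    unit : ∀ {x} y z → x ≡ 0ℚ → 1ℚ * x + (0ℚ * y + 0ℚ * z) ≡ 0ℚ
    unit y z refl = solve 2 (λ y z → con 1ℚ :* con 0ℚ :+ (con 0ℚ :* y :+ con 0ℚ :* z) := con 0ℚ) refl y z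
    -- Cramer's rule
    D₁₂≡0 : X₁ * Y₂ - X₂ * Y₁ ≡ 0ℚ
    D₁₂≡0 = proj₂ (proj₂ (trivial (X₂ * Y₃ - X₃ * Y₂) (X₃ * Y₁ - X₁ * Y₃) (X₁ * Y₂ - X₂ * Y₁)
      (solve 6 (λ x₁ x₂ x₃ y₁ y₂ y₃ → (x₂ :* y₃ :- x₃ :* y₂) :* x₁ :+ ((x₃ :* y₁ :- x₁ :* y₃) :* x₂
         :+ (x₁ :* y₂ :- x₂ :* y₁) :* x₃) := con 0ℚ) refl X₁ X₂ X₃ Y₁ Y₂ Y₃)
      (solve 6 (λ x₁ x₂ x₃ y₁ y₂ y₃ → (x₂ :* y₃ :- x₃ :* y₂) :* y₁ :+ ((x₃ :* y₁ :- x₁ :* y₃) :* y₂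
         :+ (x₁ :* y₂ :- x₂ :* y₁) :* y₃) := con 0ℚ) refl X₁ X₂ X₃ Y₁ Y₂ Y₃)))
    neg≡0 : ∀ {p} → - p ≡ 0ℚ → p ≡ 0ℚ
    neg≡0 {p} e = trans (solve 1 (λ p → p := :- (:- p)) refl p) (cong -_ e)
    Y₁≡0 : Y₁ ≡ 0ℚ
    Y₁≡0 = neg≡0 (proj₁ (proj₂ (trivial Y₂ (- Y₁) 0ℚ
      (trans (solve 5 (λ x₁ x₂ x₃ y₁ y₂ → y₂ :* x₁ :+ ((:- y₁) :* x₂ :+ con 0ℚ :* x₃)
         := x₁ :* y₂ :- x₂ :* y₁) refl X₁ X₂ X₃ Y₁ Y₂) D₁₂≡0)
      (solve 3 (λ y₁ y₂ y₃ → y₂ :* y₁ :+ ((:- y₁) :* y₂ :+ con 0ℚ :* y₃) := con 0ℚ) refl Y₁ Y₂ Y₃))))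
    X₁≡0 : X₁ ≡ 0ℚ
    X₁≡0 = proj₁ (proj₂ (trivial (- X₂) X₁ 0ℚ
      (solve 3 (λ x₁ x₂ x₃ → (:- x₂) :* x₁ :+ (x₁ :* x₂ :+ con 0ℚ :* x₃) := con 0ℚ) refl X₁ X₂ X₃)
      (trans (solve 5 (λ x₁ x₂ y₁ y₂ y₃ → (:- x₂) :* y₁ :+ (x₁ :* y₂ :+ con 0ℚ :* y₃)
         := x₁ :* y₂ :- x₂ :* y₁) refl X₁ X₂ Y₁ Y₂ Y₃) D₁₂≡0)))

edge : Fin 4 → Fin 4 → Fin 4 → ℚ
edge a b c = basis a c - basis b c

Σ₄-basis : ∀ a → Σ₄ (basis a) ≡ 1ℚ
Σ₄-basis 0F = refl
Σ₄-basis 1F = refl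
Σ₄-basis 2F = refl
Σ₄-basis 3F = refl

Σ₄-edge : ∀ a b → Σ₄ (edge a b) ≡ 0ℚ
Σ₄-edge a b = trans
  (solve 8 (λ p q r s p′ q′ r′ s′ → (p :- p′) :+ ((q :- q′) :+ ((r :- r′) :+ (s :- s′)))
    := (p :+ (q :+ (r :+ s))) :- (p′ :+ (q′ :+ (r′ :+ s′)))) refl
    (basis a 0F) (basis a 1F) (basis a 2F) (basis a 3F) (basis b 0F) (basis b 1F) (basis b 2F) (basis b 3F))
  (cong₂ _-_ (Σ₄-basis a) (Σ₄-basis b))

edge-start : ∀ {a b} → a ≢ b → edge a b a ≡ 1ℚ
edge-start {a} a≢b = cong₂ _-_ (basis-refl a) (basis-≢ λ e → a≢b (sym e))

edge-off : ∀ {a b c} → a ≢ c → b ≢ c → edge a b c ≡ 0ℚ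
edge-off a≢c b≢c = cong₂ _-_ (basis-≢ a≢c) (basis-≢ b≢c)

module _ {m : ℕ} where
  spread : Fin m → (Fin 4 → ℚ) → Weights m
  spread i f k c = basis i k * f c

  spread-≢ : ∀ {i k} f c → i ≢ k → spread i f k c ≡ 0ℚ
  spread-≢ f c i≢k = trans (cong (_* f c) (basis-≢ i≢k)) (*-zeroˡ (f c))

  spread-≡ : ∀ i f c → spread i f i c ≡ f c
  spread-≡ i f c = trans (cong (_* f c) (basis-refl i)) (*-identityˡ (f c))

  Σ₄-spread : ∀ i f k → Σ₄ (spread i f k) ≡ basis i k * Σ₄ f
  Σ₄-spread i f k = solve 5 (λ e a b c d → e :* a :+ (e :* b :+ (e :* c :+ e :* d))
      := e :* (a :+ (b :+ (c :+ d)))) refl (basis i k) (f 0F) (f 1F) (f 2F) (f 3F)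

  sum-spread : ∀ i f p q → sum (λ k → spread i f k p + spread i f k q) ≡ f p + f q
  sum-spread i f p q = trans
    (sum-only i λ k k≢i → cong₂ _+_ (spread-≢ f p (λ e → k≢i (sym e))) (spread-≢ f q (λ e → k≢i (sym e))))
    (cong₂ _+_ (spread-≡ i f p) (spread-≡ i f q))

  spread-supp : ∀ {τ : VertexSet m} {i f} → (∀ c → combine i c ∉ τ → f c ≡ 0ℚ) → Supported τ (spread i f)
  spread-supp {i = i} {f} h k c ∉τ with i ≟ k
  ... | yes refl = trans (*-identityˡ (f c)) (h c ∉τ)
  ... | no _     = *-zeroˡ (f c)

  module _ {τ : VertexSet m} (ind : Independent {m} τ) where
    private
      supp : ∀ {i a b} → combine i a ∈ τ → combine i b ∈ τ → Supported τ (spread i (edge a b))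
      supp {i} {a} {b} a∈ b∈ = spread-supp {τ} {i} {edge a b} λ c c∉ → edge-off {a} {b} {c}
        (λ { refl → c∉ a∈ }) (λ { refl → c∉ b∈ })

      lev : ∀ i a b k → Σ₄ (spread i (edge a b) k) ≡ 0ℚ
      lev i a b k = trans (Σ₄-spread i (edge a b) k)
        (trans (cong (basis i k *_) (Σ₄-edge a b)) (*-zeroʳ (basis i k)))

      on : ∀ i {a b} → a ≢ b → spread i (edge a b) i a ≡ 1ℚ
      on i {a} {b} a≢b = trans (spread-≡ i (edge a b) a) (edge-start a≢b)

      T = simplexType m τ

      2≤ : ∀ {i} → 1 ℕ.≤ T i → 2 ℕ.≤ ∣ level m τ i ∣
      2≤ {i} h = ℕₚ.≤-trans (ℕₚ.+-monoʳ-≤ 1 h) (ℕₚ.≤-reflexive (ℕₚ.m+[n∸m]≡n (ℕₚ.≤-trans h (ℕₚ.m∸n≤m _ 1))))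

      3≤ : ∀ {i} → 2 ℕ.≤ T i → 3 ℕ.≤ ∣ level m τ i ∣
      3≤ {i} h = ℕₚ.≤-trans (ℕₚ.+-monoʳ-≤ 1 h) (ℕₚ.≤-reflexive
        (ℕₚ.m+[n∸m]≡n (ℕₚ.≤-trans (ℕₚ.≤-trans (ℕₚ.n≤1+n 1) h) (ℕₚ.m∸n≤m _ 1))))

    -- The three edges are the displacements of `Dependence`: at its own starting corner each is 1,
    -- while the two others live on different levels.
    no-three-edges : ∀ {i j k} → i ≢ j → i ≢ k → j ≢ k → 1 ℕ.≤ T i → 1 ℕ.≤ T j → 1 ℕ.≤ T k → ⊥
    no-three-edges {i} {j} {k} i≢j i≢k j≢k hi hj hk =
      let (a , a′ , a≢ , a∈ , a′∈) = pick₂ (level m τ i) (2≤ hi)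
          (b , b′ , b≢ , b∈ , b′∈) = pick₂ (level m τ j) (2≤ hj)
          (c , c′ , c≢ , c∈ , c′∈) = pick₂ (level m τ k) (2≤ hk)
          off = λ {i k} (i≢k : i ≢ k) a b c → spread-≢ {i} {k} (edge a b) c i≢k
      in Dependence.absurd {m} {τ} ind
        (spread i (edge a a′)) (spread j (edge b b′)) (spread k (edge c c′))
        (supp (∈level {m} {τ} a∈) (∈level {m} {τ} a′∈)) (supp (∈level {m} {τ} b∈) (∈level {m} {τ} b′∈))
        (supp (∈level {m} {τ} c∈) (∈level {m} {τ} c′∈))
        (lev i a a′) (lev j b b′) (lev k c c′) i j k a b c
        (on i a≢) (off (≢-sym i≢j) b b′ a) (off (≢-sym i≢k) c c′ a)
        (off i≢j a a′ b) (on j b≢) (off (≢-sym j≢k) c c′ b)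
        (off i≢k a a′ c) (off j≢k b b′ c) (on k c≢)

    -- Two edges of the triangle from a common corner `o` and the edge of the other level are three
    -- displacements.
    no-triangle-edge : ∀ {i j} → i ≢ j → 2 ℕ.≤ T i → 1 ℕ.≤ T j → ⊥
    no-triangle-edge {i} {j} i≢j hi hj =
      let (a , b , o , a≢b , a≢o , b≢o , a∈ , b∈ , o∈) = pick₃ (level m τ i) (3≤ hi)
          (c , c′ , c≢ , c∈ , c′∈) = pick₂ (level m τ j) (2≤ hj)
          off = λ {i k} (i≢k : i ≢ k) a b c → spread-≢ {i} {k} (edge a b) c i≢k
      in Dependence.absurd {m} {τ} ind
        (spread i (edge a o)) (spread i (edge b o)) (spread j (edge c c′))
        (supp (∈level {m} {τ} a∈) (∈level {m} {τ} o∈)) (supp (∈level {m} {τ} b∈) (∈level {m} {τ} o∈))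
        (supp (∈level {m} {τ} c∈) (∈level {m} {τ} c′∈))
        (lev i a o) (lev i b o) (lev j c c′) i i j a b c
        (on i a≢o) (trans (spread-≡ i (edge b o) a) (edge-off (≢-sym a≢b) (≢-sym a≢o)))
        (off (≢-sym i≢j) c c′ a)
        (trans (spread-≡ i (edge a o) b) (edge-off a≢b (≢-sym b≢o))) (on i b≢o)
        (off (≢-sym i≢j) c c′ b)
        (off i≢j a o c) (off i≢j b o c) (on j c≢)

    -- The corners of a square satisfy the affine relation 00 - 10 - 01 + 11 = 0.
    not-full : ∀ i → ¬ (∀ c → combine i c ∈ τ)
    not-full i full = 1≢0 (trans (sym (spread-≡ i alt 0F)) (ind (spread i alt)
      (spread-supp {τ} {i} {alt} λ c c∉ → ⊥-elim (c∉ (full c)))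
      (sum-spread i alt 1F 3F) (sum-spread i alt 2F 3F)
      (λ k → trans (Σ₄-spread i alt k) (*-zeroʳ (basis i k))) i 0F))
      where
      alt : Fin 4 → ℚ
      alt 0F = 1ℚ
      alt 1F = - 1ℚ
      alt 2F = - 1ℚ
      alt 3F = 1ℚ

    type≤2 : ∀ i → T i ℕ.≤ 2
    type≤2 i with 4 ℕₚ.≤? ∣ level m τ i ∣
    ... | yes 4≤ = ⊥-elim (not-full i λ c → ∈level {m} {τ}
      (subst (c ∈_) (sym (∣p∣≡n⇒p≡⊤ (ℕₚ.≤-antisym (∣p∣≤n (level m τ i)) 4≤))) ∈⊤))
    ... | no 4≰ = ℕₚ.∸-monoˡ-≤ 1 (ℕₚ.≤-pred (ℕₚ.≰⇒> 4≰))

    private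
      sum-zeroℕ : ∀ {n} {t : Fin n → ℕ} → (∀ i → ¬ 1 ℕ.≤ t i) → sumℕ t ≡ 0
      sum-zeroℕ {zero} h = refl
      sum-zeroℕ {suc n} {t} h with t zero | h zero
      ... | zero  | _ = sum-zeroℕ (λ i → h (suc i))
      ... | suc _ | p = ⊥-elim (p (s≤s z≤n))

      sum≤1 : ∀ {n} {t : Fin n → ℕ} → (∀ i → t i ℕ.≤ 1) →
        (∀ {i j} → i ≢ j → 1 ℕ.≤ t i → ¬ 1 ℕ.≤ t j) → sumℕ t ℕ.≤ 1
      sum≤1 {zero} _ _ = z≤n
      sum≤1 {suc n} {t} le h with t zero in eq | le zero
      ... | zero | _ = sum≤1 (λ i → le (suc i)) (λ i≢j → h λ { refl → i≢j refl })
      ... | suc zero | _ = ℕₚ.≤-reflexive (cong suc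
        (sum-zeroℕ λ i → h {zero} {suc i} (λ ()) (ℕₚ.≤-reflexive (sym eq))))
      ... | suc (suc _) | s≤s ()

      sum≤2 : ∀ {n} {t : Fin n → ℕ} → (∀ i → t i ℕ.≤ 2) →
        (∀ {i j} → i ≢ j → 2 ℕ.≤ t i → ¬ 1 ℕ.≤ t j) →
        (∀ {i j k} → i ≢ j → i ≢ k → j ≢ k → 1 ℕ.≤ t i → 1 ℕ.≤ t j → ¬ 1 ℕ.≤ t k) → sumℕ t ℕ.≤ 2
      sum≤2 {zero} _ _ _ = z≤n
      sum≤2 {suc n} {t} le h₂ h₃ with t zero in eq | le zero
      ... | zero | _ = sum≤2 (λ i → le (suc i)) (λ i≢j → h₂ λ { refl → i≢j refl })
        (λ i≢j i≢k j≢k → h₃ (λ { refl → i≢j refl }) (λ { refl → i≢k refl }) (λ { refl → j≢k refl }))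
      ... | suc zero | _ = s≤s (sum≤1
        (λ i → ℕₚ.≤-pred (ℕₚ.≰⇒> λ 2≤t → h₂ {suc i} {zero} (λ ()) 2≤t (ℕₚ.≤-reflexive (sym eq))))
        (λ i≢j → h₃ {zero} (λ ()) (λ ()) (λ { refl → i≢j refl }) (ℕₚ.≤-reflexive (sym eq))))
      ... | suc (suc zero) | _ = ℕₚ.≤-reflexive (cong (2 ℕ.+_)
        (sum-zeroℕ λ i → h₂ {zero} {suc i} (λ ()) (ℕₚ.≤-reflexive (sym eq))))
      ... | suc (suc (suc _)) | s≤s (s≤s ())

    -- The exclusions above leave a single entry 2, or at most two entries 1, among zeros.
    rank≤2 : sumℕ T ℕ.≤ 2
    rank≤2 = sum≤2 type≤2 no-triangle-edge no-three-edges

-- Weights of simplices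

two pos : ℕ → ℕ
two (suc (suc _)) = 1
two _             = 0
pos zero    = 0
pos (suc _) = 1

-- The ordered pairs of levels that a simplex of type t serves: (i , i) if
-- tᵢ = 2 and (i , j) if tᵢ = tⱼ = 1.
serves : ∀ {m} → (Fin m → ℕ) → Fin m → Fin m → ℕ
serves t i j = if does (i ≟ j) then two (t i) else pos (t i) ℕ.* pos (t j)

Σserves : ∀ {m} → (Fin m → ℕ) → ℕ
Σserves t = sumℕ (λ i → sumℕ (serves t i))

private
  ∏! : ∀ {m} → (Fin m → ℕ) → ℕ
  ∏! t = product (List.tabulate (λ i → t i !))

  tl : ∀ {m} → (Fin (suc m) → ℕ) → Fin m → ℕ
  tl t i = t (suc i)

  sumℕ-0 : ∀ {n} {f : Fin n → ℕ} → (∀ i → f i ≡ 0) → sumℕ f ≡ 0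
  sumℕ-0 {zero}  h = refl
  sumℕ-0 {suc n} h = cong₂ ℕ._+_ (h zero) (sumℕ-0 (λ i → h (suc i)))

  sumℕ-+ : ∀ {n} (f g : Fin n → ℕ) → sumℕ (λ i → f i ℕ.+ g i) ≡ sumℕ f ℕ.+ sumℕ g
  sumℕ-+ = ℕ∑-distrib-+

  Σserves-suc : ∀ {m} (t : Fin (suc m) → ℕ) → Σserves t ≡
    two (t zero) ℕ.+ sumℕ (λ j → pos (t zero) ℕ.* pos (tl t j)) ℕ.+
    (sumℕ (λ i → pos (tl t i) ℕ.* pos (t zero)) ℕ.+ Σserves (tl t))
  Σserves-suc t = cong (two (t zero) ℕ.+ sumℕ (λ j → pos (t zero) ℕ.* pos (tl t j)) ℕ.+_)
    (sumℕ-+ (λ i → pos (tl t i) ℕ.* pos (t zero)) (λ i → sumℕ (serves (tl t) i)))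

  -- What an induction on the levels has to remember about the tail: a head of type 1 forms a served
  -- pair, in both orders, with every positive level that follows.
  Small : ∀ {m} → (Fin m → ℕ) → ℕ → ℕ → ℕ → Set
  Small t a b c = sumℕ (λ i → pos (t i)) ℕ.≤ a × Σserves t ℕ.≤ b × ∏! t ≡ c

  small₀ : ∀ {m} (t : Fin m → ℕ) → sumℕ t ℕ.≤ 0 → Small t 0 0 1
  small₀ {zero}  t h = z≤n , z≤n , refl
  small₀ {suc m} t h with t zero | Σserves-suc t | h
  ... | zero | e | h′ =
    let (p , s , q) = small₀ (tl t) h′ in
    p , ℕₚ.≤-trans (ℕₚ.≤-reflexive e)
      (ℕₚ.+-mono-≤ (ℕₚ.≤-reflexive (sumℕ-0 {m} λ _ → refl))
        (ℕₚ.+-mono-≤ (ℕₚ.≤-reflexive (sumℕ-0 {m} λ i → ℕₚ.*-zeroʳ (pos (tl t i)))) s)) ,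
    trans (ℕₚ.+-identityʳ _) q

  small₁ : ∀ {m} (t : Fin m → ℕ) → sumℕ t ℕ.≤ 1 → Small t 1 0 1
  small₁ {zero}  t h = z≤n , z≤n , refl
  small₁ {suc m} t h with t zero | Σserves-suc t | h
  ... | zero | e | h′ =
    let (p , s , q) = small₁ (tl t) h′ in
    p , ℕₚ.≤-trans (ℕₚ.≤-reflexive e)
      (ℕₚ.+-mono-≤ (ℕₚ.≤-reflexive (sumℕ-0 {m} λ _ → refl))
        (ℕₚ.+-mono-≤ (ℕₚ.≤-reflexive (sumℕ-0 {m} λ i → ℕₚ.*-zeroʳ (pos (tl t i)))) s)) ,
    trans (ℕₚ.+-identityʳ _) q
  ... | suc zero | e | s≤s h′ =
    let (p , s , q) = small₀ (tl t) h′ in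
    s≤s p , ℕₚ.≤-trans (ℕₚ.≤-reflexive e)
      (ℕₚ.+-mono-≤ (ℕₚ.≤-trans (ℕₚ.≤-reflexive (sumℕ-cong {m} λ i → ℕₚ.*-identityˡ (pos (tl t i)))) p)
        (ℕₚ.+-mono-≤ (ℕₚ.≤-trans (ℕₚ.≤-reflexive (sumℕ-cong {m} λ i → ℕₚ.*-identityʳ (pos (tl t i)))) p) s)) ,
    trans (ℕₚ.+-identityʳ _) q
  ... | suc (suc _) | e | s≤s ()

  -- Apart from smaller ones the types are a single 2, serving one pair with product of factorials
  -- 2, and two entries 1, serving a pair in both orders with product 1.
  small₂ : ∀ {m} (t : Fin m → ℕ) → sumℕ t ℕ.≤ 2 → Σserves t ℕ.* ∏! t ℕ.≤ 2
  small₂ {zero}  t h = z≤n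
  small₂ {suc m} t h with t zero | Σserves-suc t | h
  ... | zero | e | h′ = ℕₚ.≤-trans (ℕₚ.≤-reflexive (cong₂ ℕ._*_
      (trans e (cong₂ ℕ._+_ (sumℕ-0 {m} λ _ → refl)
        (cong (ℕ._+ Σserves (tl t)) (sumℕ-0 {m} λ i → ℕₚ.*-zeroʳ (pos (tl t i))))))
      (ℕₚ.*-identityˡ _))) (small₂ (tl t) h′)
  ... | suc zero | e | s≤s h′ =
    let (p , s , q) = small₁ (tl t) h′ in
    ℕₚ.≤-trans (ℕₚ.≤-reflexive (cong₂ ℕ._*_ e (trans (ℕₚ.*-identityˡ _) q)))
      (ℕₚ.≤-trans (ℕₚ.≤-reflexive (ℕₚ.*-identityʳ _))
      (ℕₚ.+-mono-≤ (ℕₚ.≤-trans (ℕₚ.≤-reflexive (sumℕ-cong {m} λ i → ℕₚ.*-identityˡ (pos (tl t i)))) p)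
        (ℕₚ.+-mono-≤ (ℕₚ.≤-trans (ℕₚ.≤-reflexive (sumℕ-cong {m} λ i → ℕₚ.*-identityʳ (pos (tl t i)))) p) s)))
  ... | suc (suc zero) | e | s≤s (s≤s h′) =
    let (p , s , q) = small₀ (tl t) h′ in
    ℕₚ.*-mono-≤ {y = 1} {v = 2}
      (ℕₚ.≤-trans (ℕₚ.≤-reflexive e)
        (ℕₚ.+-mono-≤ {y = 1} (s≤s (ℕₚ.≤-trans (ℕₚ.≤-reflexive (sumℕ-cong {m} λ i → ℕₚ.*-identityˡ (pos (tl t i)))) p))
          (ℕₚ.+-mono-≤ (ℕₚ.≤-trans (ℕₚ.≤-reflexive (sumℕ-cong {m} λ i → ℕₚ.*-identityʳ (pos (tl t i)))) p) s)))
      (ℕₚ.≤-reflexive (cong (2 ℕ.*_) q))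
  ... | suc (suc (suc _)) | e | s≤s (s≤s ())

ι : ℕ → ℚ
ι n = + n / 1

toℚᵘ-/ : ∀ i n .{{_ : ℕ.NonZero n}} → ℚ.toℚᵘ (i / n) ℚᵘ.≃ (i ℚᵘ./ n)
toℚᵘ-/ i (suc n) = ℚₚ.toℚᵘ-fromℚᵘ (ℚᵘ.mkℚᵘ i n)

ι-+ : ∀ a b → ι (a ℕ.+ b) ≡ ι a + ι b
ι-+ a b = ℚₚ.toℚᵘ-injective (ℚᵘₚ.≃-trans (toℚᵘ-/ (+ (a ℕ.+ b)) 1) (ℚᵘₚ.≃-trans
  (ℚᵘ.*≡* (cong (ℤ._* + 1) (sym (cong₂ ℤ._+_ (ℤₚ.*-identityʳ (+ a)) (ℤₚ.*-identityʳ (+ b))))))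
  (ℚᵘₚ.≃-sym (ℚᵘₚ.≃-trans (ℚₚ.toℚᵘ-homo-+ (ι a) (ι b))
    (ℚᵘₚ.+-cong (toℚᵘ-/ (+ a) 1) (toℚᵘ-/ (+ b) 1))))))

ι-* : ∀ a b → ι (a ℕ.* b) ≡ ι a * ι b
ι-* a b = ℚₚ.toℚᵘ-injective (ℚᵘₚ.≃-trans (toℚᵘ-/ (+ (a ℕ.* b)) 1) (ℚᵘₚ.≃-trans
  (ℚᵘ.*≡* (cong (ℤ._* + 1) (ℤₚ.pos-* a b)))
  (ℚᵘₚ.≃-sym (ℚᵘₚ.≃-trans (ℚₚ.toℚᵘ-homo-* (ι a) (ι b))
    (ℚᵘₚ.*-cong (toℚᵘ-/ (+ a) 1) (toℚᵘ-/ (+ b) 1))))))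

0≤ι : ∀ n → 0ℚ ≤ ι n
0≤ι n = nonNegative⁻¹ (ι n) {{normalize-nonNeg n 1}}

ι-mono : ∀ {a b} → a ℕ.≤ b → ι a ≤ ι b
ι-mono {a} {b} a≤b = ≤-by (ι (b ∸ a)) (0≤ι (b ∸ a))
  (trans (cong ι (sym (ℕₚ.m+[n∸m]≡n a≤b))) (ι-+ a (b ∸ a)))

ι-1/ : ∀ i n .{{_ : ℕ.NonZero n}} → (+ i / n) * ι n ≡ ι i
ι-1/ i n@(suc n′) = ℚₚ.toℚᵘ-injective (ℚᵘₚ.≃-trans (ℚₚ.toℚᵘ-homo-* (+ i / n) (ι n))
  (ℚᵘₚ.≃-trans (ℚᵘₚ.*-cong (toℚᵘ-/ (+ i) n) (toℚᵘ-/ (+ n) 1))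
  (ℚᵘₚ.≃-trans (ℚᵘ.*≡* (trans (ℤₚ.*-identityʳ _) (cong (+ i ℤ.*_) (sym (ℤₚ.*-identityʳ (+ n))))))
    (ℚᵘₚ.≃-sym (toℚᵘ-/ (+ i) 1)))))

0<ι : ∀ n .{{_ : ℕ.NonZero n}} → 0ℚ < ι n
0<ι n = positive⁻¹ (ι n) {{ℚₚ.normalize-pos n 1}}

-- This is `small₂` divided by the product of the factorials.
serves≤weight : ∀ {m} (τ : VertexSet m) → Independent {m} τ →
                ι (Σserves (simplexType m τ)) ≤ ι 2 * weight m τ
serves≤weight {m} τ ind = ℚₚ.*-cancelʳ-≤-pos (ι P) {{ℚ.positive (0<ι P)}} (begin
  ι (Σserves t) * ι P     ≡⟨ sym (ι-* (Σserves t) P) ⟩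
  ι (Σserves t ℕ.* P)     ≤⟨ ι-mono (small₂ t (rank≤2 {m} {τ} ind)) ⟩
  ι 2                     ≡⟨ *-identityʳ (ι 2) ⟨
  ι 2 * 1ℚ                ≡⟨ cong (ι 2 *_) (sym (ι-1/ 1 P)) ⟩
  ι 2 * ((+ 1 / P) * ι P) ≡⟨ *-assoc (ι 2) (+ 1 / P) (ι P) ⟨
  ι 2 * weight m τ * ι P  ∎)
  where
  open ℚₚ.≤-Reasoning
  t = simplexType m τ
  P = ∏! t
  instance
    _ = product≢0 (tabulate⁺ (λ i → ℕₚ._!≢0 (t i)))

-- Points over one or two levels

sum-two : ∀ {n} {i j : Fin n} → i ≢ j → {f : Fin n → ℚ} →
          (∀ k → k ≢ i → k ≢ j → f k ≡ 0ℚ) → sum f ≡ f i + f j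
sum-two {n} {i} {j} i≢j {f} h = trans (sum-cong-≗ {n} split)
  (trans (∑-distrib-+ {n} (λ k → basis i k * f i) (λ k → basis j k * f j))
    (cong₂ _+_ (one i) (one j)))
  where
  one : ∀ i → sum (λ k → basis i k * f i) ≡ f i
  one i = trans (sum-only i λ k k≢i → trans (cong (_* f i) (basis-≢ (≢-sym k≢i))) (*-zeroˡ (f i)))
    (trans (cong (_* f i) (basis-refl i)) (*-identityˡ (f i)))
  split : ∀ k → f k ≡ basis i k * f i + basis j k * f j
  split k with i ≟ k | j ≟ k
  ... | yes refl | yes refl = ⊥-elim (i≢j refl)
  ... | yes refl | no _     = solve 2 (λ p q → p := con 1ℚ :* p :+ con 0ℚ :* q) refl (f i) (f j)
  ... | no _     | yes refl = solve 2 (λ p q → q := con 0ℚ :* p :+ con 1ℚ :* q) refl (f i) (f j)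
  ... | no i≢k   | no j≢k   = trans (h k (≢-sym i≢k) (≢-sym j≢k))
    (solve 2 (λ p q → con 0ℚ := con 0ℚ :* p :+ con 0ℚ :* q) refl (f i) (f j))

Σ₄≡sum : ∀ f → Σ₄ f ≡ sum f
Σ₄≡sum f = cong (λ s → f 0F + (f 1F + (f 2F + s))) (sym (+-identityʳ (f 3F)))

Σ₄-zero : ∀ {f} → (∀ c → 0ℚ ≤ f c) → Σ₄ f ≡ 0ℚ → ∀ c → f c ≡ 0ℚ
Σ₄-zero {f} h e = sum-nonneg-zero h (trans (sym (Σ₄≡sum f)) e)

Σ₄-only : ∀ c {f} → (∀ k → k ≢ c → f k ≡ 0ℚ) → Σ₄ f ≡ f c
Σ₄-only c {f} h = trans (Σ₄≡sum f) (sum-only c h)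

Σ₄-two : ∀ {a b} → a ≢ b → ∀ {f} → (∀ k → k ≢ a → k ≢ b → f k ≡ 0ℚ) → Σ₄ f ≡ f a + f b
Σ₄-two a≢b {f} h = trans (Σ₄≡sum f) (sum-two a≢b h)

0≤basis : ∀ {m} (i k : Fin m) → 0ℚ ≤ basis i k
0≤basis i k with does (i ≟ k)
... | true  = 0≤1
... | false = ≤-refl

sum-basis : ∀ {m} (i : Fin m) → sum (basis i) ≡ 1ℚ
sum-basis i = trans (sum-only i λ k k≢i → basis-≢ (≢-sym k≢i)) (basis-refl i)

record Local {m} (τ : VertexSet m) (i : Fin m) (A : Fin 4 → ℚ) : Set where
  field
    nonneg : ∀ c → 0ℚ ≤ A c
    supp   : ∀ c → combine i c ∉ τ → A c ≡ 0ℚ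

  nonzero⇒∈ : ∀ {c} → A c ≢ 0ℚ → combine i c ∈ τ
  nonzero⇒∈ {c} A≢0 with combine i c ∈? τ
  ... | yes c∈ = c∈
  ... | no c∉ = ⊥-elim (A≢0 (supp c c∉))

X Y : (Fin 4 → ℚ) → ℚ
X A = A 1F + A 3F
Y A = A 2F + A 3F

module _ {m : ℕ} where
  -- A point on the edge of the second factor between the vertices `i` and `j`. Over it, the
  -- simplices cut out a mixed subdivision of the sum of two squares scaled by `s` and `t`.
  on-level : Fin m → Fin m → ℚ → ℚ → Fin m → ℚ
  on-level i j s t k = basis i k * s + basis j k * t

  sum-on-level : ∀ i j s t → sum (on-level i j s t) ≡ s + t
  sum-on-level i j s t = trans (∑-distrib-+ {m} (λ k → basis i k * s) (λ k → basis j k * t))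
    (cong₂ _+_ (one i s) (one j t))
    where
    one : ∀ i s → sum (λ k → basis i k * s) ≡ s
    one i s = trans (sum-only i λ k k≢i → trans (cong (_* s) (basis-≢ (≢-sym k≢i))) (*-zeroˡ s))
      (trans (cong (_* s) (basis-refl i)) (*-identityˡ s))

  0≤on-level : ∀ i j {s t} → 0ℚ ≤ s → 0ℚ ≤ t → ∀ k → 0ℚ ≤ on-level i j s t k
  0≤on-level i j 0≤s 0≤t k = 0≤+ (0≤* (0≤basis i k) 0≤s) (0≤* (0≤basis j k) 0≤t)

  module _ {τ : VertexSet m} where
    Rep₁ : ∀ {i A} → Local {m} τ i A → Σ₄ A ≡ 1ℚ → Rep {m} τ (X A) (Y A) (basis i) (spread i A)
    Rep₁ {i} {A} l e = record
      { nonneg = λ k c → 0≤* (0≤basis i k) (Local.nonneg l c)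
      ; supp   = spread-supp {m} {τ} {i} {A} (Local.supp l)
      ; horiz  = sum-spread i A 1F 3F
      ; vert   = sum-spread i A 2F 3F
      ; levels = λ k → trans (Σ₄-spread i A k) (trans (cong (basis i k *_) e) (*-identityʳ (basis i k)))
      }

    Rep₁⁻¹ : ∀ {i x y w} → Rep {m} τ x y (basis i) w →
             Local {m} τ i (w i) × X (w i) ≡ x × Y (w i) ≡ y × Σ₄ (w i) ≡ 1ℚ
    Rep₁⁻¹ {i} {w = w} r = record { nonneg = nonneg i ; supp = supp i }
      , trans (sym (sum-only i λ k k≢i → cong₂ _+_ (off k≢i 1F) (off k≢i 3F))) horiz
      , trans (sym (sum-only i λ k k≢i → cong₂ _+_ (off k≢i 2F) (off k≢i 3F))) vert
      , trans (levels i) (basis-refl i)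
      where
      open Rep r
      off : ∀ {k} → k ≢ i → ∀ c → w k c ≡ 0ℚ
      off {k} k≢i = Σ₄-zero (nonneg k) (trans (levels k) (basis-≢ (≢-sym k≢i)))

    Rep₂ : ∀ {i j A B} → i ≢ j → Local {m} τ i A → Local {m} τ j B →
           Rep {m} τ (X A + X B) (Y A + Y B) (on-level i j (Σ₄ A) (Σ₄ B))
             (λ k c → spread i A k c + spread j B k c)
    Rep₂ {i} {j} {A} {B} i≢j l r = record
      { nonneg = λ k c → 0≤+ (0≤* (0≤basis i k) (Local.nonneg l c)) (0≤* (0≤basis j k) (Local.nonneg r c))
      ; supp   = λ k c ∉τ → cong₂ _+_ (spread-supp {m} {τ} {i} {A} (Local.supp l) k c ∉τ)
                                      (spread-supp {m} {τ} {j} {B} (Local.supp r) k c ∉τ)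
      ; horiz  = coord 1F 3F
      ; vert   = coord 2F 3F
      ; levels = λ k → trans
          (solve 8 (λ a b c d a′ b′ c′ d′ → a :+ a′ :+ (b :+ b′ :+ (c :+ c′ :+ (d :+ d′)))
            := a :+ (b :+ (c :+ d)) :+ (a′ :+ (b′ :+ (c′ :+ d′)))) refl
            (u k 0F) (u k 1F) (u k 2F) (u k 3F) (v k 0F) (v k 1F) (v k 2F) (v k 3F))
          (cong₂ _+_ (Σ₄-spread i A k) (Σ₄-spread j B k))
      }
      where
      u = spread i A
      v = spread j B
      coord : ∀ p q → sum (λ k → (u k p + v k p) + (u k q + v k q)) ≡ (A p + A q) + (B p + B q)
      coord p q = trans
        (sum-cong-≗ {m} λ k → solve 4 (λ a b c d → (a :+ b) :+ (c :+ d) := (a :+ c) :+ (b :+ d))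
          refl (u k p) (v k p) (u k q) (v k q))
        (trans (∑-distrib-+ {m} (λ k → u k p + u k q) (λ k → v k p + v k q))
          (cong₂ _+_ (sum-spread i A p q) (sum-spread j B p q)))

    Rep₂⁻¹ : ∀ {i j s t x y w} → i ≢ j → Rep {m} τ x y (on-level i j s t) w →
             Local {m} τ i (w i) × Local {m} τ j (w j) ×
             X (w i) + X (w j) ≡ x × Y (w i) + Y (w j) ≡ y × Σ₄ (w i) ≡ s × Σ₄ (w j) ≡ t
    Rep₂⁻¹ {i} {j} {s} {t} {w = w} i≢j r = record { nonneg = nonneg i ; supp = supp i }
      , record { nonneg = nonneg j ; supp = supp j }
      , trans (sym (sum-two i≢j λ k k≢i k≢j → cong₂ _+_ (off k≢i k≢j 1F) (off k≢i k≢j 3F))) horiz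
      , trans (sym (sum-two i≢j λ k k≢i k≢j → cong₂ _+_ (off k≢i k≢j 2F) (off k≢i k≢j 3F))) vert
      , trans (levels i) (trans (cong₂ (λ p q → p * s + q * t) (basis-refl i) (basis-≢ (≢-sym i≢j)))
          (solve 2 (λ s t → con 1ℚ :* s :+ con 0ℚ :* t := s) refl s t))
      , trans (levels j) (trans (cong₂ (λ p q → p * s + q * t) (basis-≢ i≢j) (basis-refl j))
          (solve 2 (λ s t → con 0ℚ :* s :+ con 1ℚ :* t := t) refl s t))
      where
      open Rep r
      off : ∀ {k} → k ≢ i → k ≢ j → ∀ c → w k c ≡ 0ℚ
      off {k} k≢i k≢j = Σ₄-zero (nonneg k) (trans (levels k)
        (trans (cong₂ (λ p q → p * s + q * t) (basis-≢ (≢-sym k≢i)) (basis-≢ (≢-sym k≢j)))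
          (solve 2 (λ s t → con 0ℚ :* s :+ con 0ℚ :* t := con 0ℚ) refl s t)))

card≥1 : ∀ {n} {s : Subset n} {a} → a ∈ s → 1 ℕ.≤ ∣ s ∣
card≥1 a∈ = ℕₚ.≤-trans (s≤s z≤n) (x∈p⇒∣p-x∣<∣p∣ a∈)

card≥2 : ∀ {n} {s : Subset n} {a b} → a ≢ b → a ∈ s → b ∈ s → 2 ℕ.≤ ∣ s ∣
card≥2 {s = s} {a} a≢b a∈ b∈ = ℕₚ.≤-trans
  (s≤s (card≥1 {s = s ∖ a} (x∈p∧x≢y⇒x∈p-y b∈ (≢-sym a≢b)))) (x∈p⇒∣p-x∣<∣p∣ a∈)

card≥3 : ∀ {n} {s : Subset n} {a b c} → a ≢ b → a ≢ c → b ≢ c → a ∈ s → b ∈ s → c ∈ s → 3 ℕ.≤ ∣ s ∣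
card≥3 {s = s} {a} a≢b a≢c b≢c a∈ b∈ c∈ = ℕₚ.≤-trans
  (s≤s (card≥2 {s = s ∖ a} b≢c (x∈p∧x≢y⇒x∈p-y b∈ (≢-sym a≢b)) (x∈p∧x≢y⇒x∈p-y c∈ (≢-sym a≢c))))
  (x∈p⇒∣p-x∣<∣p∣ a∈)

module _ {m} {τ : VertexSet m} {i : Fin m} where
  type≥1 : ∀ {a b} → a ≢ b → combine i a ∈ τ → combine i b ∈ τ → 1 ℕ.≤ simplexType m τ i
  type≥1 a≢b a∈ b∈ = ℕₚ.∸-monoˡ-≤ 1 (card≥2 a≢b (∈level⁻¹ {m} {τ} a∈) (∈level⁻¹ {m} {τ} b∈))

  type≥2 : ∀ {a b c} → a ≢ b → a ≢ c → b ≢ c → combine i a ∈ τ → combine i b ∈ τ → combine i c ∈ τ →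
           2 ℕ.≤ simplexType m τ i
  type≥2 a≢b a≢c b≢c a∈ b∈ c∈ = ℕₚ.∸-monoˡ-≤ 1
    (card≥3 a≢b a≢c b≢c (∈level⁻¹ {m} {τ} a∈) (∈level⁻¹ {m} {τ} b∈) (∈level⁻¹ {m} {τ} c∈))

count : ∀ {m} → List (VertexSet m) → Fin m → Fin m → ℕ
count []      i j = 0
count {m} (τ ∷ T) i j = serves (simplexType m τ) i j ℕ.+ count {m} T i j

module _ {m} {i j : Fin m} where
  Serves : VertexSet m → Set
  Serves τ = 1 ℕ.≤ serves (simplexType m τ) i j

  count≥1 : ∀ {T : List (VertexSet m)} {τ} → τ ∈ˡ T → Serves τ → 1 ℕ.≤ count {m} T i j
  count≥1 (here refl) s = ℕₚ.≤-trans s (ℕₚ.m≤m+n _ _)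
  count≥1 (there τ∈)  s = ℕₚ.≤-trans (count≥1 τ∈ s) (ℕₚ.m≤n+m _ _)

  count≥2 : ∀ {T : List (VertexSet m)} {σ τ} → σ ≢ τ → σ ∈ˡ T → τ ∈ˡ T → Serves σ → Serves τ →
            2 ℕ.≤ count {m} T i j
  count≥2 σ≢τ (here refl) (here refl) _ _ = ⊥-elim (σ≢τ refl)
  count≥2 σ≢τ (here refl) (there τ∈) s t = ℕₚ.+-mono-≤ s (count≥1 τ∈ t)
  count≥2 σ≢τ (there σ∈) (here refl) s t = ℕₚ.+-mono-≤ t (count≥1 σ∈ s)
  count≥2 σ≢τ (there σ∈) (there τ∈) s t = ℕₚ.≤-trans (count≥2 σ≢τ σ∈ τ∈ s t) (ℕₚ.m≤n+m _ _)

two-≥ : ∀ {n} → 2 ℕ.≤ n → 1 ℕ.≤ two n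
two-≥ (s≤s (s≤s _)) = s≤s z≤n

pos-≥ : ∀ {n} → 1 ℕ.≤ n → 1 ℕ.≤ pos n
pos-≥ (s≤s _) = s≤s z≤n

Serves-refl : ∀ {m} {τ : VertexSet m} {i} → 2 ℕ.≤ simplexType m τ i → Serves {m} {i} {i} τ
Serves-refl {i = i} h with i ≟ i
... | yes _ = two-≥ h
... | no i≢i = ⊥-elim (i≢i refl)

Serves-≢ : ∀ {m} {τ : VertexSet m} {i j} → i ≢ j →
           1 ℕ.≤ simplexType m τ i → 1 ℕ.≤ simplexType m τ j → Serves {m} {i} {j} τ
Serves-≢ {i = i} {j} i≢j h h′ with i ≟ j
... | yes i≡j = ⊥-elim (i≢j i≡j)
... | no _    = ℕₚ.*-mono-≤ (pos-≥ h) (pos-≥ h′)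

-- The generic point q of the square

qˣ qʸ : ℚ
qˣ = + 1 / 5
qʸ = + 3 / 5

cx cy : Fin 4 → ℚ
cx c = corner c 0F
cy c = corner c 1F

cx-basis : ∀ c → cx c ≡ X (basis c)
cx-basis = λ { 0F → refl ; 1F → refl ; 2F → refl ; 3F → refl }

cy-basis : ∀ c → cy c ≡ Y (basis c)
cy-basis = λ { 0F → refl ; 1F → refl ; 2F → refl ; 3F → refl }

⊢≤ : ∀ {p q} {t : So (p ℚ.≤ᵇ q)} → p ≤ q
⊢≤ {t = t} = ℚₚ.≤ᵇ⇒≤ t

<⇒≢0 : ∀ {p} → 0ℚ < p → p ≢ 0ℚ
<⇒≢0 0<p refl = <-irrefl refl 0<p

module _ {A : Fin 4 → ℚ} (0≤A : ∀ c → 0ℚ ≤ A c) (ΣA : Σ₄ A ≡ 1ℚ) where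

  module _ (hx : X A ≡ qˣ) (hy : Y A ≡ qʸ) where
    -- The point q lies in the quarter of the square at its left side: x + y < 1 forces weight on
    -- the corner 00 and, below, x < y forces weight on 01, whichever diagonal is used. The mirror
    -- image (4/5, 2/5) forces weight on 10 and 11 in the same way.
    q-A₀ : + 1 / 5 ≤ A 0F
    q-A₀ = ≤-by (A 3F) (0≤A 3F) (by₃ 1ℚ ΣA (- 1ℚ) hx (- 1ℚ) hy
      (solve 4 (λ a b c d → a := con (+ 1 / 5) :+ d
          :+ con 1ℚ :* (a :+ (b :+ (c :+ d)) :- con 1ℚ) :+ con (- 1ℚ) :* (b :+ d :- con qˣ)
          :+ con (- 1ℚ) :* (c :+ d :- con qʸ)) refl (A 0F) (A 1F) (A 2F) (A 3F)))

    q-A₂ : + 2 / 5 ≤ A 2F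
    q-A₂ = ≤-by (A 1F) (0≤A 1F) (by₂ (- 1ℚ) hx 1ℚ hy
      (solve 3 (λ b c d → c := con (+ 2 / 5) :+ b
          :+ con (- 1ℚ) :* (b :+ d :- con qˣ) :+ con 1ℚ :* (c :+ d :- con qʸ)) refl (A 1F) (A 2F) (A 3F)))

  module _ (hx : X A ≡ + 4 / 5) (hy : Y A ≡ + 2 / 5) where
    q′-A₁ : + 2 / 5 ≤ A 1F
    q′-A₁ = ≤-by (A 2F) (0≤A 2F) (by₂ 1ℚ hx (- 1ℚ) hy
      (solve 3 (λ b c d → b := con (+ 2 / 5) :+ c
          :+ con 1ℚ :* (b :+ d :- con (+ 4 / 5)) :+ con (- 1ℚ) :* (c :+ d :- con (+ 2 / 5)))
        refl (A 1F) (A 2F) (A 3F)))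

    q′-A₃ : + 1 / 5 ≤ A 3F
    q′-A₃ = ≤-by (A 0F) (0≤A 0F) (by₃ (- 1ℚ) ΣA 1ℚ hx 1ℚ hy
      (solve 4 (λ a b c d → d := con (+ 1 / 5) :+ a
          :+ con (- 1ℚ) :* (a :+ (b :+ (c :+ d)) :- con 1ℚ) :+ con 1ℚ :* (b :+ d :- con (+ 4 / 5))
          :+ con 1ℚ :* (c :+ d :- con (+ 2 / 5))) refl (A 0F) (A 1F) (A 2F) (A 3F)))

≤⇒≢0 : ∀ {p r} → 0ℚ < r → r ≤ p → p ≢ 0ℚ
≤⇒≢0 0<r r≤p = <⇒≢0 (<-≤-trans 0<r r≤p)

one-of : ∀ {p q r} → 0ℚ < r → p + q ≡ r → p ≢ 0ℚ ⊎ q ≢ 0ℚ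
one-of {p} {q} 0<r e with p ℚₚ.≟ 0ℚ
... | no p≢0 = inj₁ p≢0
... | yes refl = inj₂ λ { refl → <⇒≢0 0<r (sym e) }

0<1/5 : 0ℚ < + 1 / 5
0<1/5 = positive⁻¹ (+ 1 / 5)

0<2/5 : 0ℚ < + 2 / 5
0<2/5 = positive⁻¹ (+ 2 / 5)

-- Triangles, diagonals and translated triangles in a triangulation

module Triangulation {m} {𝒯 : List (VertexSet m)} (tri : Triangulates m 𝒯) where
  private
    ind : ∀ {τ} → τ ∈ˡ 𝒯 → Independent {m} τ
    ind = independent {m} tri

  abstract
    coordinates : ∀ i {x y} → 0ℚ ≤ x → x ≤ 1ℚ → 0ℚ ≤ y → y ≤ 1ℚ →
      ∃[ τ ] ∃[ A ] (τ ∈ˡ 𝒯 × Local {m} τ i A × X A ≡ x × Y A ≡ y × Σ₄ A ≡ 1ℚ)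
    coordinates i a b c d =
      let (τ , w , τ∈ , r) = covered {m} tri a b c d (0≤basis i) (sum-basis i)
      in τ , w i , τ∈ , Rep₁⁻¹ {m} {τ} r

  -- Two points symmetric about the centre lie in different triangles of a level.
  count-level : ∀ i → 2 ℕ.≤ count {m} 𝒯 i i
  count-level i =
    let (σ , A , σ∈ , lA , ax , ay , aΣ) = coordinates i {qˣ} {qʸ} ⊢≤ ⊢≤ ⊢≤ ⊢≤
        (τ , B , τ∈ , lB , bx , by , bΣ) = coordinates i {+ 4 / 5} {+ 2 / 5} ⊢≤ ⊢≤ ⊢≤ ⊢≤
        A≥0 = Local.nonneg lA
        B≥0 = Local.nonneg lB
        ∈σ = λ {c} → Local.nonzero⇒∈ {m} {σ} lA {c}
        ∈τ = λ {c} → Local.nonzero⇒∈ {m} {τ} lB {c}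
    in two-triangles i σ∈ τ∈
      (∈σ (≤⇒≢0 0<1/5 (q-A₀ A≥0 aΣ ax ay))) (∈σ (≤⇒≢0 0<2/5 (q-A₂ A≥0 aΣ ax ay)))
      (map ∈σ ∈σ (one-of 0<1/5 ax))
      (∈τ (≤⇒≢0 0<2/5 (q′-A₁ B≥0 bΣ bx by))) (∈τ (≤⇒≢0 0<1/5 (q′-A₃ B≥0 bΣ bx by)))
      (map ∈τ ∈τ (one-of 0<1/5 (complement B bΣ bx)))
    where
    complement : ∀ B → Σ₄ B ≡ 1ℚ → X B ≡ + 4 / 5 → B 0F + B 2F ≡ + 1 / 5
    complement B e e′ = by₂ 1ℚ e (- 1ℚ) e′
      (solve 4 (λ a b c d → a :+ c := con (+ 1 / 5) :+ con 1ℚ :* (a :+ (b :+ (c :+ d)) :- con 1ℚ)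
          :+ con (- 1ℚ) :* (b :+ d :- con (+ 4 / 5))) refl (B 0F) (B 1F) (B 2F) (B 3F))

    two-triangles : ∀ i {σ τ} → σ ∈ˡ 𝒯 → τ ∈ˡ 𝒯 →
      combine i 0F ∈ σ → combine i 2F ∈ σ → combine i 1F ∈ σ ⊎ combine i 3F ∈ σ →
      combine i 1F ∈ τ → combine i 3F ∈ τ → combine i 0F ∈ τ ⊎ combine i 2F ∈ τ →
      2 ℕ.≤ count {m} 𝒯 i i
    two-triangles i {σ} {τ} σ∈ τ∈ a₀ a₂ a₁₃ b₁ b₃ b₀₂ = count≥2 {m} {i} {i}
      -- A common simplex would contain all four corners of level `i`.
      (λ { refl → not-full {m} {σ} (ind σ∈) i λ { 0F → a₀ ; 1F → b₁ ; 2F → a₂ ; 3F → b₃ } })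
      σ∈ τ∈ (Serves-refl {m} {σ} {i} (triangle {σ} a₁₃ a₀ a₂)) (Serves-refl {m} {τ} {i} (triangle′ {τ} b₀₂ b₁ b₃))
      where
      triangle : ∀ {υ} → combine i 1F ∈ υ ⊎ combine i 3F ∈ υ → combine i 0F ∈ υ → combine i 2F ∈ υ →
        2 ℕ.≤ simplexType m υ i
      triangle {υ} (inj₁ c∈) = λ a∈ b∈ → type≥2 {m} {υ} {i} (λ ()) (λ ()) (λ ()) a∈ b∈ c∈
      triangle {υ} (inj₂ c∈) = λ a∈ b∈ → type≥2 {m} {υ} {i} (λ ()) (λ ()) (λ ()) a∈ b∈ c∈
      triangle′ : ∀ {υ} → combine i 0F ∈ υ ⊎ combine i 2F ∈ υ → combine i 1F ∈ υ → combine i 3F ∈ υ →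
        2 ℕ.≤ simplexType m υ i
      triangle′ {υ} (inj₁ c∈) = λ a∈ b∈ → type≥2 {m} {υ} {i} (λ ()) (λ ()) (λ ()) a∈ b∈ c∈
      triangle′ {υ} (inj₂ c∈) = λ a∈ b∈ → type≥2 {m} {υ} {i} (λ ()) (λ ()) (λ ()) a∈ b∈ c∈

  private
    -- The centre of the square lies on whichever diagonal is present, so its coordinates, the same
    -- in all simplices, reveal the diagonal.
    centre : Fin m → Fin 4 → ℚ
    centre i = proj₁ (proj₂ (coordinates i {½} {½} ⊢≤ ⊢≤ ⊢≤ ⊢≤))

    centre-unique : ∀ {i τ A} → τ ∈ˡ 𝒯 → Local {m} τ i A → X A ≡ ½ → Y A ≡ ½ → Σ₄ A ≡ 1ℚ →
                    ∀ c → centre i c ≡ A c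
    centre-unique {i} {τ} {A} τ∈ l hx hy hΣ c =
      let (σ , B , σ∈ , k , gx , gy , gΣ) = coordinates i {½} {½} ⊢≤ ⊢≤ ⊢≤ ⊢≤ in
      trans (sym (spread-≡ i B c)) (trans
        (coordinates-unique {m} tri σ∈ τ∈ (sum-basis i)
          (subst₂ (λ x y → Rep {m} σ x y (basis i) (spread i B)) gx gy (Rep₁ {m} {σ} k gΣ))
          (subst₂ (λ x y → Rep {m} τ x y (basis i) (spread i A)) hx hy (Rep₁ {m} {τ} l hΣ)) i c)
        (spread-≡ i A c))

    main anti : Fin 4 → ℚ
    main 0F = ½
    main 1F = 0ℚ
    main 2F = 0ℚ
    main 3F = ½
    anti 0F = 0ℚ
    anti 1F = ½
    anti 2F = ½
    anti 3F = 0ℚ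

  -- true if the diagonal of level i is 00–11, false if it is 10–01
  diag : Fin m → Bool
  diag i = does (centre i 0F ℚₚ.≟ ½)

  diag-main : ∀ {i τ} → τ ∈ˡ 𝒯 → combine i 0F ∈ τ → combine i 3F ∈ τ → diag i ≡ true
  diag-main {i} {τ} τ∈ a∈ b∈ = dec-true (centre i 0F ℚₚ.≟ ½)
    (centre-unique {i} {τ} {main} τ∈
      (record { nonneg = λ { 0F → ⊢≤ ; 1F → ⊢≤ ; 2F → ⊢≤ ; 3F → ⊢≤ }
              ; supp = λ { 0F h → ⊥-elim (h a∈) ; 1F _ → refl ; 2F _ → refl ; 3F h → ⊥-elim (h b∈) } })
      refl refl refl 0F)

  diag-anti : ∀ {i τ} → τ ∈ˡ 𝒯 → combine i 1F ∈ τ → combine i 2F ∈ τ → diag i ≡ false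
  diag-anti {i} {τ} τ∈ a∈ b∈ = dec-false (centre i 0F ℚₚ.≟ ½) λ e → case (trans (sym e)
    (centre-unique {i} {τ} {anti} τ∈
      (record { nonneg = λ { 0F → ⊢≤ ; 1F → ⊢≤ ; 2F → ⊢≤ ; 3F → ⊢≤ }
              ; supp = λ { 0F _ → refl ; 1F h → ⊥-elim (h a∈) ; 2F h → ⊥-elim (h b∈) ; 3F _ → refl } })
      refl refl refl 0F))
    where
    case : ½ ≢ 0ℚ
    case ()

  module Pair {i j : Fin m} (i≢j : i ≢ j) where

    -- A cell of the mixed subdivision that is a triangle of level i translated
    -- by the corner c of level j, and contains the point ½ q + ½ c
    Translated : Fin 4 → Set
    Translated c = ∃[ τ ] ∃[ A ]
      (τ ∈ˡ 𝒯 × Local {m} τ i A × X A ≡ qˣ × Y A ≡ qʸ × Σ₄ A ≡ 1ℚ × combine j c ∈ τ)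

    private
      -- Small enough for `moved` to stay nonnegative: a coordinate loses at most 2 ε = 1/10, and
      -- the positive coordinates of (1-ε) q are at least 19/20 times 1/5.
      ε = + 1 / 20
      1-ε = + 19 / 20

      -- Barycentric coordinates of q in the triangles that lack the corner o ∈ {1 , 3}
      bary : Fin 4 → Fin 4 → ℚ
      bary 3F 0F = + 1 / 5
      bary 3F 1F = + 1 / 5
      bary 3F 2F = + 3 / 5
      bary 3F 3F = 0ℚ
      bary _  0F = + 2 / 5
      bary _  1F = 0ℚ
      bary _  2F = + 2 / 5
      bary _  3F = + 1 / 5

      sign : Fin 4 → ℚ
      sign 0F = 1ℚ
      sign 1F = - 1ℚ
      sign 2F = - 1ℚ
      sign 3F = 1ℚ

      -- The coordinates of (1-ε) q + ε (c - c′): the affine dependence of the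
      -- four corners moves the displacement off the corner o.
      moved : Fin 4 → Fin 4 → Fin 4 → Fin 4 → ℚ
      moved o c c′ k = 1-ε * bary o k + ε * (basis c k - basis c′ k + sign k * (sign o * (basis c′ o - basis c o)))

      basis≤1 : ∀ (c k : Fin 4) → basis c k ≤ 1ℚ
      basis≤1 c k with does (c ≟ k)
      ... | true  = ≤-refl
      ... | false = ⊢≤

      module _ (c c′ : Fin 4) where
        private
          p r : Fin 4 → ℚ
          p = basis c
          r = basis c′

          slack : ∀ {b x y z t w} → 0ℚ ≤ b - + 1 / 10 → 0ℚ ≤ x → 0ℚ ≤ y → z ≤ 1ℚ → t ≤ 1ℚ →
            w ≡ b - + 1 / 10 + ε * (x + y + (1ℚ - z) + (1ℚ - t)) → 0ℚ ≤ w
          slack hb hx hy hz ht refl = 0≤+ hb (0≤* {ε} ⊢≤ (0≤+ (0≤+ (0≤+ hx hy) (0≤- hz)) (0≤- ht)))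

        moved-nonneg : ∀ o → o ≡ 1F ⊎ o ≡ 3F → ∀ k → 0ℚ ≤ moved o c c′ k
        moved-nonneg 1F _ 0F = slack {1-ε * bary 1F 0F} ⊢≤ (0≤basis c 0F) (0≤basis c 1F) (basis≤1 c′ 0F) (basis≤1 c′ 1F)
          (solve 4 (λ p r po ro → con (1-ε * bary 1F 0F) :+ con ε :* (p :- r :+ con 1ℚ :* (con (- 1ℚ) :* (ro :- po)))
            := con (1-ε * bary 1F 0F - + 1 / 10) :+ con ε :* (p :+ po :+ (con 1ℚ :- r) :+ (con 1ℚ :- ro)))
            refl (p 0F) (r 0F) (p 1F) (r 1F))
        moved-nonneg 1F _ 1F = ≤-reflexive (sym
          (solve 2 (λ p r → con 0ℚ :+ con ε :* (p :- r :+ con (- 1ℚ) :* (con (- 1ℚ) :* (r :- p))) := con 0ℚ) refl (p 1F) (r 1F)))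
        moved-nonneg 1F _ 2F = slack {1-ε * bary 1F 2F} ⊢≤ (0≤basis c 2F) (0≤basis c′ 1F) (basis≤1 c′ 2F) (basis≤1 c 1F)
          (solve 4 (λ p r po ro → con (1-ε * bary 1F 2F) :+ con ε :* (p :- r :+ con (- 1ℚ) :* (con (- 1ℚ) :* (ro :- po)))
            := con (1-ε * bary 1F 2F - + 1 / 10) :+ con ε :* (p :+ ro :+ (con 1ℚ :- r) :+ (con 1ℚ :- po)))
            refl (p 2F) (r 2F) (p 1F) (r 1F))
        moved-nonneg 1F _ 3F = slack {1-ε * bary 1F 3F} ⊢≤ (0≤basis c 3F) (0≤basis c 1F) (basis≤1 c′ 3F) (basis≤1 c′ 1F)
          (solve 4 (λ p r po ro → con (1-ε * bary 1F 3F) :+ con ε :* (p :- r :+ con 1ℚ :* (con (- 1ℚ) :* (ro :- po)))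
            := con (1-ε * bary 1F 3F - + 1 / 10) :+ con ε :* (p :+ po :+ (con 1ℚ :- r) :+ (con 1ℚ :- ro)))
            refl (p 3F) (r 3F) (p 1F) (r 1F))
        moved-nonneg 3F _ 0F = slack {1-ε * bary 3F 0F} ⊢≤ (0≤basis c 0F) (0≤basis c′ 3F) (basis≤1 c′ 0F) (basis≤1 c 3F)
          (solve 4 (λ p r po ro → con (1-ε * bary 3F 0F) :+ con ε :* (p :- r :+ con 1ℚ :* (con 1ℚ :* (ro :- po)))
            := con (1-ε * bary 3F 0F - + 1 / 10) :+ con ε :* (p :+ ro :+ (con 1ℚ :- r) :+ (con 1ℚ :- po)))
            refl (p 0F) (r 0F) (p 3F) (r 3F))
        moved-nonneg 3F _ 1F = slack {1-ε * bary 3F 1F} ⊢≤ (0≤basis c 1F) (0≤basis c 3F) (basis≤1 c′ 1F) (basis≤1 c′ 3F)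
          (solve 4 (λ p r po ro → con (1-ε * bary 3F 1F) :+ con ε :* (p :- r :+ con (- 1ℚ) :* (con 1ℚ :* (ro :- po)))
            := con (1-ε * bary 3F 1F - + 1 / 10) :+ con ε :* (p :+ po :+ (con 1ℚ :- r) :+ (con 1ℚ :- ro)))
            refl (p 1F) (r 1F) (p 3F) (r 3F))
        moved-nonneg 3F _ 2F = slack {1-ε * bary 3F 2F} ⊢≤ (0≤basis c 2F) (0≤basis c 3F) (basis≤1 c′ 2F) (basis≤1 c′ 3F)
          (solve 4 (λ p r po ro → con (1-ε * bary 3F 2F) :+ con ε :* (p :- r :+ con (- 1ℚ) :* (con 1ℚ :* (ro :- po)))
            := con (1-ε * bary 3F 2F - + 1 / 10) :+ con ε :* (p :+ po :+ (con 1ℚ :- r) :+ (con 1ℚ :- ro)))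
            refl (p 2F) (r 2F) (p 3F) (r 3F))
        moved-nonneg 3F _ 3F = ≤-reflexive (sym
          (solve 2 (λ p r → con 0ℚ :+ con ε :* (p :- r :+ con 1ℚ :* (con 1ℚ :* (r :- p))) := con 0ℚ) refl (p 3F) (r 3F)))
        moved-nonneg 0F (inj₁ ())
        moved-nonneg 0F (inj₂ ())
        moved-nonneg 2F (inj₁ ())
        moved-nonneg 2F (inj₂ ())

        moved-vanishes : ∀ o → o ≡ 1F ⊎ o ≡ 3F → moved o c c′ o ≡ 0ℚ
        moved-vanishes 1F _ =
          solve 2 (λ p r → con 0ℚ :+ con ε :* (p :- r :+ con (- 1ℚ) :* (con (- 1ℚ) :* (r :- p))) := con 0ℚ) refl (p 1F) (r 1F)
        moved-vanishes 3F _ =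
          solve 2 (λ p r → con 0ℚ :+ con ε :* (p :- r :+ con 1ℚ :* (con 1ℚ :* (r :- p))) := con 0ℚ) refl (p 3F) (r 3F)
        moved-vanishes 0F (inj₁ ())
        moved-vanishes 0F (inj₂ ())
        moved-vanishes 2F (inj₁ ())
        moved-vanishes 2F (inj₂ ())

        private
          shift : ∀ a b p q p′ q′ s t κ → s ≡ - t →
            1-ε * a + ε * (p - p′ + s * κ) + (1-ε * b + ε * (q - q′ + t * κ)) + ε * (p′ + q′)
            ≡ 1-ε * a + 1-ε * b + ε * (p + q)
          shift a b p q p′ q′ s t κ refl = solve 8 (λ a b p q p′ q′ t κ →
            con 1-ε :* a :+ con ε :* (p :- p′ :+ (:- t) :* κ) :+ (con 1-ε :* b :+ con ε :* (q :- q′ :+ t :* κ)) :+ con ε :* (p′ :+ q′)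
            := con 1-ε :* a :+ con 1-ε :* b :+ con ε :* (p :+ q)) refl a b p q p′ q′ t κ

        -- The multiple of `sign` does not change the position, so the point moves by ε (c - c′)
        -- only, and this is what the corners c and c′ of level `j` differ by.
        moved-X : ∀ o → X (moved o c c′) + ε * cx c′ ≡ X (λ k → 1-ε * bary o k) + ε * cx c
        moved-X o = trans (cong (λ x → X (moved o c c′) + ε * x) (cx-basis c′)) (trans
          (shift (bary o 1F) (bary o 3F) (p 1F) (p 3F) (r 1F) (r 3F) (- 1ℚ) 1ℚ (sign o * (r o - p o)) refl)
          (cong (λ x → X (λ k → 1-ε * bary o k) + ε * x) (sym (cx-basis c))))

        moved-Y : ∀ o → Y (moved o c c′) + ε * cy c′ ≡ Y (λ k → 1-ε * bary o k) + ε * cy c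
        moved-Y o = trans (cong (λ x → Y (moved o c c′) + ε * x) (cy-basis c′)) (trans
          (shift (bary o 2F) (bary o 3F) (p 2F) (p 3F) (r 2F) (r 3F) (- 1ℚ) 1ℚ (sign o * (r o - p o)) refl)
          (cong (λ x → Y (λ k → 1-ε * bary o k) + ε * x) (sym (cy-basis c))))

        moved-Σ : ∀ o → Σ₄ (moved o c c′) ≡ Σ₄ (λ k → 1-ε * bary o k)
        moved-Σ o = by₂ ε (Σ₄-basis c) (- ε) (Σ₄-basis c′)
          (solve 13 (λ b₀ b₁ b₂ b₃ p₀ p₁ p₂ p₃ r₀ r₁ r₂ r₃ κ →
            b₀ :+ con ε :* (p₀ :- r₀ :+ con 1ℚ :* κ) :+ (b₁ :+ con ε :* (p₁ :- r₁ :+ con (- 1ℚ) :* κ)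
              :+ (b₂ :+ con ε :* (p₂ :- r₂ :+ con (- 1ℚ) :* κ) :+ (b₃ :+ con ε :* (p₃ :- r₃ :+ con 1ℚ :* κ))))
            := b₀ :+ (b₁ :+ (b₂ :+ b₃)) :+ con ε :* (p₀ :+ (p₁ :+ (p₂ :+ p₃)) :- con 1ℚ)
               :+ con (- ε) :* (r₀ :+ (r₁ :+ (r₂ :+ r₃)) :- con 1ℚ)) refl
            (1-ε * bary o 0F) (1-ε * bary o 1F) (1-ε * bary o 2F) (1-ε * bary o 3F)
            (p 0F) (p 1F) (p 2F) (p 3F) (r 0F) (r 1F) (r 2F) (r 3F) (sign o * (r o - p o)))

    private
      module _ {τ : VertexSet m} where
        rep₂ : ∀ {A B x y s t} → Local {m} τ i A → Local {m} τ j B →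
          X A + X B ≡ x → Y A + Y B ≡ y → Σ₄ A ≡ s → Σ₄ B ≡ t →
          Rep {m} τ x y (on-level i j s t) (λ k c → spread i A k c + spread j B k c)
        rep₂ a b refl refl refl refl = Rep₂ {m} {τ} i≢j a b

        corner-local : ∀ {c} → combine j c ∈ τ → Local {m} τ j (λ k → ε * basis c k)
        corner-local {c} c∈ = record
          { nonneg = λ k → 0≤* {ε} {basis c k} ⊢≤ (0≤basis c k)
          ; supp = λ k k∉ → trans (cong (ε *_) (basis-≢ {i = c} {k} λ { refl → k∉ c∈ })) (*-zeroʳ ε) }

      Xε : ∀ c → X (λ k → ε * basis c k) ≡ ε * cx c
      Xε = λ { 0F → refl ; 1F → refl ; 2F → refl ; 3F → refl }
      Yε : ∀ c → Y (λ k → ε * basis c k) ≡ ε * cy c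
      Yε = λ { 0F → refl ; 1F → refl ; 2F → refl ; 3F → refl }
      Σε : ∀ c → Σ₄ (λ k → ε * basis c k) ≡ ε
      Σε = λ { 0F → refl ; 1F → refl ; 2F → refl ; 3F → refl }

      module _ {A : Fin 4 → ℚ} (ΣA : Σ₄ A ≡ 1ℚ) (hx : X A ≡ qˣ) (hy : Y A ≡ qʸ) where

        bary₁ : A 1F ≡ 0ℚ → ∀ k → A k ≡ bary 1F k
        bary₁ e 0F = by₃ 1ℚ ΣA (- 1ℚ) hy (- 1ℚ) e
          (solve 4 (λ a b c d → a := con (+ 2 / 5) :+ con 1ℚ :* (a :+ (b :+ (c :+ d)) :- con 1ℚ)
            :+ con (- 1ℚ) :* (c :+ d :- con qʸ) :+ con (- 1ℚ) :* (b :- con 0ℚ)) refl (A 0F) (A 1F) (A 2F) (A 3F))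
        bary₁ e 1F = e
        bary₁ e 2F = by₃ 1ℚ hy (- 1ℚ) hx 1ℚ e
          (solve 3 (λ b c d → c := con (+ 2 / 5) :+ con 1ℚ :* (c :+ d :- con qʸ)
            :+ con (- 1ℚ) :* (b :+ d :- con qˣ) :+ con 1ℚ :* (b :- con 0ℚ)) refl (A 1F) (A 2F) (A 3F))
        bary₁ e 3F = by₂ 1ℚ hx (- 1ℚ) e
          (solve 2 (λ b d → d := con qˣ :+ con 1ℚ :* (b :+ d :- con qˣ)
            :+ con (- 1ℚ) :* (b :- con 0ℚ)) refl (A 1F) (A 3F))

        bary₃ : A 3F ≡ 0ℚ → ∀ k → A k ≡ bary 3F k
        bary₃ e 0F = by₃ 1ℚ ΣA (- 1ℚ) hy (- 1ℚ) b≡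
          (solve 4 (λ a b c d → a := con (+ 1 / 5) :+ con 1ℚ :* (a :+ (b :+ (c :+ d)) :- con 1ℚ)
            :+ con (- 1ℚ) :* (c :+ d :- con qʸ) :+ con (- 1ℚ) :* (b :- con qˣ)) refl (A 0F) (A 1F) (A 2F) (A 3F))
          where
          b≡ : A 1F ≡ qˣ
          b≡ = by₂ 1ℚ hx (- 1ℚ) e (solve 2 (λ b d → b := con qˣ :+ con 1ℚ :* (b :+ d :- con qˣ)
            :+ con (- 1ℚ) :* (d :- con 0ℚ)) refl (A 1F) (A 3F))
        bary₃ e 1F = by₂ 1ℚ hx (- 1ℚ) e (solve 2 (λ b d → b := con qˣ :+ con 1ℚ :* (b :+ d :- con qˣ)
            :+ con (- 1ℚ) :* (d :- con 0ℚ)) refl (A 1F) (A 3F))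
        bary₃ e 2F = by₂ 1ℚ hy (- 1ℚ) e (solve 2 (λ c d → c := con qʸ :+ con 1ℚ :* (c :+ d :- con qʸ)
            :+ con (- 1ℚ) :* (d :- con 0ℚ)) refl (A 2F) (A 3F))
        bary₃ e 3F = e

      bary≡0 : ∀ o → o ≡ 1F ⊎ o ≡ 3F → ∀ k → bary o k ≡ 0ℚ → k ≡ o
      bary≡0 1F _ 0F ()
      bary≡0 1F _ 1F _ = refl
      bary≡0 1F _ 2F ()
      bary≡0 1F _ 3F ()
      bary≡0 3F _ 0F ()
      bary≡0 3F _ 1F ()
      bary≡0 3F _ 2F ()
      bary≡0 3F _ 3F _ = refl
      bary≡0 0F (inj₁ ())
      bary≡0 0F (inj₂ ())
      bary≡0 2F (inj₁ ())
      bary≡0 2F (inj₂ ())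

      baryX : ∀ o → o ≡ 1F ⊎ o ≡ 3F → X (λ k → 1-ε * bary o k) ≡ 1-ε * qˣ ×
        Y (λ k → 1-ε * bary o k) ≡ 1-ε * qʸ × Σ₄ (λ k → 1-ε * bary o k) ≡ 1-ε × (∀ k → 0ℚ ≤ bary o k)
      baryX 1F _ = refl , refl , refl , λ { 0F → ⊢≤ ; 1F → ⊢≤ ; 2F → ⊢≤ ; 3F → ⊢≤ }
      baryX 3F _ = refl , refl , refl , λ { 0F → ⊢≤ ; 1F → ⊢≤ ; 2F → ⊢≤ ; 3F → ⊢≤ }
      baryX 0F (inj₁ ())
      baryX 0F (inj₂ ())
      baryX 2F (inj₁ ())
      baryX 2F (inj₂ ())

      -- The point (1-ε) q + ε c has coordinates in both simplices: in `σ` with its mass at level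
      -- `j` on c, in `τ` with that mass on c′, the difference ε (c - c′) being absorbed by the
      -- triangle of level `i`. Uniqueness of coordinates forbids c ≠ c′.
      same-corner : ∀ {σ τ A B c c′} o → o ≡ 1F ⊎ o ≡ 3F → σ ∈ˡ 𝒯 → τ ∈ˡ 𝒯 →
        Local {m} σ i A → Local {m} τ i B → (∀ k → A k ≡ bary o k) → (∀ k → B k ≡ bary o k) →
        combine j c ∈ σ → combine j c′ ∈ τ → c ≡ c′
      same-corner {σ} {τ} {A} {B} {c} {c′} o o∈ σ∈ τ∈ l r A≡ B≡ c∈ c′∈ with c ≟ c′
      ... | yes c≡c′ = c≡c′
      ... | no  c≢c′ = ⊥-elim (ε≢0 (trans (sym (weight-at c)) (trans
            (coordinates-unique {m} tri σ∈ τ∈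
              (trans (sum-on-level i j 1-ε ε) refl)
              (rep₂ {σ} lσ (corner-local {σ} c∈) (cong₂ _+_ bX (Xε c)) (cong₂ _+_ bY (Yε c)) bΣ (Σε c))
              (rep₂ {τ} lτ (corner-local {τ} c′∈) (trans (cong (λ p → X (moved o c c′) + p) (Xε c′)) fX)
                (trans (cong (λ p → Y (moved o c c′) + p) (Yε c′)) fY) fΣ (Σε c′))
              j c)
            (trans (cong₂ _+_ (spread-≢ (moved o c c′) c i≢j) (spread-≡ j (λ k → ε * basis c′ k) c))
              (cong (λ p → 0ℚ + ε * p) (basis-≢ (≢-sym c≢c′)))))))
        where
        ε≢0 : ε ≢ 0ℚ
        ε≢0 ()
        bXYΣ = baryX o o∈
        bX = proj₁ bXYΣ
        bY = proj₁ (proj₂ bXYΣ)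
        bΣ = proj₁ (proj₂ (proj₂ bXYΣ))
        fX = trans (moved-X c c′ o) (cong (λ p → p + ε * cx c) bX)
        fY = trans (moved-Y c c′ o) (cong (λ p → p + ε * cy c) bY)
        fΣ = trans (moved-Σ c c′ o) bΣ
        lσ : Local {m} σ i (λ k → 1-ε * bary o k)
        lσ = record
          { nonneg = λ k → 0≤* {1-ε} ⊢≤ (proj₂ (proj₂ (proj₂ bXYΣ)) k)
          ; supp = λ k k∉ → trans (cong (1-ε *_) (trans (sym (A≡ k)) (Local.supp l k k∉))) (*-zeroʳ 1-ε) }
        -- A corner missing from `τ` must be `o`, the only one where q has coordinate 0, and there
        -- the moved coordinate vanishes as well.
        lτ : Local {m} τ i (moved o c c′)
        lτ = record
          { nonneg = moved-nonneg c c′ o o∈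
          ; supp = λ k k∉ → subst (λ k → moved o c c′ k ≡ 0ℚ)
              (sym (bary≡0 o o∈ k (trans (sym (B≡ k)) (Local.supp r k k∉))))
              (moved-vanishes c c′ o o∈) }
        weight-at : ∀ c → spread i (λ k → 1-ε * bary o k) j c + spread j (λ k → ε * basis c k) j c ≡ ε
        weight-at c = trans (cong₂ _+_ (spread-≢ (λ k → 1-ε * bary o k) c i≢j) (spread-≡ j (λ k → ε * basis c k) c))
          (cong (λ p → 0ℚ + ε * p) (basis-refl c))

    -- A simplex yields a cell at every scale. When the square of level `j` is shrunk by the factor
    -- ε, the translates of the triangle around q overlap, so two different ones would share a
    -- point. The corner that the triangle lacks is 1 or 3, because q has positive weight on 0 and
    -- 2.
    translated-unique : ∀ {c c′} → Translated c → Translated c′ → c ≡ c′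
    translated-unique {c} {c′} (σ , A , σ∈ , l , hx , hy , hΣ , c∈) (τ , B , τ∈ , r , gx , gy , gΣ , c′∈) =
      go (¬∀⟶∃¬ 4 (λ k → combine i k ∈ σ) (λ k → combine i k ∈? σ) (not-full {m} {σ} (ind σ∈) i))
      where
      A≡B : ∀ k → A k ≡ B k
      A≡B k = trans (sym (spread-≡ i A k)) (trans
        (coordinates-unique {m} tri σ∈ τ∈ (sum-basis i)
          (subst₂ (λ x y → Rep {m} σ x y (basis i) (spread i A)) hx hy (Rep₁ {m} {σ} l hΣ))
          (subst₂ (λ x y → Rep {m} τ x y (basis i) (spread i B)) gx gy (Rep₁ {m} {τ} r gΣ)) i k)
        (spread-≡ i B k))
      finish : ∀ o → o ≡ 1F ⊎ o ≡ 3F → (∀ k → A k ≡ bary o k) → c ≡ c′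
      finish o o∈ A≡ = same-corner {σ} {τ} o o∈ σ∈ τ∈ l r A≡ (λ k → trans (sym (A≡B k)) (A≡ k)) c∈ c′∈
      go : ∃[ k ] combine i k ∉ σ → c ≡ c′
      go (0F , k∉) = ⊥-elim (≤⇒≢0 0<1/5 (q-A₀ (Local.nonneg l) hΣ hx hy) (Local.supp l 0F k∉))
      go (1F , k∉) = finish 1F (inj₁ refl) (bary₁ hΣ hx hy (Local.supp l 1F k∉))
      go (2F , k∉) = ⊥-elim (≤⇒≢0 0<2/5 (q-A₂ (Local.nonneg l) hΣ hx hy) (Local.supp l 2F k∉))
      go (3F , k∉) = finish 3F (inj₂ refl) (bary₃ hΣ hx hy (Local.supp l 3F k∉))

-- Parallelograms and the points q + c

ι-cancel-≤ : ∀ {a b} → ι a ≤ ι b → a ℕ.≤ b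
ι-cancel-≤ {a} {b} h with a ℕₚ.≤? b
... | yes a≤b = a≤b
... | no a≰b = ⊥-elim (<-irrefl refl (<-≤-trans
  (Sqrt.p<p+δ 0ℚ (ι b) (positive⁻¹ (ι 1)))
  (≤-trans (subst (_≤ ι a) (trans (cong ι (ℕₚ.+-comm 1 b)) (ι-+ b 1)) (ι-mono (ℕₚ.≰⇒> a≰b))) h)))

-- The functionals x, y, x + y and x - y + 1 at the corners, and five times
-- their values at q (increased by one for the last)
form : Fin 4 → Fin 4 → ℕ
form 0F 0F = 0
form 0F 1F = 1
form 0F 2F = 0
form 0F 3F = 1
form 1F 0F = 0
form 1F 1F = 0
form 1F 2F = 1
form 1F 3F = 1
form 2F 0F = 0
form 2F 1F = 1
form 2F 2F = 1
form 2F 3F = 2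
form 3F 0F = 1
form 3F 1F = 2
form 3F 2F = 0
form 3F 3F = 1

form-q : Fin 4 → ℕ
form-q 0F = 1
form-q 1F = 3
form-q 2F = 4
form-q 3F = 3

private
  -- Every segment between two corners has the direction of a side or a diagonal of the square, on
  -- which one of the four functionals is constant. For edges that are not parallel the strips
  -- between these bounds cut out the parallelogram exactly. Parallel edges have a strip of width 0,
  -- which contains no q + c, as no entry of `form-q` is a multiple of 5.
  lower upper : Fin 4 → Fin 4 → Fin 4 → Fin 4 → Fin 4 → ℕ
  lower d u u′ v v′ = (form d u ℕ.⊓ form d u′) ℕ.+ (form d v ℕ.⊓ form d v′)
  upper d u u′ v v′ = (form d u ℕ.⊔ form d u′) ℕ.+ (form d v ℕ.⊔ form d v′)

-- q + c lies between the values of the functionals on {u , u′} + {v , v′}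
Fits : Fin 4 → Fin 4 → Fin 4 → Fin 4 → Fin 4 → Set
Fits u u′ v v′ c = ∀ d →
  5 ℕ.* lower d u u′ v v′ ℕ.≤ form-q d ℕ.+ 5 ℕ.* form d c ×
  form-q d ℕ.+ 5 ℕ.* form d c ℕ.≤ 5 ℕ.* upper d u u′ v v′

Main Anti : Fin 4 → Fin 4 → Set
Main u v = (u ≡ 0F × v ≡ 3F) ⊎ (u ≡ 3F × v ≡ 0F)
Anti u v = (u ≡ 1F × v ≡ 2F) ⊎ (u ≡ 2F × v ≡ 1F)

Crossing : Fin 4 → Fin 4 → Fin 4 → Fin 4 → Set
Crossing u u′ v v′ = (Main u u′ × Anti v v′) ⊎ (Anti u u′ × Main v v′)

private
  fits? : ∀ u u′ v v′ c → Dec (Fits u u′ v v′ c)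
  fits? u u′ v v′ c = all? λ d → (_ ℕₚ.≤? _) ×-dec (_ ℕₚ.≤? _)

  main? : ∀ u v → Dec (Main u v)
  main? u v = ((u ≟ 0F) ×-dec (v ≟ 3F)) ⊎-dec ((u ≟ 3F) ×-dec (v ≟ 0F))

  anti? : ∀ u v → Dec (Anti u v)
  anti? u v = ((u ≟ 1F) ×-dec (v ≟ 2F)) ⊎-dec ((u ≟ 2F) ×-dec (v ≟ 1F))

  crossing? : ∀ u u′ v v′ → Dec (Crossing u u′ v v′)
  crossing? u u′ v v′ = (main? u u′ ×-dec anti? v v′) ⊎-dec (anti? u u′ ×-dec main? v v′)

-- A lattice parallelogram of area 1 contains only one of the points q + c.
two-fit⇒crossing : ∀ u u′ v v′ c c′ → u ≢ u′ × v ≢ v′ × c ≢ c′ →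
                   Fits u u′ v v′ c → Fits u u′ v v′ c′ → Crossing u u′ v v′
two-fit⇒crossing = toWitness
  {a? = all? λ u → all? λ u′ → all? λ v → all? λ v′ → all? λ c → all? λ c′ →
    (¬? (u ≟ u′) ×-dec (¬? (v ≟ v′) ×-dec ¬? (c ≟ c′))) →-dec
    (fits? u u′ v v′ c →-dec (fits? u u′ v v′ c′ →-dec crossing? u u′ v v′))} _

value : Fin 4 → (Fin 4 → ℚ) → ℚ
value d A = Σ₄ (λ k → ι (form d k) * A k)

value-≤ : ∀ {u u′} → u ≢ u′ → ∀ {A} → (∀ k → 0ℚ ≤ A k) → (∀ k → k ≢ u → k ≢ u′ → A k ≡ 0ℚ) →
  ∀ d → ι (form d u ℕ.⊓ form d u′) * Σ₄ A ≤ value d A × value d A ≤ ι (form d u ℕ.⊔ form d u′) * Σ₄ A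
value-≤ {u} {u′} u≢u′ {A} A≥0 off d =
    subst₂ _≤_ (sym (total lo)) (sym at) (+-mono-≤ (scale u (ι-mono (ℕₚ.m⊓n≤m (form d u) (form d u′)))) (scale u′ (ι-mono (ℕₚ.m⊓n≤n (form d u) (form d u′)))))
  , subst₂ _≤_ (sym at) (sym (total hi)) (+-mono-≤ (scale u (ι-mono (ℕₚ.m≤m⊔n (form d u) (form d u′)))) (scale u′ (ι-mono (ℕₚ.m≤n⊔m (form d u) (form d u′)))))
  where
  lo = ι (form d u ℕ.⊓ form d u′)
  hi = ι (form d u ℕ.⊔ form d u′)
  scale : ∀ k {p q} → p ≤ q → p * A k ≤ q * A k
  scale k = *-monoʳ-≤-nonNeg (A k) {{ℚ.nonNegative (A≥0 k)}}
  total : ∀ p → p * Σ₄ A ≡ p * A u + p * A u′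
  total p = trans (cong (p *_) (Σ₄-two u≢u′ off)) (*-distribˡ-+ p (A u) (A u′))
  at : value d A ≡ ι (form d u) * A u + ι (form d u′) * A u′
  at = Σ₄-two u≢u′ λ k k≢u k≢u′ → trans (cong (ι (form d k) *_) (off k k≢u k≢u′)) (*-zeroʳ (ι (form d k)))

ι5 : ℚ
ι5 = + 5 / 1

private
  q-form : Fin 4 → Fin 4 → ℚ
  q-form c 0F = ι5 * (qˣ + cx c)
  q-form c 1F = ι5 * (qʸ + cy c)
  q-form c 2F = ι5 * (qˣ + cx c + (qʸ + cy c))
  -- The last functional carries its summand 1 once for each of the two squares.
  q-form c 3F = ι5 * (qˣ + cx c - (qʸ + cy c) + ι 2)

  q-corner : ∀ d c → q-form c d ≡ ι (form-q d ℕ.+ 5 ℕ.* form d c)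
  q-corner = toWitness {a? = all? λ d → all? λ c → q-form c d ℚₚ.≟ ι (form-q d ℕ.+ 5 ℕ.* form d c)} _

value-q : ∀ {A B : Fin 4 → ℚ} c → X A + X B ≡ qˣ + cx c → Y A + Y B ≡ qʸ + cy c →
  Σ₄ A ≡ 1ℚ → Σ₄ B ≡ 1ℚ → ∀ d → ι5 * (value d A + value d B) ≡ ι (form-q d ℕ.+ 5 ℕ.* form d c)
value-q {A} {B} c hx hy hA hB d = trans (by-form d) (q-corner d c)
  where
  a₀ = A 0F
  a₁ = A 1F
  a₂ = A 2F
  a₃ = A 3F
  b₀ = B 0F
  b₁ = B 1F
  b₂ = B 2F
  b₃ = B 3F
  by-form : ∀ d → ι5 * (value d A + value d B) ≡ q-form c d
  by-form 0F = trans (cong (ι5 *_) (trans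
    (solve 8 (λ a b c d a′ b′ c′ d′ →
        (con (ι 0) :* a :+ (con (ι 1) :* b :+ (con (ι 0) :* c :+ con (ι 1) :* d)))
        :+ (con (ι 0) :* a′ :+ (con (ι 1) :* b′ :+ (con (ι 0) :* c′ :+ con (ι 1) :* d′)))
        := (b :+ d) :+ (b′ :+ d′)) refl a₀ a₁ a₂ a₃ b₀ b₁ b₂ b₃) hx)) refl
  by-form 1F = trans (cong (ι5 *_) (trans
    (solve 8 (λ a b c d a′ b′ c′ d′ →
        (con (ι 0) :* a :+ (con (ι 0) :* b :+ (con (ι 1) :* c :+ con (ι 1) :* d)))
        :+ (con (ι 0) :* a′ :+ (con (ι 0) :* b′ :+ (con (ι 1) :* c′ :+ con (ι 1) :* d′)))
        := (c :+ d) :+ (c′ :+ d′)) refl a₀ a₁ a₂ a₃ b₀ b₁ b₂ b₃) hy)) refl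
  by-form 2F = trans (cong (ι5 *_) (trans
    (solve 8 (λ a b c d a′ b′ c′ d′ →
        (con (ι 0) :* a :+ (con (ι 1) :* b :+ (con (ι 1) :* c :+ con (ι 2) :* d)))
        :+ (con (ι 0) :* a′ :+ (con (ι 1) :* b′ :+ (con (ι 1) :* c′ :+ con (ι 2) :* d′)))
        := ((b :+ d) :+ (b′ :+ d′)) :+ ((c :+ d) :+ (c′ :+ d′))) refl a₀ a₁ a₂ a₃ b₀ b₁ b₂ b₃)
      (cong₂ _+_ hx hy))) refl
  by-form 3F = trans (cong (ι5 *_) (trans
    (solve 8 (λ a b c d a′ b′ c′ d′ →
        (con (ι 1) :* a :+ (con (ι 2) :* b :+ (con (ι 0) :* c :+ con (ι 1) :* d)))
        :+ (con (ι 1) :* a′ :+ (con (ι 2) :* b′ :+ (con (ι 0) :* c′ :+ con (ι 1) :* d′)))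
        := ((b :+ d) :+ (b′ :+ d′)) :- ((c :+ d) :+ (c′ :+ d′))
           :+ ((a :+ (b :+ (c :+ d))) :+ (a′ :+ (b′ :+ (c′ :+ d′))))) refl a₀ a₁ a₂ a₃ b₀ b₁ b₂ b₃)
      (cong₂ _+_ (cong₂ _-_ hx hy) (cong₂ _+_ hA hB)))) refl

fits : ∀ {A B u u′ v v′} → u ≢ u′ → v ≢ v′ → (∀ k → 0ℚ ≤ A k) → (∀ k → 0ℚ ≤ B k) →
  (∀ k → k ≢ u → k ≢ u′ → A k ≡ 0ℚ) → (∀ k → k ≢ v → k ≢ v′ → B k ≡ 0ℚ) →
  ∀ c → X A + X B ≡ qˣ + cx c → Y A + Y B ≡ qʸ + cy c → Σ₄ A ≡ 1ℚ → Σ₄ B ≡ 1ℚ → Fits u u′ v v′ c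
fits {A} {B} {u} {u′} {v} {v′} u≢u′ v≢v′ A≥0 B≥0 offA offB c hx hy hA hB d =
    ι-cancel-≤ (subst₂ _≤_ (times5 (form d u ℕ.⊓ form d u′) (form d v ℕ.⊓ form d v′)) (value-q {A} {B} c hx hy hA hB d)
      (*-monoˡ-≤-nonNeg ι5 (+-mono-≤ (proj₁ boundA) (proj₁ boundB))))
  , ι-cancel-≤ (subst₂ _≤_ (value-q {A} {B} c hx hy hA hB d) (times5 (form d u ℕ.⊔ form d u′) (form d v ℕ.⊔ form d v′))
      (*-monoˡ-≤-nonNeg ι5 (+-mono-≤ (proj₂ boundA) (proj₂ boundB))))
  where
  boundA = value-≤ u≢u′ {A} A≥0 offA d
  boundB = value-≤ v≢v′ {B} B≥0 offB d
  times5 : ∀ p r → ι5 * (ι p * Σ₄ A + ι r * Σ₄ B) ≡ ι (5 ℕ.* (p ℕ.+ r))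
  times5 p r = trans (cong (ι5 *_) (trans
      (cong₂ _+_ (trans (cong (ι p *_) hA) (*-identityʳ (ι p))) (trans (cong (ι r *_) hB) (*-identityʳ (ι r))))
      (sym (ι-+ p r)))) (sym (ι-* 5 (p ℕ.+ r)))

TwoNonzero : (Fin 4 → ℚ) → Set
TwoNonzero A = ∃[ a ] ∃[ b ] (a ≢ b × A a ≢ 0ℚ × A b ≢ 0ℚ)

Concentrated : (Fin 4 → ℚ) → Set
Concentrated A = ∃[ c ] (∀ k → k ≢ c → A k ≡ 0ℚ)

two-nonzero? : ∀ A → TwoNonzero A ⊎ Concentrated A
two-nonzero? A with any? (λ a → any? (λ b → ¬? (a ≟ b) ×-dec (¬? (A a ℚₚ.≟ 0ℚ) ×-dec ¬? (A b ℚₚ.≟ 0ℚ))))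
... | yes two = inj₁ two
... | no ¬two with any? (λ c → ¬? (A c ℚₚ.≟ 0ℚ))
...   | no ¬one = inj₂ (0F , λ k _ → decidable-stable (A k ℚₚ.≟ 0ℚ) λ ne → ¬one (k , ne))
...   | yes (c , Ac≢0) = inj₂ (c , λ k k≢c →
        decidable-stable (A k ℚₚ.≟ 0ℚ) λ ne → ¬two (k , c , k≢c , ne , Ac≢0))

-- q is interior to the unit square
only-own-corner : ∀ c c′ → (0ℚ ≤ qˣ + cx c - cx c′ × qˣ + cx c - cx c′ ≤ 1ℚ) ×
  (0ℚ ≤ qʸ + cy c - cy c′ × qʸ + cy c - cy c′ ≤ 1ℚ) → c ≡ c′
only-own-corner = toWitness {a? = all? λ c → all? λ c′ →
  (((_ ℚₚ.≤? _) ×-dec (_ ℚₚ.≤? _)) ×-dec ((_ ℚₚ.≤? _) ×-dec (_ ℚₚ.≤? _))) →-dec (c ≟ c′)} _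

-- Cells over the edges of the simplex

module Mixed {m} {𝒯 : List (VertexSet m)} (tri : Triangulates m 𝒯) where
  open Triangulation {m} {𝒯} tri

  private
    2ℚ : ℚ
    2ℚ = + 2 / 1

    ind : ∀ {τ} → τ ∈ˡ 𝒯 → Independent {m} τ
    ind = independent {m} tri

  -- Such a cell is found over the midpoint of the edge from `i` to `j`, at the point ½ (q + c). All
  -- coordinates are then doubled, so that each of the two levels sums to 1 and the cell lies in the
  -- sum of two unit squares.
  record Cell (i j : Fin m) (c : Fin 4) : Set where
    field
      τ  : VertexSet m
      τ∈ : τ ∈ˡ 𝒯
      A B : Fin 4 → ℚ
      lA : Local {m} τ i A
      lB : Local {m} τ j B
      hx : X A + X B ≡ qˣ + cx c
      hy : Y A + Y B ≡ qʸ + cy c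
      ΣA : Σ₄ A ≡ 1ℚ
      ΣB : Σ₄ B ≡ 1ℚ

  Cell-sym : ∀ {i j c} → Cell i j c → Cell j i c
  Cell-sym C = record
    { τ = τ ; τ∈ = τ∈ ; A = B ; B = A ; lA = lB ; lB = lA ; ΣA = ΣB ; ΣB = ΣA
    ; hx = trans (+-comm (X B) (X A)) hx ; hy = trans (+-comm (Y B) (Y A)) hy }
    where open Cell C

  MixedCell : Fin m → Fin m → Fin 4 → Set
  MixedCell i j c = ∃[ C ] (TwoNonzero (Cell.A {i} {j} {c} C) × TwoNonzero (Cell.B {i} {j} {c} C))

  module _ {i j : Fin m} (i≢j : i ≢ j) where
    private
      module _ where

        bound : ∀ c → (0ℚ ≤ ½ * (qˣ + cx c) × ½ * (qˣ + cx c) ≤ 1ℚ) ×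
                      (0ℚ ≤ ½ * (qʸ + cy c) × ½ * (qʸ + cy c) ≤ 1ℚ)
        bound 0F = (⊢≤ , ⊢≤) , (⊢≤ , ⊢≤)
        bound 1F = (⊢≤ , ⊢≤) , (⊢≤ , ⊢≤)
        bound 2F = (⊢≤ , ⊢≤) , (⊢≤ , ⊢≤)
        bound 3F = (⊢≤ , ⊢≤) , (⊢≤ , ⊢≤)

        double : ∀ {τ i A} → Local {m} τ i A → Local {m} τ i (λ k → 2ℚ * A k)
        double l = record
          { nonneg = λ k → 0≤* {2ℚ} ⊢≤ (Local.nonneg l k)
          ; supp = λ k k∉ → trans (cong (2ℚ *_) (Local.supp l k k∉)) (*-zeroʳ 2ℚ) }

        coord : ∀ (A B : Fin 4 → ℚ) p q {x} → (A p + A q) + (B p + B q) ≡ ½ * x →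
          (2ℚ * A p + 2ℚ * A q) + (2ℚ * B p + 2ℚ * B q) ≡ x
        coord A B p q {x} e = by₁ 2ℚ e (solve 5 (λ a a′ b b′ x →
          (con 2ℚ :* a :+ con 2ℚ :* a′) :+ (con 2ℚ :* b :+ con 2ℚ :* b′)
            := x :+ con 2ℚ :* (a :+ a′ :+ (b :+ b′) :- con ½ :* x)) refl (A p) (A q) (B p) (B q) x)

        total : ∀ (A : Fin 4 → ℚ) → Σ₄ A ≡ ½ → Σ₄ (λ k → 2ℚ * A k) ≡ 1ℚ
        total A e = trans (solve 4 (λ a b c d → con 2ℚ :* a :+ (con 2ℚ :* b :+ (con 2ℚ :* c :+ con 2ℚ :* d))
          := con 2ℚ :* (a :+ (b :+ (c :+ d)))) refl (A 0F) (A 1F) (A 2F) (A 3F)) (cong (2ℚ *_) e)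

    abstract
      cell : ∀ c → Cell i j c
      cell c =
        let ((x≥0 , x≤1) , (y≥0 , y≤1)) = bound c
            (τ , w , τ∈ , r) = covered {m} tri {½ * (qˣ + cx c)} {½ * (qʸ + cy c)} {on-level i j ½ ½}
              x≥0 x≤1 y≥0 y≤1 (0≤on-level i j {½} {½} ⊢≤ ⊢≤) (sum-on-level i j ½ ½)
            (lA , lB , hx , hy , ΣA , ΣB) = Rep₂⁻¹ {m} {τ} i≢j r
        in record
          { τ = τ ; τ∈ = τ∈ ; lA = double {τ} lA ; lB = double {τ} lB
          ; hx = coord (w i) (w j) 1F 3F hx ; hy = coord (w i) (w j) 2F 3F hy
          ; ΣA = total (w i) ΣA ; ΣB = total (w j) ΣB }

    -- If level `j` supplies a single corner c′, the remaining coordinates place q + c - c′ in the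
    -- unit square, and this leaves c′ = c only.
    concentrated⇒translated : ∀ {c} (C : Cell i j c) → Concentrated (Cell.B C) → Pair.Translated i≢j c
    concentrated⇒translated {c} C (c′ , off) = τ , A , τ∈ , lA , XA , YA , ΣA
        , subst (λ c → combine j c ∈ τ) (sym c≡c′)
            (Local.nonzero⇒∈ {m} {τ} lB λ e → 1≢0 (trans (sym Bc′≡1) e))
      where
      open Cell C
      Bc′≡1 : B c′ ≡ 1ℚ
      Bc′≡1 = trans (sym (Σ₄-only c′ off)) ΣB
      B≡ : ∀ k → B k ≡ basis c′ k
      B≡ k with c′ ≟ k
      ... | yes refl = Bc′≡1
      ... | no c′≢k = off k (≢-sym c′≢k)
      sub : ∀ a {b t x y} → a + b ≡ x + y → b ≡ t → a ≡ x + y - t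
      sub a {b} {t} {x} {y} e e′ = by₂ 1ℚ e (- 1ℚ) e′ (solve 5 (λ a b t x y →
        a := x :+ y :- t :+ con 1ℚ :* (a :+ b :- (x :+ y)) :+ con (- 1ℚ) :* (b :- t)) refl a b t x y)
      XA′ : X A ≡ qˣ + cx c - cx c′
      XA′ = sub (X A) {x = qˣ} {cx c} hx (trans (cong₂ _+_ (B≡ 1F) (B≡ 3F)) (sym (cx-basis c′)))
      YA′ : Y A ≡ qʸ + cy c - cy c′
      YA′ = sub (Y A) {x = qʸ} {cy c} hy (trans (cong₂ _+_ (B≡ 2F) (B≡ 3F)) (sym (cy-basis c′)))
      A≥0 = Local.nonneg lA
      c≡c′ : c ≡ c′
      c≡c′ = only-own-corner c c′
        ( ( subst (0ℚ ≤_) XA′ (0≤+ (A≥0 1F) (A≥0 3F))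
          , subst₂ _≤_ XA′ ΣA (≤-by (A 0F + A 2F) (0≤+ (A≥0 0F) (A≥0 2F))
              (solve 4 (λ a b c d → a :+ (b :+ (c :+ d)) := (b :+ d) :+ (a :+ c)) refl (A 0F) (A 1F) (A 2F) (A 3F))) )
        , ( subst (0ℚ ≤_) YA′ (0≤+ (A≥0 2F) (A≥0 3F))
          , subst₂ _≤_ YA′ ΣA (≤-by (A 0F + A 1F) (0≤+ (A≥0 0F) (A≥0 1F))
              (solve 4 (λ a b c d → a :+ (b :+ (c :+ d)) := (c :+ d) :+ (a :+ b)) refl (A 0F) (A 1F) (A 2F) (A 3F))) ) )
      cancel : ∀ x y → x + y - y ≡ x
      cancel = solve 2 (λ x y → x :+ y :- y := x) refl
      XA : X A ≡ qˣ
      XA = trans XA′ (trans (cong (λ d → qˣ + cx c - cx d) (sym c≡c′)) (cancel qˣ (cx c)))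
      YA : Y A ≡ qʸ
      YA = trans YA′ (trans (cong (λ d → qʸ + cy c - cy d) (sym c≡c′)) (cancel qʸ (cy c)))

  module _ {i j : Fin m} (i≢j : i ≢ j) where
    private
      I J M : Fin 4 → Set
      I = Pair.Translated i≢j
      J = Pair.Translated (≢-sym i≢j)
      M = MixedCell i j

      -- A factor with a single corner leaves a translated triangle of the other level; otherwise
      -- the cell has an edge in both levels.
      classify : ∀ c → I c ⊎ (J c ⊎ M c)
      classify c with two-nonzero? (Cell.B (cell i≢j c))
      ... | inj₂ conc = inj₁ (concentrated⇒translated i≢j (cell i≢j c) conc)
      ... | inj₁ twoB with two-nonzero? (Cell.A (cell i≢j c))
      ...   | inj₂ conc = inj₂ (inj₁ (concentrated⇒translated (≢-sym i≢j) (Cell-sym (cell i≢j c)) conc))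
      ...   | inj₁ twoA = inj₂ (inj₂ (cell i≢j c , twoA , twoB))

      TwoMixed : Set
      TwoMixed = ∃[ c ] ∃[ c′ ] (c ≢ c′ × M c × M c′)

      not-I : ∀ {c c′} → c ≢ c′ → I c → J c′ ⊎ M c′
      not-I {c′ = c′} c≢c′ p with classify c′
      ... | inj₁ p′ = ⊥-elim (c≢c′ (Pair.translated-unique i≢j p p′))
      ... | inj₂ r = r

      not-J : ∀ {c c′} → c ≢ c′ → J c → J c′ ⊎ M c′ → M c′
      not-J c≢c′ p (inj₁ p′) = ⊥-elim (c≢c′ (Pair.translated-unique (≢-sym i≢j) p p′))
      not-J c≢c′ p (inj₂ r) = r

      three : ∀ {a b c} → a ≢ b → a ≢ c → b ≢ c → J a ⊎ M a → J b ⊎ M b → J c ⊎ M c → TwoMixed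
      three a≢b a≢c b≢c (inj₁ p) q r = _ , _ , b≢c , not-J a≢b p q , not-J a≢c p r
      three a≢b a≢c b≢c (inj₂ p) (inj₁ q) r = _ , _ , a≢c , p , not-J b≢c q r
      three a≢b a≢c b≢c (inj₂ p) (inj₂ q) r = _ , _ , a≢b , p , q

      two-mixed : TwoMixed
      two-mixed with classify 0F | classify 1F | classify 2F
      ... | inj₁ p | _ | _ = three {1F} {2F} {3F} (λ ()) (λ ()) (λ ())
                               (not-I (λ ()) p) (not-I (λ ()) p) (not-I (λ ()) p)
      ... | inj₂ p | inj₁ q | _ = three {0F} {2F} {3F} (λ ()) (λ ()) (λ ()) p (not-I (λ ()) q) (not-I (λ ()) q)
      ... | inj₂ p | inj₂ q | inj₁ r = three {0F} {1F} {3F} (λ ()) (λ ()) (λ ()) p q (not-I (λ ()) r)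
      ... | inj₂ p | inj₂ q | inj₂ r = three {0F} {1F} {2F} (λ ()) (λ ()) (λ ()) p q r

      serves-mixed : ∀ {c} ((C , _) : M c) → Serves {m} {i} {j} (Cell.τ C)
      serves-mixed (C , (a , a′ , a≢ , a≢0 , a′≢0) , (b , b′ , b≢ , b≢0 , b′≢0)) =
        Serves-≢ {m} {τ} i≢j
          (type≥1 {m} {τ} {i} a≢ (Local.nonzero⇒∈ {m} {τ} lA a≢0) (Local.nonzero⇒∈ {m} {τ} lA a′≢0))
          (type≥1 {m} {τ} {j} b≢ (Local.nonzero⇒∈ {m} {τ} lB b≢0) (Local.nonzero⇒∈ {m} {τ} lB b′≢0))
        where open Cell C

      -- A third corner in level `i` would put a triangle beside the edge of level `j`.
      off-edge : ∀ {τ i j a a′ b b′} → τ ∈ˡ 𝒯 → i ≢ j → a ≢ a′ → b ≢ b′ →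
        combine i a ∈ τ → combine i a′ ∈ τ → combine j b ∈ τ → combine j b′ ∈ τ →
        ∀ k → k ≢ a → k ≢ a′ → combine {m} i k ∉ τ
      off-edge {τ} {i} {j} τ∈ i≢j a≢ b≢ a∈ a′∈ b∈ b′∈ k k≢a k≢a′ k∈ =
        no-triangle-edge {m} {τ} (ind τ∈) i≢j
          (type≥2 {m} {τ} {i} a≢ (≢-sym k≢a) (≢-sym k≢a′) a∈ a′∈ k∈)
          (type≥1 {m} {τ} {j} b≢ b∈ b′∈)

    -- By `off-edge` the simplex has exactly an edge in each of the two levels, so both points lie
    -- in the same parallelogram. Holding two of them, it is spanned by crossing diagonals, and
    -- these are the ones recorded by `diag`.
    same-simplex⇒crossing : ∀ {c c′} → c ≢ c′ → ((C , _) : M c) ((C′ , _) : M c′) → Cell.τ C ≡ Cell.τ C′ →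
                            diag i ≢ diag j
    same-simplex⇒crossing {c} {c′} c≢c′ (C , (a , a′ , a≢ , a≢0 , a′≢0) , (b , b′ , b≢ , b≢0 , b′≢0)) (C′ , _) τ≡τ′ =
      different (two-fit⇒crossing a a′ b b′ c c′ (a≢ , b≢ , c≢c′) (fit C refl) (fit C′ (sym τ≡τ′)))
      where
      open Cell C
      a∈ = Local.nonzero⇒∈ {m} {τ} lA a≢0
      a′∈ = Local.nonzero⇒∈ {m} {τ} lA a′≢0
      b∈ = Local.nonzero⇒∈ {m} {τ} lB b≢0
      b′∈ = Local.nonzero⇒∈ {m} {τ} lB b′≢0
      fit : ∀ {c} (D : Cell i j c) → Cell.τ D ≡ τ → Fits a a′ b b′ c
      fit {c} D e = fits {D.A} {D.B} a≢ b≢ (Local.nonneg D.lA) (Local.nonneg D.lB)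
        (λ k k≢a k≢a′ → Local.supp D.lA k (subst (combine i k ∉_) (sym e)
          (off-edge {τ} τ∈ i≢j a≢ b≢ a∈ a′∈ b∈ b′∈ k k≢a k≢a′)))
        (λ k k≢b k≢b′ → Local.supp D.lB k (subst (combine j k ∉_) (sym e)
          (off-edge {τ} τ∈ (≢-sym i≢j) b≢ a≢ b∈ b′∈ a∈ a′∈ k k≢b k≢b′)))
        c D.hx D.hy D.ΣA D.ΣB
        where module D = Cell D
      main-true : ∀ {i u u′} → Main u u′ → combine i u ∈ τ → combine i u′ ∈ τ → diag i ≡ true
      main-true (inj₁ (refl , refl)) p q = diag-main {τ = τ} τ∈ p q
      main-true (inj₂ (refl , refl)) p q = diag-main {τ = τ} τ∈ q p
      anti-false : ∀ {i u u′} → Anti u u′ → combine i u ∈ τ → combine i u′ ∈ τ → diag i ≡ false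
      anti-false (inj₁ (refl , refl)) p q = diag-anti {τ = τ} τ∈ p q
      anti-false (inj₂ (refl , refl)) p q = diag-anti {τ = τ} τ∈ q p
      different : Crossing a a′ b b′ → diag i ≢ diag j
      different (inj₁ (p , q)) e = true≢false (trans (sym (main-true p a∈ a′∈)) (trans e (anti-false q b∈ b′∈)))
      different (inj₂ (p , q)) e = true≢false (trans (sym (main-true q b∈ b′∈)) (trans (sym e) (anti-false p a∈ a′∈)))

    count-pair : 1 ℕ.≤ count {m} 𝒯 i j × (diag i ≡ diag j → 2 ℕ.≤ count {m} 𝒯 i j)
    count-pair with two-mixed
    ... | c , c′ , c≢c′ , M₁@(C , _) , M₂@(C′ , _) =
        count≥1 {m} (Cell.τ∈ C) (serves-mixed M₁)
      , λ same → count≥2 {m} (λ e → same-simplex⇒crossing c≢c′ M₁ M₂ e same)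
          (Cell.τ∈ C) (Cell.τ∈ C′) (serves-mixed M₁) (serves-mixed M₂)

-- Summation over the pairs of levels

sumℕ-mono : ∀ {n} {f g : Fin n → ℕ} → (∀ i → f i ℕ.≤ g i) → sumℕ f ℕ.≤ sumℕ g
sumℕ-mono {zero}  h = z≤n
sumℕ-mono {suc n} h = ℕₚ.+-mono-≤ (h zero) (sumℕ-mono (λ i → h (suc i)))

sumℕ-const : ∀ n c → sumℕ {n} (λ _ → c) ≡ n ℕ.* c
sumℕ-const zero    c = refl
sumℕ-const (suc n) c = cong (c ℕ.+_) (sumℕ-const n c)

sumℕ-*ʳ : ∀ {n} (f : Fin n → ℕ) c → sumℕ (λ i → f i ℕ.* c) ≡ sumℕ f ℕ.* c
sumℕ-*ʳ {zero}  f c = refl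
sumℕ-*ʳ {suc n} f c = trans (cong (f zero ℕ.* c ℕ.+_) (sumℕ-*ʳ (λ i → f (suc i)) c))
  (sym (ℕₚ.*-distribʳ-+ c (f zero) _))

same : Bool → Bool → ℕ
same true true   = 1
same false false  = 1
same _ _      = 0

module _ {m} (d : Fin m → Bool) where
  size : Bool → ℕ
  size b = sumℕ (λ i → same b (d i))

  size-total : size true ℕ.+ size false ≡ m
  size-total = trans (sym (ℕ∑-distrib-+ {m} (λ i → same true (d i)) _))
    (trans (sumℕ-cong {m} λ i → one (d i)) (trans (sumℕ-const m 1) (ℕₚ.*-identityʳ m)))
    where
    one : ∀ b → same true b  ℕ.+ same false b  ≡ 1
    one true = refl
    one false = refl

  sum-classes : ∀ (f : Bool → ℕ) → sumℕ (λ i → f (d i)) ≡ size true ℕ.* f true ℕ.+ size false ℕ.* f false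
  sum-classes f = trans (sumℕ-cong {m} λ i → split (d i)) (trans
    (ℕ∑-distrib-+ {m} (λ i → same true (d i) ℕ.* f true) _)
    (cong₂ ℕ._+_ (sumℕ-*ʳ {m} _ (f true)) (sumℕ-*ʳ {m} _ (f false))))
    where
    split : ∀ b → f b ≡ same true b  ℕ.* f true ℕ.+ same false b  ℕ.* f false
    split true  = sym (trans (ℕₚ.+-identityʳ _) (ℕₚ.*-identityˡ (f true)))
    split false = sym (ℕₚ.*-identityˡ (f false))

  bound : ℕ
  bound = size true ℕ.* size true ℕ.+ size true ℕ.* size false ℕ.+ size false ℕ.* size false

  -- With m = k + l the sum is k (m + k) + l (m + l).
  sum-pairs : sumℕ (λ i → sumℕ (λ j → 1 ℕ.+ same (d i) (d j))) ≡ 2 ℕ.* bound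
  sum-pairs = trans (sumℕ-cong {m} λ i → trans (ℕ∑-distrib-+ {m} (λ _ → 1) (λ j → same (d i) (d j)))
      (cong (ℕ._+ size (d i)) (sumℕ-const m 1)))
    (trans (sum-classes (λ b → m ℕ.* 1 ℕ.+ size b))
      (trans (cong (λ n → k ℕ.* (n ℕ.* 1 ℕ.+ k) ℕ.+ l ℕ.* (n ℕ.* 1 ℕ.+ l)) (sym size-total))
        (solveℕ 2 (λ k l → k ⊗ ((k ⊕ l) ⊗ # 1 ⊕ k) ⊕ l ⊗ ((k ⊕ l) ⊗ # 1 ⊕ l)
          :=ℕ # 2 ⊗ (k ⊗ k ⊕ k ⊗ l ⊕ l ⊗ l)) refl k l)))
    where
    k = size true
    l = size false

-- 4 (k² + k l + l²) = 3 (k + l)² + (k - l)²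
quarter : ∀ k l → 3 ℕ.* ((k ℕ.+ l) ℕ.* (k ℕ.+ l)) ℕ.≤ 4 ℕ.* (k ℕ.* k ℕ.+ k ℕ.* l ℕ.+ l ℕ.* l)
quarter k l with ℕₚ.≤-total k l
... | inj₁ k≤l = subst (λ l → 3 ℕ.* ((k ℕ.+ l) ℕ.* (k ℕ.+ l)) ℕ.≤ 4 ℕ.* (k ℕ.* k ℕ.+ k ℕ.* l ℕ.+ l ℕ.* l))
  (ℕₚ.m+[n∸m]≡n k≤l) (below k (l ℕ.∸ k))
  where
  below : ∀ k e → 3 ℕ.* ((k ℕ.+ (k ℕ.+ e)) ℕ.* (k ℕ.+ (k ℕ.+ e))) ℕ.≤
                  4 ℕ.* (k ℕ.* k ℕ.+ k ℕ.* (k ℕ.+ e) ℕ.+ (k ℕ.+ e) ℕ.* (k ℕ.+ e))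
  below k e = ℕₚ.m+n≤o⇒m≤o _ {e ℕ.* e} (ℕₚ.≤-reflexive
    (solveℕ 2 (λ k e → # 3 ⊗ ((k ⊕ (k ⊕ e)) ⊗ (k ⊕ (k ⊕ e))) ⊕ e ⊗ e
      :=ℕ # 4 ⊗ (k ⊗ k ⊕ k ⊗ (k ⊕ e) ⊕ (k ⊕ e) ⊗ (k ⊕ e))) refl k e))
... | inj₂ l≤k = subst (λ k → 3 ℕ.* ((k ℕ.+ l) ℕ.* (k ℕ.+ l)) ℕ.≤ 4 ℕ.* (k ℕ.* k ℕ.+ k ℕ.* l ℕ.+ l ℕ.* l))
  (ℕₚ.m+[n∸m]≡n l≤k) (above l (k ℕ.∸ l))
  where
  above : ∀ l e → 3 ℕ.* ((l ℕ.+ e ℕ.+ l) ℕ.* (l ℕ.+ e ℕ.+ l)) ℕ.≤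
                  4 ℕ.* ((l ℕ.+ e) ℕ.* (l ℕ.+ e) ℕ.+ (l ℕ.+ e) ℕ.* l ℕ.+ l ℕ.* l)
  above l e = ℕₚ.m+n≤o⇒m≤o _ {e ℕ.* e} (ℕₚ.≤-reflexive
    (solveℕ 2 (λ l e → # 3 ⊗ ((l ⊕ e ⊕ l) ⊗ (l ⊕ e ⊕ l)) ⊕ e ⊗ e
      :=ℕ # 4 ⊗ ((l ⊕ e) ⊗ (l ⊕ e) ⊕ (l ⊕ e) ⊗ l ⊕ l ⊗ l)) refl l e))

-- Double counting: the counts of all pairs add up to what the single simplices serve, and each of
-- these is bounded by twice its weight.
counts≤weights : ∀ {m} (T : List (VertexSet m)) → (∀ {τ} → τ ∈ˡ T → Independent {m} τ) →
  ι (sumℕ (λ i → sumℕ (λ j → count {m} T i j))) ≤ ι 2 * totalWeight m T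
counts≤weights {m} [] _ = ≤-reflexive (trans
  (cong ι (trans (sumℕ-cong {m} λ i → trans (sumℕ-const m 0) (ℕₚ.*-zeroʳ m)) (trans (sumℕ-const m 0) (ℕₚ.*-zeroʳ m))))
  (sym (*-zeroʳ (ι 2))))
counts≤weights {m} (τ ∷ T) ind = begin
  ι (sumℕ (λ i → sumℕ (λ j → serves t i j ℕ.+ count {m} T i j)))
    ≡⟨ cong ι (trans (sumℕ-cong {m} λ i → ℕ∑-distrib-+ {m} (serves t i) (count {m} T i))
         (ℕ∑-distrib-+ {m} (λ i → sumℕ (serves t i)) _)) ⟩
  ι (Σserves t ℕ.+ sumℕ (λ i → sumℕ (λ j → count {m} T i j)))
    ≡⟨ ι-+ (Σserves t) _ ⟩
  ι (Σserves t) + ι (sumℕ (λ i → sumℕ (λ j → count {m} T i j)))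
    ≤⟨ +-mono-≤ (serves≤weight {m} τ (ind (here refl))) (counts≤weights {m} T (λ τ∈ → ind (there τ∈))) ⟩
  ι 2 * weight m τ + ι 2 * totalWeight m T
    ≡⟨ *-distribˡ-+ (ι 2) (weight m τ) (totalWeight m T) ⟨
  ι 2 * (weight m τ + totalWeight m T) ∎
  where
  open ℚₚ.≤-Reasoning
  t = simplexType m τ

-- The count of a pair is at least 2 for equal diagonals, a level with itself included, and at least
-- 1 otherwise. The sizes of the two classes depend on `T`, hence the existential `n`.
total-lower : ∀ m T → Triangulates m T →
              ∃[ n ] (3 ℕ.* (m ℕ.* m) ℕ.≤ 4 ℕ.* n × ι n ≤ totalWeight m T)
total-lower m T tri = bound d
  , subst (λ n → 3 ℕ.* (n ℕ.* n) ℕ.≤ 4 ℕ.* bound d) (size-total d) (quarter (size d true) (size d false))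
  , ℚₚ.*-cancelˡ-≤-pos (ι 2) (≤-trans (≤-reflexive (sym (ι-* 2 (bound d))))
      (≤-trans (ι-mono (ℕₚ.≤-trans (ℕₚ.≤-reflexive (sym (sum-pairs d))) (sumℕ-mono λ i → sumℕ-mono λ j → each i j)))
        (counts≤weights {m} T (independent {m} tri))))
  where
  d = Triangulation.diag {m} tri
  each : ∀ i j → 1 ℕ.+ same (d i) (d j) ℕ.≤ count {m} T i j
  each i j with i ≟ j
  ... | yes refl = ℕₚ.≤-trans (ℕₚ.≤-reflexive (cong suc (self (d i)))) (Triangulation.count-level {m} tri i)
    where
    self : ∀ b → same b b  ≡ 1
    self true = refl
    self false = refl
  ... | no i≢j = compare (d i) (d j) (Mixed.count-pair {m} tri i≢j)
    where
    compare : ∀ {n} b b′ → 1 ℕ.≤ n × (b ≡ b′ → 2 ℕ.≤ n) → 1 ℕ.+ same b b′ ℕ.≤ n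
    compare true  true  (_ , h) = h refl
    compare true  false (h , _) = h
    compare false true  (h , _) = h
    compare false false (_ , h) = h refl

-- The cells of the optimal triangulation

-- The levels alternate between the two diagonals. At a level of group true the
-- corners 11 and 00 are the high and the low end, at one of group false 10 and 01.
group : ∀ {m} → Fin m → Bool
group zero    = true
group (suc i) = not (group i)

-- Names for the corners relative to the diagonal of the level, so that one description serves both
-- groups. The corner `plus` lies on the side to which the diagonals of the other group point from
-- `lo` to `hi`.
data Label : Set where
  hi lo plus minus : Label

label : Bool → Fin 4 → Label
label true  0F = lo
label true  1F = plus
label true  2F = minus
label true  3F = hi
label false 0F = minus
label false 1F = hi
label false 2F = lo
label false 3F = plus

-- `central p q` is the parallelogram of two crossing diagonals. In `mid s p q` the other group
-- stays at one end, and the levels of the group of `p` are at `hi` before `p`, at a side corner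
-- chosen by `s` between `p` and `q`, and at `lo` after `q`. This is a triangle for p = q and
-- otherwise a parallelogram of two sides of squares.
data Cell (m : ℕ) : Set where
  central : (p q : Fin m) → group p ≡ true → group q ≡ false → Cell m
  mid     : Bool → (p q : Fin m) → group p ≡ group q → toℕ p ℕ.≤ toℕ q → Cell m

-- A cell as seen from one level, with numbers for the thresholds. In `cen t r` the threshold of the
-- level's own group comes first; `own` and `oth` tell whether the level belongs to the group of `p`
-- and `q`.
data Profile : Set where
  cen     : (t r : ℕ) → Profile
  own oth : Bool → (p q : ℕ) → Profile

profile : ∀ {m} → Cell m → Fin m → Profile
profile (central p q _ _) i = if group i then cen (toℕ p) (toℕ q) else cen (toℕ q) (toℕ p)
profile (mid s p q _ _)   i = if does (group i ≟ᵇ group p) then own s (toℕ p) (toℕ q) else oth s (toℕ p) (toℕ q)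

-- Reflection in the diagonal of the level, which reduces the cells on one side to those on the
-- other.
turn : Bool → Label → Label
turn false plus  = minus
turn false minus = plus
turn _     l     = l

_≤ᵈ_ : ℕ → ℕ → Bool
a ≤ᵈ b = does (a ℕₚ.≤? b)

member : Profile → ℕ → Label → Bool
member-own : ℕ → ℕ → ℕ → Label → Bool
member-own p q i hi    = i ≤ᵈ p
member-own p q i lo    = q ≤ᵈ i
member-own p q i plus  = (p ≤ᵈ i) ∧ (i ≤ᵈ q)
member-own p q i minus = false
member (cen t r)       i hi    = i ≤ᵈ t
member (cen t r)       i lo    = t ≤ᵈ i
member (cen t r)       i plus  = false
member (cen t r)       i minus = false
member (own s p q)     i l     = member-own p q i (turn s l)
member (oth true  p q) i hi    = true
member (oth false p q) i lo    = true
member (oth _     p q) i _     = false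

-- Slacks of the cells

ι≡0 : ∀ {n} → ι n ≡ 0ℚ → n ≡ 0
ι≡0 {n} e = ℕₚ.n≤0⇒n≡0 (ι-cancel-≤ {n} {0} (≤-reflexive e))

abstract
  -- The positive part of a - b: it vanishes on one side of a threshold and grows linearly on the
  -- other.
  gap : ℕ → ℕ → ℚ
  gap a b = ι (a ∸ b)

  0≤gap : ∀ a b → 0ℚ ≤ gap a b
  0≤gap a b = 0≤ι (a ∸ b)

  gap-0 : ∀ {a b} → a ℕ.≤ b → gap a b ≡ 0ℚ
  gap-0 a≤b = cong ι (ℕₚ.m≤n⇒m∸n≡0 a≤b)

  gap-0⁻¹ : ∀ {a b} → gap a b ≡ 0ℚ → a ℕ.≤ b
  gap-0⁻¹ {a} {b} e = ℕₚ.m∸n≡0⇒m≤n (ι≡0 {a ∸ b} e)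

  ι-split : ∀ {a b} → a ℕ.≤ b → ι b ≡ ι a + gap b a
  ι-split {a} {b} a≤b = trans (cong ι (sym (ℕₚ.m+[n∸m]≡n a≤b))) (ι-+ a (b ∸ a))

-- Height of a vertex above the affine function supporting a cell
slack : ℕ → Profile → ℕ → Label → ℚ
slack-own : ℕ → ℕ → ℕ → ℕ → Label → ℚ
slack-own m p q i hi    = gap i p + gap i q
slack-own m p q i lo    = gap p i + gap q i
slack-own m p q i plus  = gap i q + gap p i
slack-own m p q i minus = ι m + ι m + gap q p + (gap i q + gap p i)
slack m (cen t r)       i hi    = gap i t + gap i t
slack m (cen t r)       i lo    = gap t i + gap t i
slack m (cen t r)       i plus  = gap m r + (gap i t + gap t i)
slack m (cen t r)       i minus = ι m + ι r + (gap i t + gap t i)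
slack m (own s p q)     i l     = slack-own m p q i (turn s l)
slack m (oth true  p q) i hi    = 0ℚ
slack m (oth true  p q) i lo    = gap m i + gap m i + gap q p
slack m (oth true  p q) i plus  = gap m p + gap m i
slack m (oth true  p q) i minus = gap m i + (ι m + ι q)
slack m (oth false p q) i lo    = 0ℚ
slack m (oth false p q) i hi    = ι m + ι m + (ι i + ι i + gap q p)
slack m (oth false p q) i plus  = gap m p + (ι i + ι m)
slack m (oth false p q) i minus = ι m + ι m + (ι i + ι q)

gap-- : ∀ a b → gap a b - gap b a ≡ ι a - ι b
gap-- a b with ℕₚ.≤-total a b
... | inj₁ a≤b = by₂ 1ℚ (gap-0 a≤b) 1ℚ (ι-split a≤b)
  (solve 4 (λ x y a b → x :- y := a :- b :+ con 1ℚ :* (x :- con 0ℚ) :+ con 1ℚ :* (b :- (a :+ y))) refl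
    (gap a b) (gap b a) (ι a) (ι b))
... | inj₂ b≤a = by₂ (- 1ℚ) (gap-0 b≤a) (- 1ℚ) (ι-split b≤a)
  (solve 4 (λ x y a b → x :- y := a :- b :+ con (- 1ℚ) :* (y :- con 0ℚ) :+ con (- 1ℚ) :* (a :- (b :+ x))) refl
    (gap a b) (gap b a) (ι a) (ι b))

gap-≤ : ∀ {a b} → a ℕ.≤ b → gap b a ≡ ι b - ι a
gap-≤ {a} {b} a≤b = by₁ (- 1ℚ) (ι-split a≤b)
  (solve 3 (λ a b y → y := b :- a :+ con (- 1ℚ) :* (b :- (a :+ y))) refl (ι a) (ι b) (gap b a))

<⇒gap≢0 : ∀ {a b} → b ℕ.< a → gap a b ≢ 0ℚ
<⇒gap≢0 b<a e = ℕₚ.<⇒≱ b<a (gap-0⁻¹ e)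

≤ᵈ-true : ∀ {a b} → a ℕ.≤ b → (a ≤ᵈ b) ≡ true
≤ᵈ-true {a} {b} = dec-true (a ℕₚ.≤? b)

≤ᵈ-false : ∀ {a b} → b ℕ.< a → (a ≤ᵈ b) ≡ false
≤ᵈ-false {a} {b} b<a = dec-false (a ℕₚ.≤? b) (ℕₚ.<⇒≱ b<a)

≤ᵈ-true⁻¹ : ∀ {a b} → (a ≤ᵈ b) ≡ true → a ℕ.≤ b
≤ᵈ-true⁻¹ {a} {b} e = ℕₚ.≤ᵇ⇒≤ a b (subst So (sym e) _)

∧-true⁻¹ : ∀ {a b} → a ∧ b ≡ true → a ≡ true × b ≡ true
∧-true⁻¹ {true} {true} _ = refl , refl

private
  0+0 : ∀ {a b} → a ≡ 0ℚ → b ≡ 0ℚ → a + b ≡ 0ℚ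
  0+0 refl refl = refl

  first≡0 : ∀ {a b} → 0ℚ ≤ a → 0ℚ ≤ b → a + b ≡ 0ℚ → a ≡ 0ℚ
  first≡0 h h′ e = proj₁ (+-zero-split h h′ e)

-- The bounds on the thresholds under which the zeros of the slack are exactly the members of the
-- cell.
data Proper (m : ℕ) : Profile → Set where
  cen : ∀ {t r} → r ℕ.< m → Proper m (cen t r)
  own : ∀ {s p q} → p ℕ.≤ q → Proper m (own s p q)
  oth : ∀ {s p q} → p ℕ.< m → p ℕ.≤ q → Proper m (oth s p q)

signed : Bool → ℚ → ℚ
signed true  x = x
signed false x = - x

sum-signed : ∀ {n} s (f : Fin n → ℚ) → sum (λ i → signed s (f i)) ≡ signed s (sum f)
sum-signed true f = refl
sum-signed {n} false f = trans (sum-cong-≗ {n} λ i → sym (-1* (f i))) (trans (sum-*ˡ {n} (- 1ℚ) f) (-1* (sum f)))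
  where
  -1* : ∀ x → (- 1ℚ) * x ≡ - x
  -1* = solve 1 (λ x → con (- 1ℚ) :* x := :- x) refl

module _ {m i : ℕ} (i<m : i ℕ.< m) where
  private
    0<m : 0 ℕ.< m
    0<m = ℕₚ.≤-<-trans z≤n i<m

    m≢0 : ι m ≢ 0ℚ
    m≢0 e = ℕₚ.<⇒≢ 0<m (sym (ι≡0 e))

    gap+ : ∀ a b c d → 0ℚ ≤ gap a b + gap c d
    gap+ a b c d = 0≤+ (0≤gap a b) (0≤gap c d)

    ι+ : ∀ a b → 0ℚ ≤ ι a + ι b
    ι+ a b = 0≤+ (0≤ι a) (0≤ι b)

  slack-own-nonneg : ∀ p q l → 0ℚ ≤ slack-own m p q i l
  slack-own-nonneg p q hi    = gap+ i p i q
  slack-own-nonneg p q lo    = gap+ p i q i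
  slack-own-nonneg p q plus  = gap+ i q p i
  slack-own-nonneg p q minus = 0≤+ (0≤+ (ι+ m m) (0≤gap q p)) (gap+ i q p i)

  slack-nonneg : ∀ π l → 0ℚ ≤ slack m π i l
  slack-nonneg (cen t r)       hi    = gap+ i t i t
  slack-nonneg (cen t r)       lo    = gap+ t i t i
  slack-nonneg (cen t r)       plus  = 0≤+ (0≤gap m r) (gap+ i t t i)
  slack-nonneg (cen t r)       minus = 0≤+ (ι+ m r) (gap+ i t t i)
  slack-nonneg (own s p q)     l     = slack-own-nonneg p q (turn s l)
  slack-nonneg (oth true  p q) hi    = ≤-refl
  slack-nonneg (oth true  p q) lo    = 0≤+ (gap+ m i m i) (0≤gap q p)
  slack-nonneg (oth true  p q) plus  = gap+ m p m i
  slack-nonneg (oth true  p q) minus = 0≤+ (0≤gap m i) (ι+ m q)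
  slack-nonneg (oth false p q) lo    = ≤-refl
  slack-nonneg (oth false p q) hi    = 0≤+ (ι+ m m) (0≤+ (ι+ i i) (0≤gap q p))
  slack-nonneg (oth false p q) plus  = 0≤+ (0≤gap m p) (ι+ i m)
  slack-nonneg (oth false p q) minus = 0≤+ (ι+ m m) (ι+ i q)

  member⇒slack : ∀ {π} → Proper m π → ∀ l → member π i l ≡ true → slack m π i l ≡ 0ℚ
  member⇒slack (cen _) hi e = 0+0 (gap-0 (≤ᵈ-true⁻¹ {i} e)) (gap-0 (≤ᵈ-true⁻¹ {i} e))
  member⇒slack (cen {t} _) lo e = 0+0 (gap-0 (≤ᵈ-true⁻¹ {t} e)) (gap-0 (≤ᵈ-true⁻¹ {t} e))
  member⇒slack {own s p q} (own p≤q) l = go (turn s l)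
    where
    go : ∀ l → member-own p q i l ≡ true → slack-own m p q i l ≡ 0ℚ
    go hi e = 0+0 (gap-0 (≤ᵈ-true⁻¹ {i} e)) (gap-0 (ℕₚ.≤-trans (≤ᵈ-true⁻¹ {i} e) p≤q))
    go lo e = 0+0 (gap-0 (ℕₚ.≤-trans p≤q (≤ᵈ-true⁻¹ {q} e))) (gap-0 (≤ᵈ-true⁻¹ {q} e))
    go plus e = let (e₁ , e₂) = ∧-true⁻¹ {p ≤ᵈ i} e in 0+0 (gap-0 (≤ᵈ-true⁻¹ {i} e₂)) (gap-0 (≤ᵈ-true⁻¹ {p} e₁))
  member⇒slack (oth {true} _ _) hi e = refl
  member⇒slack (oth {false} _ _) lo e = refl

  slack⇒member : ∀ {π} → Proper m π → ∀ l → slack m π i l ≡ 0ℚ → member π i l ≡ true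
  slack⇒member {cen t r} _ hi e = ≤ᵈ-true (gap-0⁻¹ (first≡0 (0≤gap i t) (0≤gap i t) e))
  slack⇒member {cen t r} _ lo e = ≤ᵈ-true (gap-0⁻¹ (first≡0 (0≤gap t i) (0≤gap t i) e))
  slack⇒member {cen t r} (cen r<m) plus e =
    ⊥-elim (<⇒gap≢0 r<m (first≡0 (0≤gap m r) (gap+ i t t i) e))
  slack⇒member {cen t r} _ minus e =
    ⊥-elim (m≢0 (first≡0 (0≤ι m) (0≤ι r) (first≡0 (ι+ m r) (gap+ i t t i) e)))
  slack⇒member {own s p q} (own p≤q) l = go (turn s l)
    where
    go : ∀ l → slack-own m p q i l ≡ 0ℚ → member-own p q i l ≡ true
    go hi e = ≤ᵈ-true (gap-0⁻¹ (first≡0 (0≤gap i p) (0≤gap i q) e))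
    go lo e = ≤ᵈ-true (gap-0⁻¹ (proj₂ (+-zero-split (0≤gap p i) (0≤gap q i) e)))
    go plus e = let (e₁ , e₂) = +-zero-split (0≤gap i q) (0≤gap p i) e in
      cong₂ _∧_ (≤ᵈ-true (gap-0⁻¹ e₂)) (≤ᵈ-true (gap-0⁻¹ e₁))
    go minus e = ⊥-elim (m≢0 (first≡0 (0≤ι m) (0≤ι m) (first≡0 (ι+ m m) (0≤gap q p)
      (first≡0 (0≤+ (ι+ m m) (0≤gap q p)) (gap+ i q p i) e))))
  slack⇒member {oth true p q} _ hi e = refl
  slack⇒member {oth true p q} _ lo e =
    ⊥-elim (<⇒gap≢0 i<m (first≡0 (0≤gap m i) (0≤gap m i) (first≡0 (gap+ m i m i) (0≤gap q p) e)))
  slack⇒member {oth true p q} (oth p<m _) plus e = ⊥-elim (<⇒gap≢0 p<m (first≡0 (0≤gap m p) (0≤gap m i) e))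
  slack⇒member {oth true p q} _ minus e = ⊥-elim (<⇒gap≢0 i<m (first≡0 (0≤gap m i) (ι+ m q) e))
  slack⇒member {oth false p q} _ lo e = refl
  slack⇒member {oth false p q} _ hi e = ⊥-elim (m≢0 (first≡0 (0≤ι m) (0≤ι m)
    (first≡0 (ι+ m m) (0≤+ (ι+ i i) (0≤gap q p)) e)))
  slack⇒member {oth false p q} (oth p<m _) plus e = ⊥-elim (<⇒gap≢0 p<m (first≡0 (0≤gap m p) (ι+ i m) e))
  slack⇒member {oth false p q} _ minus e = ⊥-elim (m≢0 (first≡0 (0≤ι m) (0≤ι m) (first≡0 (ι+ m m) (ι+ i q) e)))

  -- All cells come from one height function on the vertices: up to an affine
  -- function of the point with gradient (u , v) / 2 in the directions along and
  -- across the diagonal of the level, the slack is a function of the level only.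
  record Regular (π : Profile) (u v : ℚ) : Set where
    private s = slack m π i
    field
      along  : s hi - s lo ≡ ι i + ι i - u
      across : s plus - s minus ≡ - v
      convex : s hi + s lo - s plus - s minus ≡ - (ι m + ι m)

  -- The gradient is forced by equal slacks at the two ends of the diagonals at the threshold levels
  -- `t` and `r`.
  regular-cen : ∀ {t r} → r ℕ.< m → Regular (cen t r) (ι t + ι t) (ι r + ι r)
  regular-cen {t} {r} r<m = record
    { along = by₁ (1ℚ + 1ℚ) (gap-- i t) (solve 4 (λ x y i t → x :+ x :- (y :+ y)
        := i :+ i :- (t :+ t) :+ con (1ℚ + 1ℚ) :* (x :- y :- (i :- t))) refl (gap i t) (gap t i) (ι i) (ι t))
    ; across = by₁ 1ℚ (gap-≤ (ℕₚ.<⇒≤ r<m)) (solve 4 (λ z g m r → z :+ g :- (m :+ r :+ g)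
        := :- (r :+ r) :+ con 1ℚ :* (z :- (m :- r))) refl (gap m r) (gap i t + gap t i) (ι m) (ι r))
    ; convex = by₁ (- 1ℚ) (gap-≤ (ℕₚ.<⇒≤ r<m)) (solve 5 (λ x y z m r →
        x :+ x :+ (y :+ y) :- (z :+ (x :+ y)) :- (m :+ r :+ (x :+ y))
        := :- (m :+ m) :+ con (- 1ℚ) :* (z :- (m :- r))) refl (gap i t) (gap t i) (gap m r) (ι m) (ι r)) }

  -- For s = true the gradient comes from equal slacks at the ends of the edges of the cell: `hi`
  -- and `plus` at level p give u - v = 2 (p - m), `plus` and `lo` at level q give u + v = 2 (q +
  -- m). The reflection `turn` changes the sign of v.
  regular-own : ∀ s {p q} → p ℕ.≤ q → Regular (own s p q) (ι p + ι q) (signed s (ι m + ι m + (ι q - ι p)))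
  regular-own true {p} {q} p≤q = record
    { along = by₂ 1ℚ (gap-- i p) 1ℚ (gap-- i q) (solve 7 (λ a a′ b b′ i p q →
        a :+ b :- (a′ :+ b′) := i :+ i :- (p :+ q) :+ con 1ℚ :* (a :- a′ :- (i :- p)) :+ con 1ℚ :* (b :- b′ :- (i :- q)))
        refl (gap i p) (gap p i) (gap i q) (gap q i) (ι i) (ι p) (ι q))
    ; across = by₁ (- 1ℚ) (gap-≤ p≤q) (solve 5 (λ g e m p q →
        g :- (m :+ m :+ e :+ g) := :- (m :+ m :+ (q :- p)) :+ con (- 1ℚ) :* (e :- (q :- p)))
        refl (gap i q + gap p i) (gap q p) (ι m) (ι p) (ι q))
    ; convex = by₃ 1ℚ (gap-- i p) (- 1ℚ) (gap-- i q) (- 1ℚ) (gap-≤ p≤q) (solve 9 (λ a a′ b b′ e i p q m →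
        a :+ b :+ (a′ :+ b′) :- (b :+ a′) :- (m :+ m :+ e :+ (b :+ a′))
        := :- (m :+ m) :+ con 1ℚ :* (a :- a′ :- (i :- p)) :+ con (- 1ℚ) :* (b :- b′ :- (i :- q)) :+ con (- 1ℚ) :* (e :- (q :- p)))
        refl (gap i p) (gap p i) (gap i q) (gap q i) (gap q p) (ι i) (ι p) (ι q) (ι m)) }
  regular-own false {p} {q} p≤q = record
    { along = R.along
    ; across = by₁ (- 1ℚ) R.across (solve 3 (λ x y v → y :- x := :- (:- v) :+ con (- 1ℚ) :* (x :- y :- (:- v)))
        refl (slack-own m p q i plus) (slack-own m p q i minus) (ι m + ι m + (ι q - ι p)))
    ; convex = trans (solve 4 (λ a b x y → a :+ b :- y :- x := a :+ b :- x :- y) refl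
        (slack-own m p q i hi) (slack-own m p q i lo) (slack-own m p q i plus) (slack-own m p q i minus)) R.convex }
    where module R = Regular (regular-own true {p} {q} p≤q)

  -- The gradient of `regular-own` with its two components exchanged, since what is along for one
  -- group is across for the other.
  regular-oth : ∀ s {p q} → p ℕ.< m → p ℕ.≤ q → Regular (oth s p q) (signed s (ι m + ι m + (ι q - ι p))) (ι p + ι q)
  regular-oth true {p} {q} p<m p≤q = record
    { along = by₂ (- (1ℚ + 1ℚ)) (gap-≤ (ℕₚ.<⇒≤ i<m)) (- 1ℚ) (gap-≤ p≤q) (solve 6 (λ z e i p q m →
        con 0ℚ :- (z :+ z :+ e) := i :+ i :- (m :+ m :+ (q :- p)) :+ con (- (1ℚ + 1ℚ)) :* (z :- (m :- i))
          :+ con (- 1ℚ) :* (e :- (q :- p))) refl (gap m i) (gap q p) (ι i) (ι p) (ι q) (ι m))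
    ; across = by₁ 1ℚ (gap-≤ (ℕₚ.<⇒≤ p<m)) (solve 5 (λ y z p q m →
        y :+ z :- (z :+ (m :+ q)) := :- (p :+ q) :+ con 1ℚ :* (y :- (m :- p))) refl (gap m p) (gap m i) (ι p) (ι q) (ι m))
    ; convex = by₂ (- 1ℚ) (gap-≤ (ℕₚ.<⇒≤ p<m)) 1ℚ (gap-≤ p≤q) (solve 6 (λ y z e p q m →
        con 0ℚ :+ (z :+ z :+ e) :- (y :+ z) :- (z :+ (m :+ q)) := :- (m :+ m) :+ con (- 1ℚ) :* (y :- (m :- p))
          :+ con 1ℚ :* (e :- (q :- p))) refl (gap m p) (gap m i) (gap q p) (ι p) (ι q) (ι m)) }
  regular-oth false {p} {q} p<m p≤q = record
    { along = by₁ 1ℚ (gap-≤ p≤q) (solve 5 (λ e i p q m →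
        m :+ m :+ (i :+ i :+ e) :- con 0ℚ := i :+ i :- (:- (m :+ m :+ (q :- p))) :+ con 1ℚ :* (e :- (q :- p)))
        refl (gap q p) (ι i) (ι p) (ι q) (ι m))
    ; across = by₁ 1ℚ (gap-≤ (ℕₚ.<⇒≤ p<m)) (solve 5 (λ y i p q m →
        y :+ (i :+ m) :- (m :+ m :+ (i :+ q)) := :- (p :+ q) :+ con 1ℚ :* (y :- (m :- p))) refl (gap m p) (ι i) (ι p) (ι q) (ι m))
    ; convex = by₂ (- 1ℚ) (gap-≤ (ℕₚ.<⇒≤ p<m)) 1ℚ (gap-≤ p≤q) (solve 6 (λ y e i p q m →
        m :+ m :+ (i :+ i :+ e) :+ con 0ℚ :- (y :+ (i :+ m)) :- (m :+ m :+ (i :+ q))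
          := :- (m :+ m) :+ con (- 1ℚ) :* (y :- (m :- p)) :+ con 1ℚ :* (e :- (q :- p)))
        refl (gap m p) (gap q p) (ι i) (ι p) (ι q) (ι m)) }

-- Cells as vertex sets, and their intersections

memberAt : ∀ {m} → Cell m → Fin m → Fin 4 → Bool
memberAt C i c = member (profile C i) (toℕ i) (label (group i) c)

slackAt : ∀ {m} → Cell m → Fin m → Fin 4 → ℚ
slackAt {m} C i c = slack m (profile C i) (toℕ i) (label (group i) c)

⟦_⟧ : ∀ {m} → Cell m → VertexSet m
⟦_⟧ {m} C = Vec.tabulate (λ k → memberAt C (proj₁ (remQuot {m} 4 k)) (proj₂ (remQuot {m} 4 k)))

module _ {m : ℕ} where
  private
    lookup-⟦⟧ : ∀ (C : Cell m) i c → Vec.lookup ⟦ C ⟧ (combine i c) ≡ memberAt C i c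
    lookup-⟦⟧ C i c = trans (lookup∘tabulate _ (combine i c))
      (cong (λ k → memberAt C (proj₁ k) (proj₂ k)) (remQuot-combine {m} i c))

  ∈⟦⟧ : ∀ (C : Cell m) {i c} → memberAt C i c ≡ true → combine i c ∈ ⟦ C ⟧
  ∈⟦⟧ C {i} {c} e = lookup⇒[]= (combine i c) ⟦ C ⟧ (trans (lookup-⟦⟧ C i c) e)

  ∈⟦⟧⁻¹ : ∀ (C : Cell m) {i c} → combine i c ∈ ⟦ C ⟧ → memberAt C i c ≡ true
  ∈⟦⟧⁻¹ C {i} {c} e = trans (sym (lookup-⟦⟧ C i c)) ([]=⇒lookup e)

  level-⟦⟧ : ∀ (C : Cell m) i → level m ⟦ C ⟧ i ≡ Vec.tabulate (memberAt C i)
  level-⟦⟧ C i = tabulate-cong (lookup-⟦⟧ C i)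

  proper : ∀ (C : Cell m) i → Proper m (profile C i)
  proper (central p q _ _) i with group i
  ... | true  = cen (toℕ<n q)
  ... | false = cen (toℕ<n p)
  proper (mid s p q _ p≤q) i with does (group i ≟ᵇ group p)
  ... | true  = own p≤q
  ... | false = oth (toℕ<n p) p≤q

  gradient : Cell m → Bool → ℚ
  gradient (central p q _ _) true  = ι (toℕ p) + ι (toℕ p)
  gradient (central p q _ _) false = ι (toℕ q) + ι (toℕ q)
  gradient (mid s p q _ _) b = if does (b ≟ᵇ group p) then ι (toℕ p) + ι (toℕ q)
    else signed s (ι m + ι m + (ι (toℕ q) - ι (toℕ p)))

  regular : ∀ (C : Cell m) i →
            Regular (toℕ<n i) (profile C i) (gradient C (group i)) (gradient C (not (group i)))
  regular (central p q _ _) i with group i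
  ... | true  = regular-cen (toℕ<n i) (toℕ<n q)
  ... | false = regular-cen (toℕ<n i) (toℕ<n p)
  regular (mid s p q _ p≤q) i with group i | group p
  ... | true  | true  = regular-own (toℕ<n i) s p≤q
  ... | false | false = regular-own (toℕ<n i) s p≤q
  ... | true  | false = regular-oth (toℕ<n i) s (toℕ<n p) p≤q
  ... | false | true  = regular-oth (toℕ<n i) s (toℕ<n p) p≤q

module _ (s : Fin 4 → ℚ) (a b q : ℚ)
  (h₁ : s 3F - s 0F ≡ a) (h₂ : s 1F - s 2F ≡ b) (h₃ : s 0F + s 3F - s 1F - s 2F ≡ q) where

  corner₁ : s 1F ≡ s 0F + ½ * (a + b - q)
  corner₁ = by₃ ½ h₁ ½ h₂ (- ½) h₃ (solve 7 (λ x y z w a b q →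
    y := x :+ con ½ :* (a :+ b :- q) :+ con ½ :* (w :- x :- a) :+ con ½ :* (y :- z :- b)
      :+ con (- ½) :* (x :+ w :- y :- z :- q)) refl (s 0F) (s 1F) (s 2F) (s 3F) a b q)

  corner₂ : s 2F ≡ s 0F + ½ * (a - b - q)
  corner₂ = by₃ ½ h₁ (- ½) h₂ (- ½) h₃ (solve 7 (λ x y z w a b q →
    z := x :+ con ½ :* (a :- b :- q) :+ con ½ :* (w :- x :- a) :+ con (- ½) :* (y :- z :- b)
      :+ con (- ½) :* (x :+ w :- y :- z :- q)) refl (s 0F) (s 1F) (s 2F) (s 3F) a b q)

  corner₃ : s 3F ≡ s 0F + a
  corner₃ = by₁ 1ℚ h₁ (solve 3 (λ x w a → w := x :+ a :+ con 1ℚ :* (w :- x :- a)) refl (s 0F) (s 3F) a)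

private
  -- The numbers h, k and q are common to both functions, so s - t is affine on the square. Paired
  -- with weights of sum 0 it yields its gradient applied to their displacement.
  Σ₄-affine : ∀ (v s t : Fin 4 → ℚ) {h k q U V U′ V′ : ℚ} →
    s 3F - s 0F ≡ h - U → s 1F - s 2F ≡ k - V → s 0F + s 3F - s 1F - s 2F ≡ q →
    t 3F - t 0F ≡ h - U′ → t 1F - t 2F ≡ k - V′ → t 0F + t 3F - t 1F - t 2F ≡ q →
    Σ₄ v ≡ 0ℚ → Σ₄ (λ c → v c * (s c - t c)) ≡
      ½ * (U′ - U + (V′ - V)) * (v 1F + v 3F) + ½ * (U′ - U - (V′ - V)) * (v 2F + v 3F)
  Σ₄-affine v s t {h} {k} {q} {U} {V} {U′} {V′} h₁ h₂ h₃ g₁ g₂ g₃ e = trans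
    (cong₂ _+_ {v 0F * (s 0F - t 0F)} refl (cong₂ _+_ (cong₂ (λ x y → v 1F * (x - y)) (corner₁ s _ _ _ h₁ h₂ h₃) (corner₁ t _ _ _ g₁ g₂ g₃))
      (cong₂ _+_ (cong₂ (λ x y → v 2F * (x - y)) (corner₂ s _ _ _ h₁ h₂ h₃) (corner₂ t _ _ _ g₁ g₂ g₃))
                 (cong₂ (λ x y → v 3F * (x - y)) (corner₃ s _ _ _ h₁ h₂ h₃) (corner₃ t _ _ _ g₁ g₂ g₃)))))
    (by₁ (s 0F - t 0F) e (solve 13 (λ v₀ v₁ v₂ v₃ s t h k q U V U′ V′ →
      v₀ :* (s :- t) :+ (v₁ :* (s :+ con ½ :* (h :- U :+ (k :- V) :- q) :- (t :+ con ½ :* (h :- U′ :+ (k :- V′) :- q)))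
        :+ (v₂ :* (s :+ con ½ :* (h :- U :- (k :- V) :- q) :- (t :+ con ½ :* (h :- U′ :- (k :- V′) :- q)))
        :+ v₃ :* (s :+ (h :- U) :- (t :+ (h :- U′)))))
      := con ½ :* (U′ :- U :+ (V′ :- V)) :* (v₁ :+ v₃) :+ con ½ :* (U′ :- U :- (V′ :- V)) :* (v₂ :+ v₃)
        :+ (s :- t) :* (v₀ :+ (v₁ :+ (v₂ :+ v₃)) :- con 0ℚ)) refl
      (v 0F) (v 1F) (v 2F) (v 3F) (s 0F) (t 0F) h k q U V U′ V′))

module _ {m : ℕ} (C D : Cell m) where
  private
    -- The difference of the two gradients, rewritten from the directions x + y and x - y to x and
    -- y.
    κ₁ κ₂ : ℚ
    κ₁ = ½ * (gradient D true - gradient C true + (gradient D false - gradient C false))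
    κ₂ = ½ * (gradient D true - gradient C true - (gradient D false - gradient C false))

    at-level : ∀ (v : Weights m) i → Σ₄ (v i) ≡ 0ℚ →
      Σ₄ (λ c → v i c * (slackAt C i c - slackAt D i c)) ≡ κ₁ * (v i 1F + v i 3F) + κ₂ * (v i 2F + v i 3F)
    at-level v i e with group i | regular C i | regular D i
    ... | true  | r | s = Σ₄-affine (v i) (at C true) (at D true)
            {ι (toℕ i) + ι (toℕ i)} {0ℚ} {q = - ι m - ι m} {gradient C true} {gradient C false} {gradient D true} {gradient D false}
            (Regular.along r) (trans (Regular.across r) (neg (gradient C false))) (swap (at C true) (Regular.convex r))
            (Regular.along s) (trans (Regular.across s) (neg (gradient D false))) (swap (at D true) (Regular.convex s)) e
      where
      at : Cell m → Bool → Fin 4 → ℚ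
      at E b c = slack m (profile E i) (toℕ i) (label b c)
      neg : ∀ x → - x ≡ 0ℚ - x
      neg = solve 1 (λ x → :- x := con 0ℚ :- x) refl
      swap : ∀ f → f 3F + f 0F - f 1F - f 2F ≡ - (ι m + ι m) → f 0F + f 3F - f 1F - f 2F ≡ - ι m - ι m
      swap f h = by₁ 1ℚ h (solve 5 (λ x y z w m → x :+ y :- z :- w := :- m :- m :+ con 1ℚ :* (y :+ x :- z :- w :- (:- (m :+ m))))
        refl (f 0F) (f 3F) (f 1F) (f 2F) (ι m))
    ... | false | r | s = Σ₄-affine (v i) (at C false) (at D false)
            {0ℚ} {ι (toℕ i) + ι (toℕ i)} {ι m + ι m} {gradient C true} {gradient C false} {gradient D true} {gradient D false}
            (trans (Regular.across r) (neg (gradient C true))) (Regular.along r) (conv (at C false) (Regular.convex r))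
            (trans (Regular.across s) (neg (gradient D true))) (Regular.along s) (conv (at D false) (Regular.convex s)) e
      where
      at : Cell m → Bool → Fin 4 → ℚ
      at E b c = slack m (profile E i) (toℕ i) (label b c)
      neg : ∀ x → - x ≡ 0ℚ - x
      neg = solve 1 (λ x → :- x := con 0ℚ :- x) refl
      conv : ∀ f → f 1F + f 2F - f 3F - f 0F ≡ - (ι m + ι m) → f 0F + f 3F - f 1F - f 2F ≡ ι m + ι m
      conv f h = by₁ (- 1ℚ) h (solve 5 (λ x y z w m → x :+ y :- z :- w := m :+ con (- 1ℚ) :* (z :+ w :- y :- x :- (:- m)))
        refl (f 0F) (f 3F) (f 1F) (f 2F) (ι m + ι m))

  -- Up to a constant at each level, the difference of two slacks has the same gradient everywhere;
  -- it is thus orthogonal to every affine relation of the vertices.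
  energy : ∀ (v : Weights m) → (∀ i → Σ₄ (v i) ≡ 0ℚ) → sumX v ≡ 0ℚ → sumY v ≡ 0ℚ →
    sum (λ i → Σ₄ (λ c → v i c * (slackAt C i c - slackAt D i c))) ≡ 0ℚ
  energy v hl hx hy = trans (sum-cong-≗ {m} λ i → at-level v i (hl i))
    (trans (∑-distrib-+ {m} (λ i → κ₁ * (v i 1F + v i 3F)) _)
      (cong₂ _+_ (trans (sum-*ˡ {m} κ₁ _) (trans (cong (κ₁ *_) hx) (*-zeroʳ κ₁)))
                 (trans (sum-*ˡ {m} κ₂ _) (trans (cong (κ₂ *_) hy) (*-zeroʳ κ₂)))))

  private
    0≤slack : ∀ (E : Cell m) i c → 0ℚ ≤ slackAt E i c
    0≤slack E i c = slack-nonneg (toℕ<n i) (profile E i) (label (group i) c)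

    orthogonal : ∀ (E : Cell m) {w : Weights m} → Supported ⟦ E ⟧ w → ∀ i c → w i c * slackAt E i c ≡ 0ℚ
    orthogonal E {w} supp i c with combine i c ∈? ⟦ E ⟧
    ... | yes c∈ = trans (cong (w i c *_) (member⇒slack (toℕ<n i) (proper E i) (label (group i) c) (∈⟦⟧⁻¹ E c∈)))
                     (*-zeroʳ (w i c))
    ... | no c∉ = trans (cong (_* slackAt E i c) (supp i c c∉)) (*-zeroˡ (slackAt E i c))

  -- Both Σ w slack C and Σ v slack D vanish, and so do therefore the
  -- nonnegative Σ v slack C and Σ w slack D.
  common-support : ∀ {x y h w v} → Rep {m} ⟦ C ⟧ x y h w → Rep {m} ⟦ D ⟧ x y h v → Supported ⟦ C ⟧ v
  common-support {w = w} {v} r s i c c∉ = begin-zero (v i c ℚₚ.≟ 0ℚ)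
    where
    u : Weights m
    u = diff v w
    total : sum (λ i → Σ₄ (λ c → v i c * slackAt C i c + w i c * slackAt D i c)) ≡ 0ℚ
    total = trans (sum-cong-≗ {m} λ i → Σ₄-cong λ c → term i c)
      (energy u (λ i → trans (diff-Σ₄ v w i) (p-q≡0 (trans (Rep.levels s i) (sym (Rep.levels r i)))))
        (trans (diff-X v w) (p-q≡0 (trans (Rep.horiz s) (sym (Rep.horiz r)))))
        (trans (diff-Y v w) (p-q≡0 (trans (Rep.vert s) (sym (Rep.vert r))))))
      where
      term : ∀ i c → v i c * slackAt C i c + w i c * slackAt D i c ≡ u i c * (slackAt C i c - slackAt D i c)
      term i c = by₂ 1ℚ (orthogonal C (Rep.supp r) i c) 1ℚ (orthogonal D (Rep.supp s) i c)
        (solve 4 (λ v w a b → v :* a :+ w :* b := (v :- w) :* (a :- b) :+ con 1ℚ :* (w :* a :- con 0ℚ)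
          :+ con 1ℚ :* (v :* b :- con 0ℚ)) refl (v i c) (w i c) (slackAt C i c) (slackAt D i c))
    0≤term : ∀ i c → 0ℚ ≤ v i c * slackAt C i c + w i c * slackAt D i c
    0≤term i c = 0≤+ (0≤* (Rep.nonneg s i c) (0≤slack C i c)) (0≤* (Rep.nonneg r i c) (0≤slack D i c))
    v*slack≡0 : v i c * slackAt C i c ≡ 0ℚ
    v*slack≡0 = proj₁ (+-zero-split (0≤* (Rep.nonneg s i c) (0≤slack C i c)) (0≤* (Rep.nonneg r i c) (0≤slack D i c))
      (Σ₄-zero (0≤term i) (sum-nonneg-zero {m} (λ i → 0≤Σ₄ (0≤term i)) total i) c))
      where
      0≤Σ₄ : ∀ {f} → (∀ c → 0ℚ ≤ f c) → 0ℚ ≤ Σ₄ f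
      0≤Σ₄ h = 0≤+ (h 0F) (0≤+ (h 1F) (0≤+ (h 2F) (h 3F)))
    slack≢0 : slackAt C i c ≢ 0ℚ
    slack≢0 e = c∉ (∈⟦⟧ C (slack⇒member (toℕ<n i) (proper C i) (label (group i) c) e))
    begin-zero : Dec (v i c ≡ 0ℚ) → v i c ≡ 0ℚ
    begin-zero (yes e) = e
    begin-zero (no v≢0) = ⊥-elim (slack≢0 (zero-product v≢0 v*slack≡0))
      where
      zero-product : ∀ {a b} → a ≢ 0ℚ → a * b ≡ 0ℚ → b ≡ 0ℚ
      zero-product {a} {b} a≢0 e = trans (sym (*-identityˡ b)) (trans
        (cong (_* b) (sym (ℚₚ.*-inverseˡ a)))
        (trans (*-assoc (ℚ.1/ a) a b) (trans (cong (ℚ.1/ a *_) e) (*-zeroʳ (ℚ.1/ a)))))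
        where instance _ = ℚ.≢-nonZero a≢0

  -- By `common-support`, a point of both simplices already has its coordinates on the vertices that
  -- they share, so these span the common face.
  face-to-face : MeetFaceToFace (vertex m) ⟦ C ⟧ ⟦ D ⟧
  face-to-face = ⟦ C ⟧ ∩ ⟦ D ⟧ , p∩q⊆p _ _ , p∩q⊆q _ _ , λ x → mk⇔ (meet x) (apart x)
    where
    meet : ∀ x → _∈conv_ (vertex m) x ⟦ C ⟧ × _∈conv_ (vertex m) x ⟦ D ⟧ → _∈conv_ (vertex m) x (⟦ C ⟧ ∩ ⟦ D ⟧)
    meet x (cC@(_ , _ , _ , Σc , comb) , cD) =
      let (w , r) = conv⇒Rep {m} cC
          (v , s) = conv⇒Rep {m} cD
      in Rep⇒conv {m} {x} {⟦ C ⟧ ∩ ⟦ D ⟧} {v} (record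
        { nonneg = Rep.nonneg s
        ; supp = both (Rep.supp s) (common-support r s)
        ; horiz = Rep.horiz s ; vert = Rep.vert s ; levels = Rep.levels s })
        (trans (sum-cong-≗ {m} λ i → sym (Rep.levels r i))
          (trans (sym (sum-blocks m (proj₁ cC))) Σc))
      where
      both : ∀ {v : Weights m} → Supported ⟦ D ⟧ v → Supported ⟦ C ⟧ v → Supported (⟦ C ⟧ ∩ ⟦ D ⟧) v
      both supD supC i c c∉ with combine i c ∈? ⟦ C ⟧ | combine i c ∈? ⟦ D ⟧
      ... | yes p | yes q = ⊥-elim (c∉ (x∈p∩q⁺ (p , q)))
      ... | no p  | _     = supC i c p
      ... | _     | no q  = supD i c q
    apart : ∀ x → _∈conv_ (vertex m) x (⟦ C ⟧ ∩ ⟦ D ⟧) → _∈conv_ (vertex m) x ⟦ C ⟧ × _∈conv_ (vertex m) x ⟦ D ⟧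
    apart x (c , c≥0 , supp , rest) =
        (c , c≥0 , (λ k k∉ → supp k λ k∈ → k∉ (p∩q⊆p ⟦ C ⟧ ⟦ D ⟧ k∈)) , rest)
      , (c , c≥0 , (λ k k∉ → supp k λ k∈ → k∉ (p∩q⊆q ⟦ C ⟧ ⟦ D ⟧ k∈)) , rest)

-- Affine independence of the cells

at : Bool → Label → Fin 4
at true  lo    = 0F
at true  plus  = 1F
at true  minus = 2F
at true  hi    = 3F
at false minus = 0F
at false hi    = 1F
at false lo    = 2F
at false plus  = 3F

label-at : ∀ b l → label b (at b l) ≡ l
label-at true  hi    = refl
label-at true  lo    = refl
label-at true  plus  = refl
label-at true  minus = refl
label-at false hi    = refl
label-at false lo    = refl
label-at false plus  = refl
label-at false minus = refl

at-label : ∀ b c → at b (label b c) ≡ c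
at-label true  0F = refl
at-label true  1F = refl
at-label true  2F = refl
at-label true  3F = refl
at-label false 0F = refl
at-label false 1F = refl
at-label false 2F = refl
at-label false 3F = refl

turn-turn : ∀ s l → turn s (turn s l) ≡ l
turn-turn true  l     = refl
turn-turn false hi    = refl
turn-turn false lo    = refl
turn-turn false plus  = refl
turn-turn false minus = refl

turn-hi : ∀ s → turn s hi ≡ hi
turn-hi true  = refl
turn-hi false = refl

turn-lo : ∀ s → turn s lo ≡ lo
turn-lo true  = refl
turn-lo false = refl

labelled : ∀ {m} → (Fin m → Label → ℚ) → Weights m
labelled W i c = W i (label (group i) c)

-- The contribution of a level to the coordinates x + y - 1 (for b = true) and
-- x - y (for b = false)
component : ∀ {m} → (Fin m → Label → ℚ) → Bool → Fin m → ℚ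
component W b i = if does (group i ≟ᵇ b) then W i hi - W i lo else W i plus - W i minus

total : (Label → ℚ) → ℚ
total f = f hi + f lo + (f plus + f minus)

module _ {m} (W : Fin m → Label → ℚ) where

  Σ₄-labelled : ∀ i → Σ₄ (labelled W i) ≡ total (W i)
  Σ₄-labelled i with group i
  ... | true  = solve 4 (λ h l p n → l :+ (p :+ (n :+ h)) := h :+ l :+ (p :+ n)) refl (W i hi) (W i lo) (W i plus) (W i minus)
  ... | false = solve 4 (λ h l p n → n :+ (h :+ (l :+ p)) := h :+ l :+ (p :+ n)) refl (W i hi) (W i lo) (W i plus) (W i minus)

  private
    levelX : ∀ i → labelled W i 1F + labelled W i 3F ≡
      ½ * total (W i) + (½ * component W true i + ½ * component W false i)
    levelX i with group i
    ... | true  = solve 4 (λ h l p n → p :+ h := con ½ :* (h :+ l :+ (p :+ n)) :+ (con ½ :* (h :- l) :+ con ½ :* (p :- n)))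
                    refl (W i hi) (W i lo) (W i plus) (W i minus)
    ... | false = solve 4 (λ h l p n → h :+ p := con ½ :* (h :+ l :+ (p :+ n)) :+ (con ½ :* (p :- n) :+ con ½ :* (h :- l)))
                    refl (W i hi) (W i lo) (W i plus) (W i minus)

    levelY : ∀ i → labelled W i 2F + labelled W i 3F ≡
      ½ * total (W i) + (½ * component W true i + (- ½) * component W false i)
    levelY i with group i
    ... | true  = solve 4 (λ h l p n → n :+ h := con ½ :* (h :+ l :+ (p :+ n)) :+ (con ½ :* (h :- l) :+ con (- ½) :* (p :- n)))
                    refl (W i hi) (W i lo) (W i plus) (W i minus)
    ... | false = solve 4 (λ h l p n → l :+ p := con ½ :* (h :+ l :+ (p :+ n)) :+ (con ½ :* (p :- n) :+ con (- ½) :* (h :- l)))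
                    refl (W i hi) (W i lo) (W i plus) (W i minus)

    spread-sum : ∀ (f g h : Fin m → ℚ) k →
      sum (λ i → ½ * f i + (½ * g i + k * h i)) ≡ ½ * sum f + (½ * sum g + k * sum h)
    spread-sum f g h k = trans (∑-distrib-+ {m} (λ i → ½ * f i) _)
      (cong₂ _+_ (sum-*ˡ {m} ½ f) (trans (∑-distrib-+ {m} (λ i → ½ * g i) _)
        (cong₂ _+_ (sum-*ˡ {m} ½ g) (sum-*ˡ {m} k h))))

  sumX-labelled : sumX (labelled W) ≡
    ½ * sum (λ i → total (W i)) + (½ * sum (component W true) + ½ * sum (component W false))
  sumX-labelled = trans (sum-cong-≗ {m} levelX) (spread-sum _ _ _ ½)

  sumY-labelled : sumY (labelled W) ≡
    ½ * sum (λ i → total (W i)) + (½ * sum (component W true) + (- ½) * sum (component W false))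
  sumY-labelled = trans (sum-cong-≗ {m} levelY) (spread-sum _ _ _ (- ½))

module _ {m : ℕ} where
  Vanishing : Cell m → (Fin m → Label → ℚ) → Set
  Vanishing C W = ∀ i l → member (profile C i) (toℕ i) l ≡ false → W i l ≡ 0ℚ

  private
    single : ∀ {a b c d : ℚ} → a + b + (c + d) ≡ 0ℚ → b ≡ 0ℚ → c ≡ 0ℚ → d ≡ 0ℚ → a ≡ 0ℚ
    single {a} e refl refl refl = trans (solve 1 (λ a → a := a :+ con 0ℚ :+ (con 0ℚ :+ con 0ℚ)) refl a) e

    single′ : ∀ {a b c d : ℚ} → a + b + (c + d) ≡ 0ℚ → a ≡ 0ℚ → c ≡ 0ℚ → d ≡ 0ℚ → b ≡ 0ℚ
    single′ {b = b} e refl refl refl = trans (solve 1 (λ b → b := con 0ℚ :+ b :+ (con 0ℚ :+ con 0ℚ)) refl b) e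

    single″ : ∀ {a b c d : ℚ} → a + b + (c + d) ≡ 0ℚ → a ≡ 0ℚ → b ≡ 0ℚ → d ≡ 0ℚ → c ≡ 0ℚ
    single″ {c = c} e refl refl refl = trans (solve 1 (λ c → c := con 0ℚ :+ con 0ℚ :+ (c :+ con 0ℚ)) refl c) e

    ends : ∀ {x y} → x - y ≡ 0ℚ → x + y ≡ 0ℚ → x ≡ 0ℚ × y ≡ 0ℚ
    ends {x} {y} e f =
        by₂ ½ e ½ f (solve 2 (λ x y → x := con 0ℚ :+ con ½ :* (x :- y :- con 0ℚ) :+ con ½ :* (x :+ y :- con 0ℚ)) refl x y)
      , by₂ (- ½) e ½ f (solve 2 (λ x y → y := con 0ℚ :+ con (- ½) :* (x :- y :- con 0ℚ) :+ con ½ :* (x :+ y :- con 0ℚ)) refl x y)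

    ≢ℕ : ∀ {i j : Fin m} → i ≢ j → toℕ i ≢ toℕ j
    ≢ℕ i≢j e = i≢j (toℕ-injective e)

  module _ (W : Fin m → Label → ℚ) (flat : ∀ i → total (W i) ≡ 0ℚ)
           (along₀ : ∀ b → sum (component W b) ≡ 0ℚ) where

    private
      module Mid (s : Bool) (p q : Fin m) (e : group p ≡ group q) (p≤q : toℕ p ℕ.≤ toℕ q)
                 (van : Vanishing (mid s p q e p≤q) W) where
        V : Fin m → Label → ℚ
        V i l = W i (turn s l)

        V-flat : ∀ i → total (V i) ≡ 0ℚ
        V-flat i = trans (turned s) (flat i)
          where
          turned : ∀ s → total (λ l → W i (turn s l)) ≡ total (W i)
          turned true  = refl
          turned false = cong (λ z → W i hi + W i lo + z) (+-comm (W i minus) (W i plus))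

        -- Where a level has a single corner, that corner carries the level total, which is 0. Hence
        -- weight on `hi` survives only at `p` and weight on `lo` only at `q`, and the two plane
        -- components reduce to the corners named in `first` and `second`.
        record At (i : Fin m) : Set where
          field
            high  : i ≢ p → V i hi ≡ 0ℚ
            low   : i ≢ q → V i lo ≡ 0ℚ
            other : V i minus ≡ 0ℚ
            first : component W (group p) i ≡ V i hi - V i lo
            second : component W (not (group p)) i ≡ signed s (V i plus)

        hi-turn : ∀ i → V i hi ≡ W i hi
        hi-turn i = cong (W i) (turn-hi s)
        lo-turn : ∀ i → V i lo ≡ W i lo
        lo-turn i = cong (W i) (turn-lo s)

        at-own : ∀ i → (∀ l → member-own (toℕ p) (toℕ q) (toℕ i) l ≡ false → V i l ≡ 0ℚ) →
          component W (group p) i ≡ W i hi - W i lo → component W (not (group p)) i ≡ W i plus - W i minus → At i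
        at-own i van′ c₁ c₂ = record
          { high = high ; low = low ; other = van′ minus refl
          ; first = trans c₁ (cong₂ _-_ (sym (hi-turn i)) (sym (lo-turn i)))
          ; second = trans c₂ (mid-part s refl) }
          where
          mid-part : ∀ s′ → s′ ≡ s → W i plus - W i minus ≡ signed s (V i plus)
          mid-part true  refl = trans (cong (λ x → W i plus - x) (van′ minus refl)) (+-identityʳ (W i plus))
          mid-part false refl = trans (cong (λ x → x - W i minus) (van′ minus refl)) (+-identityˡ (- W i minus))
          high : i ≢ p → V i hi ≡ 0ℚ
          high i≢p with ℕₚ.<-cmp (toℕ i) (toℕ p)
          ... | tri< i<p _ _ = single (V-flat i) (van′ lo (≤ᵈ-false (ℕₚ.<-≤-trans i<p p≤q)))
                                 (van′ plus (cong (_∧ _) (≤ᵈ-false i<p))) (van′ minus refl)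
          ... | tri≈ _ i≡p _ = ⊥-elim (≢ℕ i≢p i≡p)
          ... | tri> _ _ i>p = van′ hi (≤ᵈ-false i>p)
          low : i ≢ q → V i lo ≡ 0ℚ
          low i≢q with ℕₚ.<-cmp (toℕ i) (toℕ q)
          ... | tri< i<q _ _ = van′ lo (≤ᵈ-false i<q)
          ... | tri≈ _ i≡q _ = ⊥-elim (≢ℕ i≢q i≡q)
          ... | tri> _ _ i>q = single′ (V-flat i) (van′ hi (≤ᵈ-false (ℕₚ.≤-<-trans p≤q i>q)))
                                 (van′ plus (trans (cong (_ ∧_) (≤ᵈ-false i>q)) (∧-zeroʳ _))) (van′ minus refl)

        at-oth : ∀ i → (∀ l → W i l ≡ 0ℚ) → component W (group p) i ≡ W i plus - W i minus →
          component W (not (group p)) i ≡ W i hi - W i lo → At i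
        at-oth i z c₁ c₂ = record
          { high = λ _ → z _ ; low = λ _ → z _ ; other = z _
          ; first = trans c₁ (trans (cong₂ _-_ (z plus) (z minus)) (sym (cong₂ _-_ (z (turn s hi)) (z (turn s lo)))))
          ; second = trans c₂ (trans (cong₂ _-_ (z hi) (z lo)) (sym (zero-signed s (z (turn s plus))))) }
          where
          zero-signed : ∀ s {x} → x ≡ 0ℚ → signed s x ≡ 0ℚ
          zero-signed true refl = refl
          zero-signed false refl = refl

        oth-zero : ∀ s i → (∀ l → member (oth s (toℕ p) (toℕ q)) (toℕ i) l ≡ false → W i l ≡ 0ℚ) → ∀ l → W i l ≡ 0ℚ
        oth-zero true i v hi = single (flat i) (v lo refl) (v plus refl) (v minus refl)
        oth-zero true i v lo = v lo refl
        oth-zero true i v plus = v plus refl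
        oth-zero true i v minus = v minus refl
        oth-zero false i v hi = v hi refl
        oth-zero false i v lo = single′ (flat i) (v hi refl) (v plus refl) (v minus refl)
        oth-zero false i v plus = v plus refl
        oth-zero false i v minus = v minus refl

        everywhere : ∀ i → At i
        everywhere i with group i ≟ᵇ group p | van i | at-own i | at-oth i
        ... | yes g≡ | v | own′ | _ = own′
              (λ l e → v (turn s l) (trans (cong (member-own (toℕ p) (toℕ q) (toℕ i)) (turn-turn s l)) e))
              refl (cong (λ b → if b then W i hi - W i lo else W i plus - W i minus)
                (dec-false (group i ≟ᵇ not (group p)) λ e → not-¬ (trans (sym g≡) e) ))
          where
          not-¬ : ∀ {b} → b ≢ not b
          not-¬ {true} ()
          not-¬ {false} ()
        ... | no g≢ | v | _ | oth′ = oth′ (oth-zero s i v) refl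
              (cong (λ b → if b then W i hi - W i lo else W i plus - W i minus)
                (dec-true (group i ≟ᵇ not (group p)) (¬-not g≢)))

        ΣV : Label → ℚ
        ΣV l = sum (λ i → V i l)

        ΣV-hi : ΣV hi ≡ V p hi
        ΣV-hi = sum-only p λ i i≢p → At.high (everywhere i) i≢p
        ΣV-lo : ΣV lo ≡ V q lo
        ΣV-lo = sum-only q λ i i≢q → At.low (everywhere i) i≢q

        ΣV-plus : ΣV plus ≡ 0ℚ
        ΣV-plus = unsign s (trans (sym (sum-signed s (λ i → V i plus)))
          (trans (sym (sum-cong-≗ {m} λ i → At.second (everywhere i))) (along₀ (not (group p)))))
          where
          unsign : ∀ s {x} → signed s x ≡ 0ℚ → x ≡ 0ℚ
          unsign true e = e
          unsign false {x} e = trans (solve 1 (λ x → x := :- (:- x)) refl x) (cong -_ e)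

        -- The component across makes the sum over `plus` vanish. The sum of the level totals then
        -- gives V p hi + V q lo = 0, and the component along gives V p hi - V q lo = 0.
        both : V p hi ≡ 0ℚ × V q lo ≡ 0ℚ
        both = ends
          (trans (sym (trans (sum-- {m} _ _) (cong₂ _-_ ΣV-hi ΣV-lo)))
            (trans (sym (sum-cong-≗ {m} λ i → At.first (everywhere i))) (along₀ (group p))))
          (trans (sym (cong₂ _+_ ΣV-hi ΣV-lo)) (by₂ 1ℚ totals (- 1ℚ) ΣV-plus
            (solve 3 (λ a b c → a :+ b := con 0ℚ :+ con 1ℚ :* (a :+ (b :+ c) :- con 0ℚ) :+ con (- 1ℚ) :* (c :- con 0ℚ))
              refl (ΣV hi) (ΣV lo) (ΣV plus))))
          where
          totals : ΣV hi + (ΣV lo + ΣV plus) ≡ 0ℚ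
          totals = trans (sym (trans (∑-distrib-+ {m} (λ i → V i hi) _) (cong (λ z → ΣV hi + z) (∑-distrib-+ {m} (λ i → V i lo) _))))
            (sum-zero λ i → trans (trans (solve 3 (λ a b c → a :+ (b :+ c) := a :+ b :+ (c :+ con 0ℚ)) refl (V i hi) (V i lo) (V i plus))
              (cong (λ x → V i hi + V i lo + (V i plus + x)) (sym (At.other (everywhere i))))) (V-flat i))

        V-zero : ∀ i l → V i l ≡ 0ℚ
        V-zero i hi with i ≟ p
        ... | yes refl = proj₁ both
        ... | no i≢p = At.high (everywhere i) i≢p
        V-zero i lo with i ≟ q
        ... | yes refl = proj₂ both
        ... | no i≢q = At.low (everywhere i) i≢q
        V-zero i plus = single″ (V-flat i) (V-zero i hi) (V-zero i lo) (V-zero i minus)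
        V-zero i minus = At.other (everywhere i)

        zero-everywhere : ∀ i l → W i l ≡ 0ℚ
        zero-everywhere i l = trans (cong (W i) (sym (turn-turn s l))) (V-zero i (turn s l))

      module Central (p q : Fin m) (gp : group p ≡ true) (gq : group q ≡ false)
                     (van : Vanishing (central p q gp gq) W) where
        sides : ∀ i → W i plus ≡ 0ℚ × W i minus ≡ 0ℚ
        sides i with group i | van i
        ... | true  | v = v plus refl , v minus refl
        ... | false | v = v plus refl , v minus refl

        thr : Bool → Fin m
        thr true  = p
        thr false = q

        away : ∀ {i t r} → (∀ l → member (cen (toℕ t) r) (toℕ i) l ≡ false → W i l ≡ 0ℚ) → i ≢ t →
          W i hi ≡ 0ℚ × W i lo ≡ 0ℚ
        away {i} {t} v i≢t with ℕₚ.<-cmp (toℕ i) (toℕ t)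
        ... | tri< i<t _ _ = single (flat i) (v lo (≤ᵈ-false i<t)) (v plus refl) (v minus refl) , v lo (≤ᵈ-false i<t)
        ... | tri≈ _ i≡t _ = ⊥-elim (≢ℕ i≢t i≡t)
        ... | tri> _ _ i>t = v hi (≤ᵈ-false i>t) , single′ (flat i) (v hi (≤ᵈ-false i>t)) (v plus refl) (v minus refl)

        off : ∀ i → i ≢ thr (group i) → W i hi ≡ 0ℚ × W i lo ≡ 0ℚ
        off i i≢t with group i | van i
        ... | true  | v = away {i} v i≢t
        ... | false | v = away {i} v i≢t

        group-thr : ∀ b → group (thr b) ≡ b
        group-thr true  = gp
        group-thr false = gq

        component-off : ∀ b i → i ≢ thr b → component W b i ≡ 0ℚ
        component-off b i i≢t with group i ≟ᵇ b | off i
        ... | yes refl | o = let (h , l) = o i≢t in trans (cong₂ _-_ h l) refl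
        ... | no _     | _ = trans (cong₂ _-_ (proj₁ (sides i)) (proj₂ (sides i))) refl

        component-at : ∀ b → W (thr b) hi - W (thr b) lo ≡ 0ℚ
        component-at b = trans (sym (cong (λ d → if d then W (thr b) hi - W (thr b) lo else W (thr b) plus - W (thr b) minus)
            (dec-true (group (thr b) ≟ᵇ b) (group-thr b))))
          (trans (sym (sum-only (thr b) (component-off b))) (along₀ b))

        -- At the threshold level of the group the component of `b` is the difference of the two
        -- ends and the level total is their sum; both are 0.
        at-thr : ∀ b → W (thr b) hi ≡ 0ℚ × W (thr b) lo ≡ 0ℚ
        at-thr b = ends (component-at b) (trans (solve 2 (λ h l → h :+ l := h :+ l :+ (con 0ℚ :+ con 0ℚ)) refl (W (thr b) hi) (W (thr b) lo))
          (trans (cong (λ x → W (thr b) hi + W (thr b) lo + x) (sym (cong₂ _+_ (proj₁ (sides (thr b))) (proj₂ (sides (thr b))))))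
            (flat (thr b))))

        main : ∀ i → W i hi ≡ 0ℚ × W i lo ≡ 0ℚ
        main i with i ≟ thr (group i)
        ... | yes e = subst (λ i → W i hi ≡ 0ℚ × W i lo ≡ 0ℚ) (sym e) (at-thr (group i))
        ... | no ne = off i ne

        zero-everywhere : ∀ i l → W i l ≡ 0ℚ
        zero-everywhere i hi    = proj₁ (main i)
        zero-everywhere i lo    = proj₂ (main i)
        zero-everywhere i plus  = proj₁ (sides i)
        zero-everywhere i minus = proj₂ (sides i)

    vanishing⇒zero : ∀ C → Vanishing C W → ∀ i l → W i l ≡ 0ℚ
    vanishing⇒zero (mid s p q e p≤q) van = Mid.zero-everywhere s p q e p≤q van
    vanishing⇒zero (central p q gp gq) van = Central.zero-everywhere p q gp gq van

  cell-independent : ∀ (C : Cell m) → Independent {m} ⟦ C ⟧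
  cell-independent C w supp hx hy hl i c = trans (sym (relabel i c))
    (vanishing⇒zero W flat along C
      (λ i l e → supp i (at (group i) l) λ c∈ → true≢false (trans (sym (∈⟦⟧⁻¹ C c∈))
        (trans (cong (member (profile C i) (toℕ i)) (label-at (group i) l)) e)))
      i (label (group i) c))
    where
    W : Fin m → Label → ℚ
    W i l = w i (at (group i) l)
    relabel : ∀ i c → labelled W i c ≡ w i c
    relabel i c = cong (w i) (at-label (group i) c)
    flat : ∀ i → total (W i) ≡ 0ℚ
    flat i = trans (sym (Σ₄-labelled W i)) (trans (Σ₄-cong (relabel i)) (hl i))
    Σflat : sum (λ i → total (W i)) ≡ 0ℚ
    Σflat = sum-zero flat
    X₀ : sumX (labelled W) ≡ 0ℚ
    X₀ = trans (sum-cong-≗ {m} λ i → cong₂ _+_ (relabel i 1F) (relabel i 3F)) hx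
    Y₀ : sumY (labelled W) ≡ 0ℚ
    Y₀ = trans (sum-cong-≗ {m} λ i → cong₂ _+_ (relabel i 2F) (relabel i 3F)) hy
    X₁ = trans (sym (sumX-labelled W)) X₀
    Y₁ = trans (sym (sumY-labelled W)) Y₀
    along : ∀ b → sum (component W b) ≡ 0ℚ
    along true = by₃ 1ℚ X₁ 1ℚ Y₁ (- 1ℚ) Σflat (solve 3 (λ t a b → a := con 0ℚ
      :+ con 1ℚ :* (con ½ :* t :+ (con ½ :* a :+ con ½ :* b) :- con 0ℚ)
      :+ con 1ℚ :* (con ½ :* t :+ (con ½ :* a :+ con (- ½) :* b) :- con 0ℚ)
      :+ con (- 1ℚ) :* (t :- con 0ℚ)) refl (sum (λ i → total (W i))) (sum (component W true)) (sum (component W false)))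
    along false = by₂ 1ℚ X₁ (- 1ℚ) Y₁ (solve 3 (λ t a b → b := con 0ℚ
      :+ con 1ℚ :* (con ½ :* t :+ (con ½ :* a :+ con ½ :* b) :- con 0ℚ)
      :+ con (- 1ℚ) :* (con ½ :* t :+ (con ½ :* a :+ con (- ½) :* b) :- con 0ℚ))
      refl (sum (λ i → total (W i))) (sum (component W true)) (sum (component W false)))

-- Dimension and type of the cells

𝟙 : Bool → ℕ
𝟙 true  = 1
𝟙 false = 0

labels : (Label → Bool) → ℕ
labels f = 𝟙 (f hi) ℕ.+ 𝟙 (f lo) ℕ.+ (𝟙 (f plus) ℕ.+ 𝟙 (f minus))

private
  ∣∷∣ : ∀ {n} a (s : Subset n) → ∣ a ∷ s ∣ ≡ 𝟙 a ℕ.+ ∣ s ∣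
  ∣∷∣ true  s = refl
  ∣∷∣ false s = refl

  ∣four∣ : ∀ a b c d → ∣ a ∷ b ∷ c ∷ d ∷ [] ∣ ≡ 𝟙 a ℕ.+ (𝟙 b ℕ.+ (𝟙 c ℕ.+ (𝟙 d ℕ.+ 0)))
  ∣four∣ a b c d rewrite ∣∷∣ a (b ∷ c ∷ d ∷ []) | ∣∷∣ b (c ∷ d ∷ []) | ∣∷∣ c (d ∷ []) | ∣∷∣ d [] = refl

card-labels : ∀ b (f : Label → Bool) → ∣ Vec.tabulate (λ c → f (label b c)) ∣ ≡ labels f
card-labels true f = trans (∣four∣ (f lo) (f plus) (f minus) (f hi)) (solveℕ 4
  (λ h l p n → l ⊕ (p ⊕ (n ⊕ (h ⊕ # 0))) :=ℕ h ⊕ l ⊕ (p ⊕ n)) refl (𝟙 (f hi)) (𝟙 (f lo)) (𝟙 (f plus)) (𝟙 (f minus)))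
card-labels false f = trans (∣four∣ (f minus) (f hi) (f lo) (f plus)) (solveℕ 4
  (λ h l p n → n ⊕ (h ⊕ (l ⊕ (p ⊕ # 0))) :=ℕ h ⊕ l ⊕ (p ⊕ n)) refl (𝟙 (f hi)) (𝟙 (f lo)) (𝟙 (f plus)) (𝟙 (f minus)))

δ : ℕ → ℕ → ℕ
δ i t = 𝟙 (does (i ℕₚ.≟ t))

labels-cen : ∀ t r i → labels (member (cen t r) i) ≡ 1 ℕ.+ δ i t
labels-cen t r i with ℕₚ.<-cmp i t
... | tri< i<t i≢t _ rewrite ≤ᵈ-true (ℕₚ.<⇒≤ i<t) | ≤ᵈ-false i<t | dec-false (i ℕₚ.≟ t) i≢t = refl
... | tri≈ _ refl _ rewrite ≤ᵈ-true (ℕₚ.≤-refl {i}) | dec-true (i ℕₚ.≟ i) refl = refl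
... | tri> _ i≢t i>t rewrite ≤ᵈ-true (ℕₚ.<⇒≤ i>t) | ≤ᵈ-false i>t | dec-false (i ℕₚ.≟ t) i≢t = refl

labels-own : ∀ s p q i → p ℕ.≤ q → labels (member (own s p q) i) ≡ 1 ℕ.+ (δ i p ℕ.+ δ i q)
labels-own s p q i p≤q = trans (untwist s) main
  where
  untwist : ∀ s → labels (λ l → member-own p q i (turn s l)) ≡ labels (member-own p q i)
  untwist true  = refl
  untwist false = cong (𝟙 (i ≤ᵈ p) ℕ.+ 𝟙 (q ≤ᵈ i) ℕ.+_) (ℕₚ.+-comm 0 _)
  main : labels (member-own p q i) ≡ 1 ℕ.+ (δ i p ℕ.+ δ i q)
  main with ℕₚ.<-cmp i p | ℕₚ.<-cmp i q
  ... | tri< i<p i≢p _ | tri< i<q i≢q _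
      rewrite ≤ᵈ-true (ℕₚ.<⇒≤ i<p) | ≤ᵈ-false i<p | ≤ᵈ-false i<q
            | dec-false (i ℕₚ.≟ p) i≢p | dec-false (i ℕₚ.≟ q) i≢q = refl
  ... | tri< i<p _ _ | tri≈ _ refl _ = ⊥-elim (ℕₚ.<⇒≱ i<p p≤q)
  ... | tri< i<p _ _ | tri> _ _ q<i = ⊥-elim (ℕₚ.<⇒≱ (ℕₚ.<-trans q<i i<p) p≤q)
  ... | tri≈ _ refl _ | tri< i<q i≢q _
      rewrite ≤ᵈ-true (ℕₚ.≤-refl {i}) | ≤ᵈ-false i<q | ≤ᵈ-true (ℕₚ.<⇒≤ i<q)
            | dec-true (i ℕₚ.≟ i) refl | dec-false (i ℕₚ.≟ q) i≢q = refl
  ... | tri≈ _ refl _ | tri≈ _ refl _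
      rewrite ≤ᵈ-true (ℕₚ.≤-refl {i}) | dec-true (i ℕₚ.≟ i) refl = refl
  ... | tri≈ _ refl _ | tri> _ _ q<i = ⊥-elim (ℕₚ.<⇒≱ q<i p≤q)
  ... | tri> _ i≢p p<i | tri< i<q i≢q _
      rewrite ≤ᵈ-false p<i | ≤ᵈ-false i<q | ≤ᵈ-true (ℕₚ.<⇒≤ p<i) | ≤ᵈ-true (ℕₚ.<⇒≤ i<q)
            | dec-false (i ℕₚ.≟ p) i≢p | dec-false (i ℕₚ.≟ q) i≢q = refl
  ... | tri> _ i≢p p<i | tri≈ _ refl _
      rewrite ≤ᵈ-false p<i | ≤ᵈ-true (ℕₚ.<⇒≤ p<i) | ≤ᵈ-true (ℕₚ.≤-refl {i})
            | dec-false (i ℕₚ.≟ p) i≢p | dec-true (i ℕₚ.≟ i) refl = refl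
  ... | tri> _ i≢p p<i | tri> _ i≢q q<i
      rewrite ≤ᵈ-false p<i | ≤ᵈ-true (ℕₚ.<⇒≤ p<i) | ≤ᵈ-true (ℕₚ.<⇒≤ q<i) | ≤ᵈ-false q<i
            | dec-false (i ℕₚ.≟ p) i≢p | dec-false (i ℕₚ.≟ q) i≢q = refl

first second : ∀ {m} → Cell m → Fin m
first (central p _ _ _) = p
first (mid _ p _ _ _)   = p
second (central _ q _ _) = q
second (mid _ _ q _ _)   = q

module _ {m : ℕ} where
  card-level : ∀ (C : Cell m) i → ∣ level m ⟦ C ⟧ i ∣ ≡
               1 ℕ.+ (δ (toℕ i) (toℕ (first C)) ℕ.+ δ (toℕ i) (toℕ (second C)))
  card-level C i = trans (cong ∣_∣ (level-⟦⟧ C i))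
    (trans (card-labels (group i) (member (profile C i) (toℕ i))) (go C i))
    where
    apart : ∀ {i j : Fin m} → group i ≢ group j → δ (toℕ i) (toℕ j) ≡ 0
    apart {i} {j} g≢ = cong 𝟙 (dec-false (toℕ i ℕₚ.≟ toℕ j) λ e → g≢ (cong group (toℕ-injective e)))
    go : ∀ C i → labels (member (profile C i) (toℕ i)) ≡
                 1 ℕ.+ (δ (toℕ i) (toℕ (first C)) ℕ.+ δ (toℕ i) (toℕ (second C)))
    go (central p q gp gq) i with group i in gi
    ... | true  = trans (labels-cen (toℕ p) (toℕ q) (toℕ i)) (cong suc (sym (trans
                    (cong (δ (toℕ i) (toℕ p) ℕ.+_) (apart {i} {q} λ e → true≢false (trans (sym gi) (trans e gq)))) (ℕₚ.+-identityʳ _))))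
    ... | false = trans (labels-cen (toℕ q) (toℕ p) (toℕ i)) (cong suc (sym
                    (cong (ℕ._+ δ (toℕ i) (toℕ q)) (apart {i} {p} λ e → true≢false (trans (sym gp) (trans (sym e) gi))))))
    go (mid s p q e p≤q) i with group i ≟ᵇ group p
    ... | yes _ = labels-own s (toℕ p) (toℕ q) (toℕ i) p≤q
    ... | no g≢ = trans (single s) (cong suc (sym (cong₂ ℕ._+_ (apart {i} {p} g≢) (apart {i} {q} λ e′ → g≢ (trans e′ (sym e))))))
      where
      single : ∀ s → labels (member (oth s (toℕ p) (toℕ q)) (toℕ i)) ≡ 1
      single true = refl
      single false = refl

card-++ : ∀ {k n} (s : Subset k) (t : Subset n) → ∣ s Vec.++ t ∣ ≡ ∣ s ∣ ℕ.+ ∣ t ∣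
card-++ []      t = refl
card-++ (a ∷ s) t = trans (∣∷∣ a (s Vec.++ t)) (trans (cong (𝟙 a ℕ.+_) (card-++ s t))
  (trans (sym (ℕₚ.+-assoc (𝟙 a) _ _)) (cong (ℕ._+ ∣ t ∣) (sym (∣∷∣ a s)))))

card-blocks : ∀ m (τ : VertexSet m) → ∣ τ ∣ ≡ sumℕ (λ i → ∣ level m τ i ∣)
card-blocks zero    [] = refl
card-blocks (suc m) (a ∷ b ∷ c ∷ d ∷ τ) = trans (card-++ (a ∷ b ∷ c ∷ d ∷ []) τ)
  (cong (∣ a ∷ b ∷ c ∷ d ∷ [] ∣ ℕ.+_) (card-blocks m τ))

Σδ : ∀ {m} (p : Fin m) → sumℕ {m} (λ i → δ (toℕ i) (toℕ p)) ≡ 1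
Σδ {suc m} zero = cong suc (trans (sumℕ-const m 0) (ℕₚ.*-zeroʳ m))
Σδ {suc m} (suc p) = Σδ p

cell-simplex : ∀ {m} (C : Cell m) → IsSimplex (vertex m) (suc m) ⟦ C ⟧
cell-simplex {m} C = (begin
    ∣ ⟦ C ⟧ ∣                                     ≡⟨ card-blocks m ⟦ C ⟧ ⟩
    sumℕ {m} (λ i → ∣ level m ⟦ C ⟧ i ∣)              ≡⟨ sumℕ-cong {m} (card-level C) ⟩
    sumℕ {m} (λ i → 1 ℕ.+ (δ (toℕ i) p ℕ.+ δ (toℕ i) q)) ≡⟨ ℕ∑-distrib-+ {m} (λ _ → 1) _ ⟩
    sumℕ {m} (λ _ → 1) ℕ.+ sumℕ {m} (λ i → δ (toℕ i) p ℕ.+ δ (toℕ i) q)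
      ≡⟨ cong₂ ℕ._+_ (trans (sumℕ-const m 1) (ℕₚ.*-identityʳ m))
           (trans (ℕ∑-distrib-+ {m} (λ i → δ (toℕ i) p) _) (cong₂ ℕ._+_ {sumℕ {m} (λ i → δ (toℕ i) p)} {1} {sumℕ {m} (λ i → δ (toℕ i) q)} {1} (Σδ (first C)) (Σδ (second C)))) ⟩
    m ℕ.+ 2                                       ≡⟨ ℕₚ.+-comm m 2 ⟩
    suc (suc m)                                   ∎)
  , Independent⇒affine {m} (cell-independent C)
  where
  open ≡-Reasoning
  p = toℕ (first C)
  q = toℕ (second C)

type-twice : ∀ {m} (C : Cell m) → first C ≡ second C → simplexType m ⟦ C ⟧ (first C) ≡ 2
type-twice C e = cong (_∸ 1) (trans (card-level C (first C)) (cong suc (cong₂ ℕ._+_ (self (first C))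
  (trans (cong (λ q → δ (toℕ (first C)) (toℕ q)) (sym e)) (self (first C))))))
  where
  self : ∀ {m} (i : Fin m) → δ (toℕ i) (toℕ i) ≡ 1
  self i = cong 𝟙 (dec-true (toℕ i ℕₚ.≟ toℕ i) refl)

-- The cells cover the polytope

true-or-false : ∀ b → b ≡ true ⊎ b ≡ false
true-or-false true  = inj₁ refl
true-or-false false = inj₂ refl

-- A mass f is distributed to the levels of a class in their order, each level i
-- receiving at most y i; only the level p receives a proper part.
record Threshold {m} (g : Fin m → Bool) (y : Fin m → ℚ) (f : ℚ) : Set where
  field
    p       : Fin m
    p∈      : g p ≡ true
    w       : Fin m → ℚ
    nonneg  : ∀ i → 0ℚ ≤ w i
    bounded : ∀ i → w i ≤ y i
    mass    : sum w ≡ f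
    above   : ∀ i → toℕ p ℕ.< toℕ i → w i ≡ 0ℚ
    below   : ∀ i → toℕ i ℕ.< toℕ p → w i ≡ y i

rest-≤ : ∀ {f a s} → f ≤ a + s → f - a ≤ s
rest-≤ {f} {a} {s} h = ≤-by (a + s - f) (0≤- h) (solve 3 (λ f a s → s := f :- a :+ (a :+ s :- f)) refl f a s)

-- Greedy filling: levels of the class are filled up until the mass is exhausted. Even the mass 0
-- needs a level of the class to serve as `p`, hence the second alternative.
threshold : ∀ {m} (g : Fin m → Bool) (y : Fin m → ℚ) {f} → (∀ i → 0ℚ ≤ y i) →
  (∀ i → g i ≡ false → y i ≡ 0ℚ) → 0ℚ ≤ f → f ≤ sum y → Threshold g y f ⊎ (∀ i → g i ≡ false)
threshold {zero} g y _ _ _ _ = inj₂ λ ()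
threshold {suc m} g y {f} y≥0 y∉ 0≤f f≤ = choose (true-or-false (g zero)) (f ℚₚ.≤? y zero)
  where
  Tail : ℚ → Set
  Tail f = Threshold (g ∘ suc) (y ∘ suc) f ⊎ (∀ i → g (suc i) ≡ false)

  tail : ∀ {f} → 0ℚ ≤ f → f ≤ sum (y ∘ suc) → Tail f
  tail = threshold (g ∘ suc) (y ∘ suc) (y≥0 ∘ suc) (λ i → y∉ (suc i))

  skip : g zero ≡ false → Tail f → Threshold g y f ⊎ (∀ i → g i ≡ false)
  skip g₀ (inj₂ none) = inj₂ λ { zero → g₀ ; (suc i) → none i }
  skip g₀ (inj₁ t) = inj₁ (record
    { p = suc p ; p∈ = p∈ ; w = 0ℚ ∷ᵛ w
    ; nonneg = λ { zero → ≤-refl ; (suc i) → nonneg i }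
    ; bounded = λ { zero → y≥0 zero ; (suc i) → bounded i }
    ; mass = trans (+-identityˡ (sum w)) mass
    ; above = λ { (suc i) (s≤s p<i) → above i p<i }
    ; below = λ { zero _ → sym (y∉ zero g₀) ; (suc i) (s≤s i<p) → below i i<p } })
    where open Threshold t

  fill : ¬ f ≤ y zero → Tail (f - y zero) → Threshold g y f
  fill f≰y₀ (inj₂ none) = ⊥-elim (f≰y₀ (subst (f ≤_)
    (trans (cong (λ z → y zero + z) (sum-zero λ i → y∉ (suc i) (none i))) (+-identityʳ (y zero))) f≤))
  fill f≰y₀ (inj₁ t) = record
    { p = suc p ; p∈ = p∈ ; w = y zero ∷ᵛ w
    ; nonneg = λ { zero → y≥0 zero ; (suc i) → nonneg i }
    ; bounded = λ { zero → ≤-refl ; (suc i) → bounded i }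
    ; mass = trans (cong (λ z → y zero + z) mass) (solve 2 (λ a f → a :+ (f :- a) := f) refl (y zero) f)
    ; above = λ { (suc i) (s≤s p<i) → above i p<i }
    ; below = λ { zero _ → refl ; (suc i) (s≤s i<p) → below i i<p } }
    where
    open Threshold t

  choose : g zero ≡ true ⊎ g zero ≡ false → Dec (f ≤ y zero) → Threshold g y f ⊎ (∀ i → g i ≡ false)
  choose (inj₂ g₀) _ = skip g₀ (tail 0≤f
    (subst (f ≤_) (trans (cong (_+ sum (y ∘ suc)) (y∉ zero g₀)) (+-identityˡ _)) f≤))
  choose (inj₁ g₀) (yes f≤y₀) = inj₁ (record
    { p = zero ; p∈ = g₀ ; w = f ∷ᵛ λ _ → 0ℚ
    ; nonneg = λ { zero → 0≤f ; (suc i) → ≤-refl }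
    ; bounded = λ { zero → f≤y₀ ; (suc i) → y≥0 (suc i) }
    ; mass = trans (cong (λ z → f + z) (sum-zero {m} λ _ → refl)) (+-identityʳ f)
    ; above = λ { (suc i) _ → refl }
    ; below = λ _ () })
  choose (inj₁ g₀) (no f≰y₀) = inj₁ (fill f≰y₀ (tail (0≤- (<⇒≤ (≰⇒> f≰y₀))) (rest-≤ {f} {y zero} f≤)))

-- The masses f and e are distributed consecutively.
record TwoThresholds {m} (g : Fin m → Bool) (y : Fin m → ℚ) (f e : ℚ) : Set where
  field
    p q     : Fin m
    p∈      : g p ≡ true
    q∈      : g q ≡ true
    p≤q     : toℕ p ℕ.≤ toℕ q
    v w     : Fin m → ℚ
    0≤v     : ∀ i → 0ℚ ≤ v i
    v≤w     : ∀ i → v i ≤ w i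
    w≤y     : ∀ i → w i ≤ y i
    mass-v  : sum v ≡ f
    mass-w  : sum w ≡ f + e
    above-p : ∀ i → toℕ p ℕ.< toℕ i → v i ≡ 0ℚ
    below-p : ∀ i → toℕ i ℕ.< toℕ p → v i ≡ w i
    above-q : ∀ i → toℕ q ℕ.< toℕ i → w i ≡ 0ℚ
    below-q : ∀ i → toℕ i ℕ.< toℕ q → w i ≡ y i

-- The mass f + e is filled in first and f then into the result `w`, which makes v ≤ w automatic and
-- leaves e as the mass of w - v.
two-thresholds : ∀ {m} (g : Fin m → Bool) (y : Fin m → ℚ) {f e} → (∀ i → 0ℚ ≤ y i) →
  (∀ i → g i ≡ false → y i ≡ 0ℚ) → 0ℚ ≤ f → 0ℚ ≤ e → f + e ≤ sum y →
  TwoThresholds g y f e ⊎ (∀ i → g i ≡ false)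
two-thresholds {m} g y {f} {e} y≥0 y∉ 0≤f 0≤e f+e≤ = first-step (threshold g y y≥0 y∉ (0≤+ 0≤f 0≤e) f+e≤)
  where
  module _ (t : Threshold g y (f + e)) where
    private module T = Threshold t

    second-step : Threshold g T.w f ⊎ (∀ i → g i ≡ false) → TwoThresholds g y f e ⊎ (∀ i → g i ≡ false)
    second-step (inj₂ none) = inj₂ none
    second-step (inj₁ s) = inj₁ (order (toℕ S.p ℕₚ.≤? toℕ T.p))
      where
      module S = Threshold s
      order : Dec (toℕ S.p ℕ.≤ toℕ T.p) → TwoThresholds g y f e
      order (yes p≤q) = record
        { p = S.p ; q = T.p ; p∈ = S.p∈ ; q∈ = T.p∈ ; p≤q = p≤q ; v = S.w ; w = T.w
        ; 0≤v = S.nonneg ; v≤w = S.bounded ; w≤y = T.bounded ; mass-v = S.mass ; mass-w = T.mass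
        ; above-p = S.above ; below-p = S.below ; above-q = T.above ; below-q = T.below }
      -- The outer threshold can then replace the inner one: beyond it w, and hence v, is 0, and
      -- before it v still equals w.
      order (no p≰q) = record
        { p = T.p ; q = T.p ; p∈ = T.p∈ ; q∈ = T.p∈ ; p≤q = ℕₚ.≤-refl ; v = S.w ; w = T.w
        ; 0≤v = S.nonneg ; v≤w = S.bounded ; w≤y = T.bounded ; mass-v = S.mass ; mass-w = T.mass
        ; above-p = λ i q<i → 0≤-antisym (S.nonneg i) (≤-trans (S.bounded i) (≤-reflexive (T.above i q<i)))
        ; below-p = λ i i<q → S.below i (ℕₚ.<-trans i<q (ℕₚ.≰⇒> p≰q))
        ; above-q = T.above ; below-q = T.below }

  first-step : Threshold g y (f + e) ⊎ (∀ i → g i ≡ false) → TwoThresholds g y f e ⊎ (∀ i → g i ≡ false)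
  first-step (inj₂ none) = inj₂ none
  first-step (inj₁ t) = second-step t (threshold g T.w {f} T.nonneg
      (λ i gi → 0≤-antisym (T.nonneg i) (≤-trans (T.bounded i) (≤-reflexive (y∉ i gi))))
      0≤f (subst (f ≤_) (sym T.mass) (≤-by e 0≤e refl)))
    where module T = Threshold t

module Cover {m} (y : Fin m → ℚ) (y≥0 : ∀ i → 0ℚ ≤ y i) (Σy : sum y ≡ 1ℚ) (X Y : ℚ)
             (0≤X : 0ℚ ≤ X) (X≤1 : X ≤ 1ℚ) (0≤Y : 0ℚ ≤ Y) (Y≤1 : Y ≤ 1ℚ) where

  coordinate : Bool → ℚ
  coordinate true  = X + Y - 1ℚ
  coordinate false = X - Y

  part : Bool → Fin m → ℚ
  part b i = if does (group i ≟ᵇ b) then y i else 0ℚ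

  -- The rectangle spanned by the two families of diagonals is given by |coordinate b| ≤ share b for
  -- both values of b.
  share : Bool → ℚ
  share b = sum (part b)

  private
    part≥0 : ∀ b i → 0ℚ ≤ part b i
    part≥0 b i with does (group i ≟ᵇ b)
    ... | true  = y≥0 i
    ... | false = ≤-refl

    part∉ : ∀ b (i : Fin m) → does (group i ≟ᵇ b) ≡ false → part b i ≡ 0ℚ
    part∉ b i e = cong (λ d → if d then y i else 0ℚ) e

    part-split : ∀ b i → part (not b) i + part b i ≡ y i
    part-split b i with group i
    part-split true  i | true  = +-identityˡ (y i)
    part-split true  i | false = +-identityʳ (y i)
    part-split false i | true  = +-identityʳ (y i)
    part-split false i | false = +-identityˡ (y i)

    share-split : ∀ b → share (not b) + share b ≡ 1ℚ
    share-split b = trans (sym (∑-distrib-+ {m} (part (not b)) (part b)))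
      (trans (sum-cong-≗ {m} (part-split b)) Σy)

  Covered : Set
  Covered = ∃ λ (C : Cell m) → ∃ λ (w : Weights m) → Rep {m} ⟦ C ⟧ X Y y w

  -- Returning from the coordinates x + y - 1 and x - y to X and Y uses that all weights sum to 1,
  -- which the level totals provide.
  cover : ∀ (C : Cell m) (W : Fin m → Label → ℚ) → (∀ i l → 0ℚ ≤ W i l) → Vanishing C W →
    (∀ i → total (W i) ≡ y i) → (∀ b → sum (component W b) ≡ coordinate b) → Covered
  cover C W W≥0 van lev comp = C , labelled W , record
    { nonneg = λ i c → W≥0 i (label (group i) c)
    ; supp   = λ i c c∉ → van i (label (group i) c) (¬-not λ e → c∉ (∈⟦⟧ C e))
    ; horiz  = trans (sumX-labelled W) (by₃ ½ Σtotal ½ (comp true) ½ (comp false)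
        (solve 5 (λ t a b X Y → con ½ :* t :+ (con ½ :* a :+ con ½ :* b) := X :+ con ½ :* (t :- con 1ℚ)
          :+ con ½ :* (a :- (X :+ Y :- con 1ℚ)) :+ con ½ :* (b :- (X :- Y))) refl
          (sum (λ i → total (W i))) (sum (component W true)) (sum (component W false)) X Y))
    ; vert   = trans (sumY-labelled W) (by₃ ½ Σtotal ½ (comp true) (- ½) (comp false)
        (solve 5 (λ t a b X Y → con ½ :* t :+ (con ½ :* a :+ con (- ½) :* b) := Y :+ con ½ :* (t :- con 1ℚ)
          :+ con ½ :* (a :- (X :+ Y :- con 1ℚ)) :+ con (- ½) :* (b :- (X :- Y))) refl
          (sum (λ i → total (W i))) (sum (component W true)) (sum (component W false)) X Y))
    ; levels = λ i → trans (Σ₄-labelled W i) (lev i) }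
    where
    Σtotal : sum (λ i → total (W i)) ≡ 1ℚ
    Σtotal = trans (sum-cong-≗ {m} lev) Σy

  -- The point lies outside the rectangle or on its boundary, on side `s`. The other group sits at
  -- its end and contributes `share (not b)` across; the group `b` adds e by its side corners, has
  -- mass f on `hi` and the remaining share b - f - e on `lo`.
  module Middle (b s : Bool) {f e} (t : TwoThresholds (λ i → does (group i ≟ᵇ b)) (part b) f e)
    (along : f + (f + e) - share b ≡ coordinate b)
    (across : signed s (e + share (not b)) ≡ coordinate (not b)) where
    open TwoThresholds t

    does-group : ∀ {i : Fin m} → does (group i ≟ᵇ b) ≡ true → group i ≡ b
    does-group {i} e with group i ≟ᵇ b
    ... | yes g≡ = g≡
    does-group {i} () | no _

    gp : group p ≡ b
    gp = does-group {p} p∈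

    C : Cell m
    C = mid s p q (trans gp (sym (does-group {q} q∈))) p≤q

    W-own : Fin m → Label → ℚ
    W-own i hi    = v i
    W-own i plus  = w i - v i
    W-own i lo    = part b i - w i
    W-own i minus = 0ℚ

    W-oth : Bool → Fin m → Label → ℚ
    W-oth true  i hi = y i
    W-oth false i lo = y i
    W-oth _     i _  = 0ℚ

    W : Fin m → Label → ℚ
    W i l = if does (group i ≟ᵇ b) then W-own i (turn s l) else W-oth s i l

    W-own≥0 : ∀ i l → 0ℚ ≤ W-own i l
    W-own≥0 i hi    = 0≤v i
    W-own≥0 i plus  = 0≤- (v≤w i)
    W-own≥0 i lo    = 0≤- (w≤y i)
    W-own≥0 i minus = ≤-refl

    W-oth≥0 : ∀ s i l → 0ℚ ≤ W-oth s i l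
    W-oth≥0 true  i hi    = y≥0 i
    W-oth≥0 true  i lo    = ≤-refl
    W-oth≥0 true  i plus  = ≤-refl
    W-oth≥0 true  i minus = ≤-refl
    W-oth≥0 false i hi    = ≤-refl
    W-oth≥0 false i lo    = y≥0 i
    W-oth≥0 false i plus  = ≤-refl
    W-oth≥0 false i minus = ≤-refl

    W≥0 : ∀ i l → 0ℚ ≤ W i l
    W≥0 i l with does (group i ≟ᵇ b)
    ... | true  = W-own≥0 i (turn s l)
    ... | false = W-oth≥0 s i l

    own-vanishing : ∀ i l → member-own (toℕ p) (toℕ q) (toℕ i) l ≡ false → W-own i l ≡ 0ℚ
    own-vanishing i hi e = above-p i (ℕₚ.≰⇒> λ i≤p → true≢false (trans (sym (≤ᵈ-true i≤p)) e))
    own-vanishing i lo e = p-q≡0 (sym (below-q i (ℕₚ.≰⇒> λ q≤i → true≢false (trans (sym (≤ᵈ-true q≤i)) e))))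
    own-vanishing i minus e = refl
    own-vanishing i plus e with toℕ p ℕₚ.≤? toℕ i | toℕ i ℕₚ.≤? toℕ q
    ... | no p≰i | _ = p-q≡0 (sym (below-p i (ℕₚ.≰⇒> p≰i)))
    ... | yes p≤i | no i≰q = p-q≡0 (trans w≡0 (sym (0≤-antisym (0≤v i) (subst (v i ≤_) w≡0 (v≤w i)))))
      where
      w≡0 : w i ≡ 0ℚ
      w≡0 = above-q i (ℕₚ.≰⇒> i≰q)
    ... | yes p≤i | yes i≤q = ⊥-elim (true≢false (trans (sym (cong₂ _∧_ (≤ᵈ-true p≤i) (≤ᵈ-true i≤q))) e))

    oth-vanishing : ∀ s i l → member (oth s (toℕ p) (toℕ q)) (toℕ i) l ≡ false → W-oth s i l ≡ 0ℚ
    oth-vanishing true  i lo    e = refl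
    oth-vanishing true  i plus  e = refl
    oth-vanishing true  i minus e = refl
    oth-vanishing false i hi    e = refl
    oth-vanishing false i plus  e = refl
    oth-vanishing false i minus e = refl

    vanishing : Vanishing C W
    vanishing i l e = go (group i ≟ᵇ group p) (group i ≟ᵇ b) refl refl
      where
      go : ∀ (d : Dec (group i ≡ group p)) (d′ : Dec (group i ≡ b)) →
        (group i ≟ᵇ group p) ≡ d → (group i ≟ᵇ b) ≡ d′ → W i l ≡ 0ℚ
      go (yes g≡) (yes g≡b) eq eq′ = trans
        (cong (λ d → if d then W-own i (turn s l) else W-oth s i l) (cong does eq′))
        (own-vanishing i (turn s l) (trans (cong (λ d → member (if d then own s (toℕ p) (toℕ q) else oth s (toℕ p) (toℕ q)) (toℕ i) l)
          (sym (cong does eq))) e))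
      go (no g≢) (no g≢b) eq eq′ = trans
        (cong (λ d → if d then W-own i (turn s l) else W-oth s i l) (cong does eq′))
        (oth-vanishing s i l (trans (cong (λ d → member (if d then own s (toℕ p) (toℕ q) else oth s (toℕ p) (toℕ q)) (toℕ i) l)
          (sym (cong does eq))) e))
      go (yes g≡) (no g≢b) _ _ = ⊥-elim (g≢b (trans g≡ gp))
      go (no g≢) (yes g≡b) _ _ = ⊥-elim (g≢ (trans g≡b (sym gp)))

    own-total : ∀ s i → total (λ l → W-own i (turn s l)) ≡ part b i
    own-total true  i = solve 3 (λ v w y → v :+ (y :- w) :+ (w :- v :+ con 0ℚ) := y) refl (v i) (w i) (part b i)
    own-total false i = solve 3 (λ v w y → v :+ (y :- w) :+ (con 0ℚ :+ (w :- v)) := y) refl (v i) (w i) (part b i)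

    oth-total : ∀ s i → total (W-oth s i) ≡ y i
    oth-total true  i = solve 1 (λ y → y :+ con 0ℚ :+ (con 0ℚ :+ con 0ℚ) := y) refl (y i)
    oth-total false i = solve 1 (λ y → con 0ℚ :+ y :+ (con 0ℚ :+ con 0ℚ) := y) refl (y i)

    levels : ∀ i → total (W i) ≡ y i
    levels i with true-or-false (does (group i ≟ᵇ b))
    ... | inj₁ e = trans (cong (λ d → total (λ l → if d then W-own i (turn s l) else W-oth s i l)) e)
                     (trans (own-total s i) (cong (λ d → if d then y i else 0ℚ) e))
    ... | inj₂ e = trans (cong (λ d → total (λ l → if d then W-own i (turn s l) else W-oth s i l)) e) (oth-total s i)

    outside : ∀ (i : Fin m) → does (group i ≟ᵇ b) ≡ false → v i ≡ 0ℚ × w i ≡ 0ℚ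
    outside i e = 0≤-antisym (0≤v i) (subst (v i ≤_) w≡0 (v≤w i)) , w≡0
      where
      w≡0 : w i ≡ 0ℚ
      w≡0 = 0≤-antisym (≤-trans (0≤v i) (v≤w i)) (subst (w i ≤_) (part∉ b i e) (w≤y i))

    flip-group : ∀ (i : Fin m) → does (group i ≟ᵇ not b) ≡ not (does (group i ≟ᵇ b))
    flip-group i = flip (group i) b
      where
      flip : ∀ a b → does (a ≟ᵇ not b) ≡ not (does (a ≟ᵇ b))
      flip true  true  = refl
      flip true  false = refl
      flip false true  = refl
      flip false false = refl

    component-along : ∀ i → component W b i ≡ v i + w i - part b i
    component-along i with true-or-false (does (group i ≟ᵇ b))
    ... | inj₁ e = trans (cong (λ d → if d then W i hi - W i lo else W i plus - W i minus) e)
        (trans (cong (λ d → (if d then W-own i (turn s hi) else W-oth s i hi) - (if d then W-own i (turn s lo) else W-oth s i lo)) e)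
        (trans (cong₂ _-_ (cong (W-own i) (turn-hi s)) (cong (W-own i) (turn-lo s)))
          (solve 3 (λ v w y → v :- (y :- w) := v :+ w :- y) refl (v i) (w i) (part b i))))
    ... | inj₂ e = let (v≡0 , w≡0) = outside i e in
        trans (cong (λ d → if d then W i hi - W i lo else W i plus - W i minus) e)
        (trans (cong (λ d → (if d then W-own i (turn s plus) else W-oth s i plus) - (if d then W-own i (turn s minus) else W-oth s i minus)) e)
        (trans (sides s) (sym (cong₂ _-_ (cong₂ _+_ v≡0 w≡0) (part∉ b i e)))))
      where
      sides : ∀ s → W-oth s i plus - W-oth s i minus ≡ 0ℚ
      sides true = refl
      sides false = refl

    component-across : ∀ i → component W (not b) i ≡ signed s (w i - v i + part (not b) i)
    component-across i with true-or-false (does (group i ≟ᵇ b))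
    ... | inj₁ e = trans (cong (λ d → if d then W i hi - W i lo else W i plus - W i minus) e′)
        (trans (cong (λ d → (if d then W-own i (turn s plus) else W-oth s i plus) - (if d then W-own i (turn s minus) else W-oth s i minus)) e)
        (trans (sides s) (cong (signed s) (trans (solve 2 (λ v w → w :- v := w :- v :+ con 0ℚ) refl (v i) (w i))
          (cong (λ z → w i - v i + z) (sym (part∉ (not b) i e′)))))))
      where
      e′ : does (group i ≟ᵇ not b) ≡ false
      e′ = trans (flip-group i) (cong not e)
      sides : ∀ s → W-own i (turn s plus) - W-own i (turn s minus) ≡ signed s (w i - v i)
      sides true = +-identityʳ (w i - v i)
      sides false = +-identityˡ (- (w i - v i))
    ... | inj₂ e = let (v≡0 , w≡0) = outside i e in
        trans (cong (λ d → if d then W i hi - W i lo else W i plus - W i minus) e′)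
        (trans (cong (λ d → (if d then W-own i (turn s hi) else W-oth s i hi) - (if d then W-own i (turn s lo) else W-oth s i lo)) e)
        (trans (sides s) (cong (signed s) (trans (solve 1 (λ y → y := con 0ℚ :- con 0ℚ :+ y) refl (y i))
          (cong₂ _+_ (sym (cong₂ _-_ w≡0 v≡0)) (sym (cong (λ d → if d then y i else 0ℚ) e′)))))))
      where
      e′ : does (group i ≟ᵇ not b) ≡ true
      e′ = trans (flip-group i) (cong not e)
      sides : ∀ s → W-oth s i hi - W-oth s i lo ≡ signed s (y i)
      sides true = +-identityʳ (y i)
      sides false = +-identityˡ (- y i)

    sum-along : sum (component W b) ≡ coordinate b
    sum-along = trans (sum-cong-≗ {m} component-along) (trans (sum-- {m} (λ i → v i + w i) (part b))
      (trans (cong (_- share b) (trans (∑-distrib-+ {m} v w) (cong₂ _+_ mass-v mass-w))) along))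

    sum-across : sum (component W (not b)) ≡ coordinate (not b)
    sum-across = trans (sum-cong-≗ {m} component-across) (trans (sum-signed s (λ i → w i - v i + part (not b) i))
      (trans (cong (signed s) (trans (∑-distrib-+ {m} (λ i → w i - v i) (part (not b))) (cong (_+ share (not b))
        (trans (sum-- {m} w v) (trans (cong₂ _-_ mass-w mass-v)
          (solve 2 (λ f e → f :+ e :- f := e) refl f e)))))) across))

    covered-middle : Covered
    covered-middle = cover C W W≥0 vanishing levels components
      where
      components : ∀ d → sum (component W d) ≡ coordinate d
      components d with d ≟ᵇ b
      ... | yes refl = sum-along
      ... | no d≢b = subst (λ d → sum (component W d) ≡ coordinate d) (sym (¬-not d≢b)) sum-across

  -- The mass put on the high ends solves hi + lo = share b and hi - lo = coordinate b.
  module Centre (t : ∀ b → Threshold (λ i → does (group i ≟ᵇ b)) (part b) (½ * (share b + coordinate b))) where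

    thr : Bool → Fin m
    thr b = Threshold.p (t b)

    high : Fin m → ℚ
    high i = Threshold.w (t (group i)) i

    W : Fin m → Label → ℚ
    W i hi    = high i
    W i lo    = y i - high i
    W i plus  = 0ℚ
    W i minus = 0ℚ

    part-own : ∀ i → part (group i) i ≡ y i
    part-own i = cong (λ d → if d then y i else 0ℚ) (dec-true (group i ≟ᵇ group i) refl)

    W≥0 : ∀ i l → 0ℚ ≤ W i l
    W≥0 i hi    = Threshold.nonneg (t (group i)) i
    W≥0 i lo    = 0≤- (subst (high i ≤_) (part-own i) (Threshold.bounded (t (group i)) i))
    W≥0 i plus  = ≤-refl
    W≥0 i minus = ≤-refl

    group-thr : ∀ b → group (thr b) ≡ b
    group-thr b with group (thr b) ≟ᵇ b | Threshold.p∈ (t b)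
    ... | yes g≡ | _ = g≡
    ... | no _   | ()

    C : Cell m
    C = central (thr true) (thr false) (group-thr true) (group-thr false)

    vanishing : Vanishing C W
    vanishing i l e = go l (group i) refl e
      where
      away : ∀ {r} l → member (cen (toℕ (thr (group i))) r) (toℕ i) l ≡ false → W i l ≡ 0ℚ
      away hi e = Threshold.above (t (group i)) i (ℕₚ.≰⇒> λ i≤t → true≢false (trans (sym (≤ᵈ-true i≤t)) e))
      away lo e = p-q≡0 (sym (trans (Threshold.below (t (group i)) i
        (ℕₚ.≰⇒> λ t≤i → true≢false (trans (sym (≤ᵈ-true t≤i)) e))) (part-own i)))
      away plus  e = refl
      away minus e = refl
      go : ∀ l b → group i ≡ b →
        member (if group i then cen (toℕ (thr true)) (toℕ (thr false)) else cen (toℕ (thr false)) (toℕ (thr true))) (toℕ i) l ≡ false →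
        W i l ≡ 0ℚ
      go l true g e = away {toℕ (thr false)} l (trans (cong (λ b → member (cen (toℕ (thr b)) (toℕ (thr false))) (toℕ i) l) g)
        (trans (cong (λ b → member (if b then cen (toℕ (thr true)) (toℕ (thr false)) else cen (toℕ (thr false)) (toℕ (thr true))) (toℕ i) l) (sym g)) e))
      go l false g e = away {toℕ (thr true)} l (trans (cong (λ b → member (cen (toℕ (thr b)) (toℕ (thr true))) (toℕ i) l) g)
        (trans (cong (λ b → member (if b then cen (toℕ (thr true)) (toℕ (thr false)) else cen (toℕ (thr false)) (toℕ (thr true))) (toℕ i) l) (sym g)) e))

    levels : ∀ i → total (W i) ≡ y i
    levels i = solve 2 (λ h y → h :+ (y :- h) :+ (con 0ℚ :+ con 0ℚ) := y) refl (high i) (y i)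

    components-at : ∀ b i → component W b i ≡ Threshold.w (t b) i + Threshold.w (t b) i - part b i
    components-at b i with true-or-false (does (group i ≟ᵇ b))
    ... | inj₁ e = trans (cong (λ d → if d then W i hi - W i lo else W i plus - W i minus) e)
      (trans (solve 2 (λ h y → h :- (y :- h) := h :+ h :- y) refl (high i) (y i))
        (cong₂ _-_ (cong (λ b → Threshold.w (t b) i + Threshold.w (t b) i) (dec-does e)) (sym (cong (λ d → if d then y i else 0ℚ) e))))
      where
      dec-does : does (group i ≟ᵇ b) ≡ true → group i ≡ b
      dec-does e with group i ≟ᵇ b
      ... | yes g≡ = g≡
      dec-does () | no _
    ... | inj₂ e = trans (cong (λ d → if d then W i hi - W i lo else W i plus - W i minus) e)
      (sym (cong₂ _-_ (cong₂ _+_ w≡0 w≡0) (part∉ b i e)))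
      where
      w≡0 : Threshold.w (t b) i ≡ 0ℚ
      w≡0 = 0≤-antisym (Threshold.nonneg (t b) i) (subst (Threshold.w (t b) i ≤_) (part∉ b i e) (Threshold.bounded (t b) i))

    components : ∀ b → sum (component W b) ≡ coordinate b
    components b = trans (sum-cong-≗ {m} (components-at b)) (trans (sum-- {m} (λ i → Threshold.w (t b) i + Threshold.w (t b) i) (part b))
      (trans (cong (_- share b) (trans (∑-distrib-+ {m} (Threshold.w (t b)) (Threshold.w (t b))) (cong₂ _+_ (Threshold.mass (t b)) (Threshold.mass (t b)))))
        (solve 2 (λ s c → con ½ :* (s :+ c) :+ con ½ :* (s :+ c) :- s := c) refl (share b) (coordinate b))))

    covered-centre : Covered
    covered-centre = cover C W W≥0 vanishing levels components

  private
    -- The square is given by |x + y - 1| + |x - y| ≤ 1.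
    square : ∀ b s → 0ℚ ≤ ½ * (1ℚ - signed s (coordinate (not b)) + coordinate b) ×
                     0ℚ ≤ ½ * (1ℚ - signed s (coordinate (not b)) - coordinate b)
    square true true =
        subst (0ℚ ≤_) (solve 2 (λ X Y → Y := con ½ :* (con 1ℚ :- (X :- Y) :+ (X :+ Y :- con 1ℚ))) refl X Y) 0≤Y
      , subst (0ℚ ≤_) (solve 2 (λ X Y → con 1ℚ :- X := con ½ :* (con 1ℚ :- (X :- Y) :- (X :+ Y :- con 1ℚ))) refl X Y) (0≤- X≤1)
    square true false =
        subst (0ℚ ≤_) (solve 2 (λ X Y → X := con ½ :* (con 1ℚ :- (:- (X :- Y)) :+ (X :+ Y :- con 1ℚ))) refl X Y) 0≤X
      , subst (0ℚ ≤_) (solve 2 (λ X Y → con 1ℚ :- Y := con ½ :* (con 1ℚ :- (:- (X :- Y)) :- (X :+ Y :- con 1ℚ))) refl X Y) (0≤- Y≤1)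
    square false true =
        subst (0ℚ ≤_) (solve 2 (λ X Y → con 1ℚ :- Y := con ½ :* (con 1ℚ :- (X :+ Y :- con 1ℚ) :+ (X :- Y))) refl X Y) (0≤- Y≤1)
      , subst (0ℚ ≤_) (solve 2 (λ X Y → con 1ℚ :- X := con ½ :* (con 1ℚ :- (X :+ Y :- con 1ℚ) :- (X :- Y))) refl X Y) (0≤- X≤1)
    square false false =
        subst (0ℚ ≤_) (solve 2 (λ X Y → X := con ½ :* (con 1ℚ :- (:- (X :+ Y :- con 1ℚ)) :+ (X :- Y))) refl X Y) 0≤X
      , subst (0ℚ ≤_) (solve 2 (λ X Y → Y := con ½ :* (con 1ℚ :- (:- (X :+ Y :- con 1ℚ)) :- (X :- Y))) refl X Y) 0≤Y

    middle : ∀ b s → share (not b) ≤ signed s (coordinate (not b)) → Covered ⊎ (∀ (i : Fin m) → does (group i ≟ᵇ b) ≡ false)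
    middle b s h = map₁ (λ t → Middle.covered-middle b s t along across)
      (two-thresholds (λ i → does (group i ≟ᵇ b)) (part b) {f} {e} (part≥0 b) (part∉ b)
        (proj₁ (square b s)) (0≤- h) enough)
      where
      z = signed s (coordinate (not b))
      -- The excess e over the rectangle must come from the side corners. This leaves hi + lo =
      -- share b - e = 1 - z, and with hi - lo = coordinate b the mass on `hi` is f; `square` says
      -- that both masses are nonnegative.
      e = z - share (not b)
      f = ½ * (1ℚ - z + coordinate b)
      enough : f + e ≤ share b
      enough = ≤-by (½ * (1ℚ - z - coordinate b)) (proj₂ (square b s))
        (by₁ 1ℚ (share-split b) (solve 4 (λ z c s s′ → s := con ½ :* (con 1ℚ :- z :+ c) :+ (z :- s′)
          :+ con ½ :* (con 1ℚ :- z :- c) :+ con 1ℚ :* (s′ :+ s :- con 1ℚ)) refl z (coordinate b) (share b) (share (not b))))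
      along : f + (f + e) - share b ≡ coordinate b
      along = by₁ (- 1ℚ) (share-split b) (solve 4 (λ z c s s′ → con ½ :* (con 1ℚ :- z :+ c) :+ (con ½ :* (con 1ℚ :- z :+ c) :+ (z :- s′)) :- s
        := c :+ con (- 1ℚ) :* (s′ :+ s :- con 1ℚ)) refl z (coordinate b) (share b) (share (not b)))
      involutive : ∀ s {x} → signed s (signed s x) ≡ x
      involutive true = refl
      involutive false {x} = solve 1 (λ x → :- (:- x) := x) refl x
      across : signed s (e + share (not b)) ≡ coordinate (not b)
      across = trans (cong (signed s) (solve 2 (λ z s′ → z :- s′ :+ s′ := z) refl z (share (not b)))) (involutive s)

    -- The alternation starts with group true, so this group is empty only if there are no levels,
    -- and then the masses cannot sum to 1.
    nonempty : ∀ {n} (h : Fin n → ℚ) → sum h ≡ 1ℚ → ¬ (∀ i → does (group {n} i ≟ᵇ true) ≡ false)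
    nonempty {zero}  h e _ = 1≢0 (sym e)
    nonempty {suc n} h e none with none zero
    ... | ()

    empty-share : ∀ b → (∀ (i : Fin m) → does (group i ≟ᵇ b) ≡ false) → share b ≡ 0ℚ
    empty-share b none = sum-zero λ i → part∉ b i (none i)

    -- The group is inhabited: otherwise its share is 0, and one of 0 ≤ c and 0 ≤ -c, for its
    -- coordinate c, contradicts a hypothesis.
    central-threshold : ∀ b → ¬ share b ≤ coordinate b → ¬ share b ≤ - coordinate b →
      Threshold (λ i → does (group i ≟ᵇ b)) (part b) (½ * (share b + coordinate b))
    central-threshold b c≱ c≰ = present (threshold (λ i → does (group i ≟ᵇ b)) (part b) {½ * (share b + coordinate b)}
      (part≥0 b) (part∉ b) low high)
      where
      0≤½ : 0ℚ ≤ ½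
      0≤½ = nonNegative⁻¹ ½
      low : 0ℚ ≤ ½ * (share b + coordinate b)
      low = 0≤* {½} 0≤½ (subst (0ℚ ≤_) (solve 2 (λ s c → s :- (:- c) := s :+ c) refl (share b) (coordinate b))
          (0≤- (<⇒≤ (≰⇒> c≰))))
      high : ½ * (share b + coordinate b) ≤ share b
      high = ≤-by (½ * (share b - coordinate b)) (0≤* {½} 0≤½ (0≤- (<⇒≤ (≰⇒> c≱))))
          (solve 2 (λ s c → s := con ½ :* (s :+ c) :+ con ½ :* (s :- c)) refl (share b) (coordinate b))
      absent : (∀ (i : Fin m) → does (group i ≟ᵇ b) ≡ false) → Dec (coordinate b ≤ 0ℚ) → ⊥
      absent none (yes c≤0) = c≰ (subst (_≤ - coordinate b) (sym (empty-share b none)) (neg-antimono-≤ c≤0))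
      absent none (no c≰0) = c≱ (subst (_≤ coordinate b) (sym (empty-share b none)) (<⇒≤ (≰⇒> c≰0)))
      present : ∀ {f} → Threshold (λ i → does (group i ≟ᵇ b)) (part b) f ⊎ (∀ (i : Fin m) → does (group i ≟ᵇ b) ≡ false) →
        Threshold (λ i → does (group i ≟ᵇ b)) (part b) f
      present (inj₁ t) = t
      present (inj₂ none) = ⊥-elim (absent none (coordinate b ℚₚ.≤? 0ℚ))

    or-absurd : ∀ b → ¬ (∀ (i : Fin m) → does (group i ≟ᵇ b) ≡ false) →
      Covered ⊎ (∀ (i : Fin m) → does (group i ≟ᵇ b) ≡ false) → Covered
    or-absurd b _ (inj₁ c) = c
    or-absurd b some (inj₂ none) = ⊥-elim (some none)

    inhabited : ∀ {b f} → Threshold (λ i → does (group i ≟ᵇ b)) (part b) f → ¬ (∀ (i : Fin m) → does (group i ≟ᵇ b) ≡ false)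
    inhabited t none with trans (sym (Threshold.p∈ t)) (none (Threshold.p t))
    ... | ()

  -- The order of the cases matters. Group false is empty for m = 1; its share is then 0 and one of
  -- the first two cases applies, whose thresholds lie in group true. Once these cases are excluded,
  -- `central-threshold` shows group false to be inhabited.
  covered-point : Covered
  covered-point = choose (share false ℚₚ.≤? coordinate false) (share false ℚₚ.≤? - coordinate false)
                         (share true ℚₚ.≤? coordinate true) (share true ℚₚ.≤? - coordinate true)
    where
    choose : Dec (share false ≤ coordinate false) → Dec (share false ≤ - coordinate false) →
             Dec (share true ≤ coordinate true) → Dec (share true ≤ - coordinate true) → Covered
    choose (yes h) _ _ _ = or-absurd true (nonempty y Σy) (middle true true h)
    choose (no _) (yes h) _ _ = or-absurd true (nonempty y Σy) (middle true false h)
    choose (no F₁) (no F₂) (yes h) _ = or-absurd false (inhabited (central-threshold false F₁ F₂)) (middle false true h)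
    choose (no F₁) (no F₂) (no _) (yes h) = or-absurd false (inhabited (central-threshold false F₁ F₂)) (middle false false h)
    choose (no F₁) (no F₂) (no T₁) (no T₂) = Centre.covered-centre λ
      { true → central-threshold true T₁ T₂ ; false → central-threshold false F₁ F₂ }

-- Upper bounds for weights

factor≤product : ∀ {n} (f : Fin n → ℕ) → (∀ i → ℕ.NonZero (f i)) → ∀ p → f p ℕ.≤ product (List.tabulate f)
factor≤product {suc n} f f≢0 zero = ℕₚ.m≤m*n (f zero) (product (List.tabulate (f ∘ suc)))
  {{product≢0 (tabulate⁺ (f≢0 ∘ suc))}}
factor≤product {suc n} f f≢0 (suc p) = ℕₚ.≤-trans (factor≤product (f ∘ suc) (f≢0 ∘ suc) p)
  (ℕₚ.m≤n*m _ (f zero) {{f≢0 zero}})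

module _ {m} (τ : VertexSet m) where
  private
    fs = List.tabulate (λ i → simplexType m τ i !)
    instance
      P≢0 : ℕ.NonZero (product fs)
      P≢0 = product≢0 (tabulate⁺ (λ i → ℕₚ._!≢0 (simplexType m τ i)))

  weight≥0 : 0ℚ ≤ weight m τ
  weight≥0 = nonNegative⁻¹ (weight m τ) {{normalize-nonNeg 1 (product fs)}}

  weight-≤ : ∀ n → n ℕ.≤ product fs → weight m τ * ι n ≤ 1ℚ
  weight-≤ n n≤P = ≤-trans (*-monoˡ-≤-nonNeg (weight m τ) {{ℚ.nonNegative weight≥0}} (ι-mono n≤P))
    (≤-reflexive (ι-1/ 1 (product fs)))

  weight≤1 : weight m τ ≤ 1ℚ
  weight≤1 = subst (_≤ 1ℚ) (*-identityʳ (weight m τ)) (weight-≤ 1 (ℕ.>-nonZero⁻¹ (product fs)))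

  twice-weight≤1 : ∀ i → simplexType m τ i ≡ 2 → weight m τ + weight m τ ≤ 1ℚ
  twice-weight≤1 i e = subst (_≤ 1ℚ) (solve 1 (λ w → w :* con (ι 2) := w :+ w) refl (weight m τ))
    (weight-≤ 2 (ℕₚ.≤-trans (ℕₚ.≤-reflexive (cong _! (sym e)))
      (factor≤product (λ i → simplexType m τ i !) (λ i → ℕₚ._!≢0 (simplexType m τ i)) i)))

total-++ : ∀ {m} (S T : List (VertexSet m)) → totalWeight m (S List.++ T) ≡ totalWeight m S + totalWeight m T
total-++ {m} []      T = sym (+-identityˡ (totalWeight m T))
total-++ {m} (τ ∷ S) T = trans (cong (λ x → weight m τ + x) (total-++ {m} S T)) (sym (ℚₚ.+-assoc (weight m τ) _ _))

module _ {A : Set} (f : A → ℚ) (f≥0 : ∀ x → 0ℚ ≤ f x) where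
  Σf : List A → ℚ
  Σf xs = List.foldr _+_ 0ℚ (List.map f xs)

  Σ-filter : ∀ {P : Pred A 0ℓ} (P? : Decidable P) xs → Σf (filter P? xs) ≤ Σf xs
  Σ-filter P? [] = ≤-refl
  Σ-filter P? (x ∷ xs) with does (P? x)
  ... | true  = +-monoʳ-≤ (f x) (Σ-filter P? xs)
  ... | false = ≤-trans (Σ-filter P? xs) (≤-by (f x) (f≥0 x) (+-comm (f x) _))

  Σ-deduplicate : ∀ (_≟_ : DecidableEquality A) xs → Σf (deduplicate _≟_ xs) ≤ Σf xs
  Σ-deduplicate _≟_ [] = ≤-refl
  Σ-deduplicate _≟_ (x ∷ xs) = +-monoʳ-≤ (f x)
    (≤-trans (Σ-filter _ (deduplicate _≟_ xs)) (Σ-deduplicate _≟_ xs))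

-- The optimal triangulation

module _ {m : ℕ} where
  forward : ∀ (p q : Fin m) → group p ≡ group q → Dec (toℕ p ℕ.≤ toℕ q) → List (Cell m)
  forward p q e (yes p≤q) = mid true p q e p≤q ∷ []
  forward p q e (no _)    = []

  backward : ∀ (p q : Fin m) → group p ≡ group q → Dec (toℕ q ℕ.≤ toℕ p) → List (Cell m)
  backward p q e (yes q≤p) = mid false q p (sym e) q≤p ∷ []
  backward p q e (no _)    = []

  mixed : ∀ (p q : Fin m) a b → group p ≡ a → group q ≡ b → List (Cell m)
  mixed p q true false gp gq = central p q gp gq ∷ []
  mixed p q _    _     _  _  = []

  -- Cells are listed by ordered pairs of levels. Within a group the pairs p ≤ q index the cells on
  -- one side of the diagonals and q ≤ p those on the other, so p = q yields the two triangles of a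
  -- level. A crossing pair is listed in one order only.
  cells-of : ∀ (p q : Fin m) → Dec (group p ≡ group q) → List (Cell m)
  cells-of p q (yes e) = forward p q e (toℕ p ℕₚ.≤? toℕ q) List.++ backward p q e (toℕ q ℕₚ.≤? toℕ p)
  cells-of p q (no _)  = mixed p q (group p) (group q) refl refl

  simplices-of : Fin m → Fin m → List (VertexSet m)
  simplices-of p q = List.map ⟦_⟧ (cells-of p q (group p ≟ᵇ group q))

  all-simplices : List (VertexSet m)
  all-simplices = List.concat (List.tabulate λ p → List.concat (List.tabulate λ q → simplices-of p q))

  -- Removing repetitions gives uniqueness without comparing the vertex sets of different cells, and
  -- it can only lower the total weight.
  optimal : List (VertexSet m)
  optimal = deduplicate (≡-dec _≟ᵇ_) all-simplices

  private
    listed : ∀ p q {τ} → τ ∈ˡ simplices-of p q → τ ∈ˡ optimal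
    listed p q τ∈ = ∈-deduplicate⁺ (≡-dec _≟ᵇ_)
      (∈-concat⁺′ (∈-concat⁺′ τ∈ (∈-tabulate⁺ {f = λ q → simplices-of p q} q))
        (∈-tabulate⁺ {f = λ p → List.concat (List.tabulate λ q → simplices-of p q)} p))

  cell∈optimal : ∀ (C : Cell m) → ⟦ C ⟧ ∈ˡ optimal
  cell∈optimal (central p q gp gq) = listed p q (go (group p ≟ᵇ group q))
    where
    go : ∀ d → ⟦ central p q gp gq ⟧ ∈ˡ List.map ⟦_⟧ (cells-of p q d)
    go (yes e) with trans (sym gp) (trans e gq)
    ... | ()
    go (no _) = here-central (group p) (group q) refl refl gp gq
      where
      here-central : ∀ a b (ga : group p ≡ a) (gb : group q ≡ b) → a ≡ true → b ≡ false →
        ⟦ central p q gp gq ⟧ ∈ˡ List.map ⟦_⟧ (mixed p q a b ga gb)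
      here-central true false _ _ _ _ = here refl
  cell∈optimal (mid true p q e p≤q) = listed p q (go (group p ≟ᵇ group q))
    where
    go : ∀ d → ⟦ mid true p q e p≤q ⟧ ∈ˡ List.map ⟦_⟧ (cells-of p q d)
    go (no g≢) = ⊥-elim (g≢ e)
    go (yes _) with toℕ p ℕₚ.≤? toℕ q
    ... | yes _ = here refl
    ... | no p≰q = ⊥-elim (p≰q p≤q)
  cell∈optimal (mid false p q e p≤q) = listed q p (go (group q ≟ᵇ group p))
    where
    go : ∀ d → ⟦ mid false p q e p≤q ⟧ ∈ˡ List.map ⟦_⟧ (cells-of q p d)
    go (no g≢) = ⊥-elim (g≢ (sym e))
    go (yes e′) = subst (_ ∈ˡ_) (sym (map-++ ⟦_⟧ (forward q p e′ (toℕ q ℕₚ.≤? toℕ p)) _))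
      (∈-++⁺ʳ (List.map ⟦_⟧ (forward q p e′ (toℕ q ℕₚ.≤? toℕ p))) last)
      where
      last : ⟦ mid false p q e p≤q ⟧ ∈ˡ List.map ⟦_⟧ (backward q p e′ (toℕ p ℕₚ.≤? toℕ q))
      last with toℕ p ℕₚ.≤? toℕ q
      ... | yes _ = here refl
      ... | no p≰q = ⊥-elim (p≰q p≤q)

  private
    from-concat : ∀ {n} {P : VertexSet m → Set} (f : Fin n → List (VertexSet m)) →
      (∀ i {τ} → τ ∈ˡ f i → P τ) → ∀ {τ} → τ ∈ˡ List.concat (List.tabulate f) → P τ
    from-concat {zero} f h ()
    from-concat {suc n} {P} f h = go (f zero) (h zero)
      where
      go : ∀ xs → (∀ {τ} → τ ∈ˡ xs → P τ) → ∀ {τ} → τ ∈ˡ xs List.++ List.concat (List.tabulate (f ∘ suc)) → P τ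
      go []       k τ∈ = from-concat (f ∘ suc) (λ i → h (suc i)) τ∈
      go (x ∷ xs) k (here refl) = k (here refl)
      go (x ∷ xs) k (there τ∈) = go xs (k ∘ there) τ∈

  optimal⇒cell : ∀ {τ} → τ ∈ˡ optimal → ∃[ C ] τ ≡ ⟦ C ⟧
  optimal⇒cell τ∈ = from-concat (λ p → List.concat (List.tabulate λ q → simplices-of p q))
    (λ p → from-concat (simplices-of p) λ q τ∈ → let (C , _ , e) = ∈-map⁻ ⟦_⟧ τ∈ in C , e)
    (∈-deduplicate⁻ (≡-dec _≟ᵇ_) all-simplices τ∈)

  private
    module _ {x y h w τ} (r : Rep {m} τ x y h w) where
      open Rep r

      pair≥0 : ∀ a b → 0ℚ ≤ sum (λ i → w i a + w i b)
      pair≥0 a b = sum-nonneg {m} λ i → 0≤+ (nonneg i a) (nonneg i b)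

      X≤total : sumX w ≤ sum (λ i → Σ₄ (w i))
      X≤total = ≤-by (sum (λ i → w i 0F + w i 2F)) (pair≥0 0F 2F)
        (trans (sum-cong-≗ {m} λ i → solve 4 (λ a b c d → a :+ (b :+ (c :+ d)) := b :+ d :+ (a :+ c)) refl
          (w i 0F) (w i 1F) (w i 2F) (w i 3F)) (∑-distrib-+ {m} (λ i → w i 1F + w i 3F) _))

      Y≤total : sumY w ≤ sum (λ i → Σ₄ (w i))
      Y≤total = ≤-by (sum (λ i → w i 0F + w i 1F)) (pair≥0 0F 1F)
        (trans (sum-cong-≗ {m} λ i → solve 4 (λ a b c d → a :+ (b :+ (c :+ d)) := c :+ d :+ (a :+ b)) refl
          (w i 0F) (w i 1F) (w i 2F) (w i 3F)) (∑-distrib-+ {m} (λ i → w i 2F + w i 3F) _))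

      level≥0 : ∀ i → 0ℚ ≤ h i
      level≥0 i = subst (0ℚ ≤_) (levels i) (0≤+ (nonneg i 0F) (0≤+ (nonneg i 1F) (0≤+ (nonneg i 2F) (nonneg i 3F))))

    conv⊆I²×Δ : ∀ {x τ} → _∈conv_ (vertex m) x τ → I²×Δ m x
    conv⊆I²×Δ {x} {τ} cv@(c , _ , _ , Σc , _) =
      let (w , r) = conv⇒Rep {m} {x} {τ} cv
          Σh : sum (λ i → x (suc (suc i))) ≡ 1ℚ
          Σh = trans (sym (sum-cong-≗ {m} (Rep.levels r))) (Σ₄w w r)
      in (λ { 0F → subst (0ℚ ≤_) (Rep.horiz r) (pair≥0 r 1F 3F) , subst₂ _≤_ (Rep.horiz r) (Σ₄w w r) (X≤total r)
            ; 1F → subst (0ℚ ≤_) (Rep.vert r) (pair≥0 r 2F 3F) , subst₂ _≤_ (Rep.vert r) (Σ₄w w r) (Y≤total r) })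
       , level≥0 r , Σh
      where
      Σh≡1 : sum (λ i → x (suc (suc i))) ≡ 1ℚ
      Σh≡1 = trans (sym (sum-cong-≗ {m} (Rep.levels (proj₂ (conv⇒Rep {m} {x} {τ} cv))))) (trans (sym (sum-blocks m c)) Σc)
      Σ₄w : ∀ w → Rep {m} τ (x 0F) (x 1F) (λ i → x (suc (suc i))) w → sum (λ i → Σ₄ (w i)) ≡ 1ℚ
      Σ₄w w r = trans (sum-cong-≗ {m} (Rep.levels r)) Σh≡1

  optimal-triangulates : Triangulates m optimal
  optimal-triangulates = record
    { unique = deduplicate-! (≡-dec _≟ᵇ_) all-simplices
    ; simplices = λ τ∈ → let (C , e) = optimal⇒cell τ∈ in subst (IsSimplex (vertex m) (suc m)) (sym e) (cell-simplex C)
    ; union = λ x → mk⇔ (to x) (λ any → conv⊆I²×Δ {x} (proj₂ (proj₂ (find any))))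
    ; faceToFace = λ σ∈ τ∈ → let (C , e) = optimal⇒cell σ∈ ; (D , e′) = optimal⇒cell τ∈ in
        subst₂ (MeetFaceToFace (vertex m)) (sym e) (sym e′) (face-to-face C D) }
    where
    to : ∀ x → I²×Δ m x → Any (_∈conv_ (vertex m) x) optimal
    to x (sq , y≥0 , Σy) =
      let (C , w , r) = Cover.covered-point (λ i → x (suc (suc i))) y≥0 Σy (x 0F) (x 1F)
            (proj₁ (sq 0F)) (proj₂ (sq 0F)) (proj₁ (sq 1F)) (proj₂ (sq 1F))
      in lose (cell∈optimal C) (Rep⇒conv {m} {x} {⟦ C ⟧} {w} r Σy)

  -- Two simplices arise only for p = q, and these are triangles of weight at most 1/2 each; any
  -- other pair has at most one simplex, of weight at most 1.
  total-pair : ∀ p q → totalWeight m (simplices-of p q) ≤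
               ι (same (group p) (group q) ℕ.+ same true (group p) ℕ.* same false (group q))
  total-pair p q = go (group p ≟ᵇ group q)
    where
    bound₁ : ∀ τ → totalWeight m (τ ∷ []) ≤ 1ℚ
    bound₁ τ = subst (_≤ 1ℚ) (sym (+-identityʳ (weight m τ))) (weight≤1 {m} τ)
    same≥1 : ∀ {a b} → a ≡ b → 1ℚ ≤ ι (same a b ℕ.+ same true a ℕ.* same false b)
    same≥1 {true} refl = ≤-refl
    same≥1 {false} refl = ≤-refl
    go : ∀ d → totalWeight m (List.map ⟦_⟧ (cells-of p q d)) ≤
               ι (same (group p) (group q) ℕ.+ same true (group p) ℕ.* same false (group q))
    go (no _) = apart (group p) (group q) refl refl
      where
      apart : ∀ a b (ga : group p ≡ a) (gb : group q ≡ b) →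
        totalWeight m (List.map ⟦_⟧ (mixed p q a b ga gb)) ≤ ι (same a b ℕ.+ same true a ℕ.* same false b)
      apart true  true  _  _  = 0≤ι 1
      apart true  false ga gb = bound₁ ⟦ central p q ga gb ⟧
      apart false true  _  _  = ≤-refl
      apart false false _  _  = 0≤ι 1
    go (yes e) = ≤-trans (together (toℕ p ℕₚ.≤? toℕ q) (toℕ q ℕₚ.≤? toℕ p)) (same≥1 e)
      where
      together : ∀ d d′ → totalWeight m (List.map ⟦_⟧ (forward p q e d List.++ backward p q e d′)) ≤ 1ℚ
      together (no _) (no _) = 0≤1
      together (yes p≤q) (no _) = bound₁ ⟦ mid true p q e p≤q ⟧
      together (no _) (yes q≤p) = bound₁ ⟦ mid false q p (sym e) q≤p ⟧
      together (yes p≤q) (yes q≤p) = ≤-by ((1ℚ - (u + u)) * ½ + (1ℚ - (v + v)) * ½)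
            (0≤+ (0≤* (0≤- (half C C≡)) (nonNegative⁻¹ ½)) (0≤* (0≤- (half D D≡)) (nonNegative⁻¹ ½)))
            (solve 2 (λ u v → con 1ℚ := u :+ (v :+ con 0ℚ) :+ ((con 1ℚ :- (u :+ u)) :* con ½ :+ (con 1ℚ :- (v :+ v)) :* con ½)) refl u v)
        where
        C D : Cell m
        C = mid true p q e p≤q
        D = mid false q p (sym e) q≤p
        u = weight m ⟦ C ⟧
        v = weight m ⟦ D ⟧
        C≡ : first C ≡ second C
        C≡ = toℕ-injective (ℕₚ.≤-antisym p≤q q≤p)
        D≡ : first D ≡ second D
        D≡ = sym C≡
        half : ∀ (E : Cell m) → first E ≡ second E → weight m ⟦ E ⟧ + weight m ⟦ E ⟧ ≤ 1ℚ
        half E E≡ = twice-weight≤1 {m} ⟦ E ⟧ (first E) (type-twice E E≡)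

-- Total weight of the optimal triangulation

total-concat : ∀ {m n} (f : Fin n → List (VertexSet m)) (b : Fin n → ℕ) → (∀ i → totalWeight m (f i) ≤ ι (b i)) →
  totalWeight m (List.concat (List.tabulate f)) ≤ ι (sumℕ b)
total-concat {n = zero} f b h = ≤-refl
total-concat {m} {suc n} f b h = subst₂ _≤_ (sym (total-++ {m} (f zero) _)) (sym (ι-+ (b zero) _))
  (+-mono-≤ (h zero) (total-concat {m} (f ∘ suc) (b ∘ suc) (λ i → h (suc i))))

sum-contributions : ∀ {m} (d : Fin m → Bool) →
  sumℕ (λ p → sumℕ (λ q → same (d p) (d q) ℕ.+ same true (d p) ℕ.* same false (d q))) ≡ bound d
sum-contributions {m} d = trans (sumℕ-cong {m} λ p → trans (ℕ∑-distrib-+ {m} (λ q → same (d p) (d q)) _)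
    (cong (size d (d p) ℕ.+_) (trans (sumℕ-cong {m} λ q → ℕₚ.*-comm (same true (d p)) (same false (d q)))
      (sumℕ-*ʳ {m} (λ q → same false (d q)) (same true (d p))))))
  (trans (sum-classes d (λ b → size d b ℕ.+ size d false ℕ.* same true b))
    (solveℕ 2 (λ k l → k ⊗ (k ⊕ l ⊗ # 1) ⊕ l ⊗ (l ⊕ l ⊗ # 0)
      :=ℕ k ⊗ k ⊕ k ⊗ l ⊕ l ⊗ l) refl (size d true) (size d false)))

-- A level of group true put in front exchanges the two classes and then enlarges the first.
balanced : ∀ m → size (group {m}) true ≡ size (group {m}) false ⊎
                 size (group {m}) true ≡ suc (size (group {m}) false)
balanced zero = inj₁ refl
balanced (suc m) = step (balanced m)
  where
  flip : ∀ b → sumℕ (λ (i : Fin m) → same b (not (group i))) ≡ size (group {m}) (not b)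
  flip b = sumℕ-cong {m} λ i → same-not b (group i)
    where
    same-not : ∀ a b → same a (not b) ≡ same (not a) b
    same-not true  true  = refl
    same-not true  false = refl
    same-not false true  = refl
    same-not false false = refl
  step : size (group {m}) true ≡ size (group {m}) false ⊎ size (group {m}) true ≡ suc (size (group {m}) false) →
    size (group {suc m}) true ≡ size (group {suc m}) false ⊎ size (group {suc m}) true ≡ suc (size (group {suc m}) false)
  step (inj₁ e) = inj₂ (cong suc (trans (flip true) (trans (sym e) (sym (flip false)))))
  step (inj₂ e) = inj₁ (trans (cong suc (flip true)) (trans (sym e) (sym (flip false))))

-- For class sizes k = l or k = l + 1 this is 3 m² / 4 rounded up.
least : ℕ → ℕ
least m = bound (group {m})

total-optimal : ∀ m → totalWeight m (optimal {m}) ≤ ι (least m)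
total-optimal m = ≤-trans (Σ-deduplicate (weight m) (weight≥0 {m}) (≡-dec _≟ᵇ_) (all-simplices {m})) (subst (λ n → totalWeight m (all-simplices {m}) ≤ ι n)
  (sum-contributions (group {m}))
  (total-concat {m} (λ p → List.concat (List.tabulate λ q → simplices-of p q)) (λ p → sumℕ (share p))
    λ p → total-concat {m} (λ q → simplices-of p q) (share p) (total-pair p)))
  where
  share : Fin m → Fin m → ℕ
  share p q = same (group p) (group q) ℕ.+ same true (group p) ℕ.* same false (group q)

least-lower : ∀ m → 3 ℕ.* (m ℕ.* m) ℕ.≤ 4 ℕ.* least m
least-lower m = subst (λ n → 3 ℕ.* (n ℕ.* n) ℕ.≤ 4 ℕ.* least m) (size-total (group {m}))
  (quarter (size (group {m}) true) (size (group {m}) false))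

-- The two sides without the summand 1 differ by (k - l)², which is 0 or 1 for balanced classes.
least-upper : ∀ m → 4 ℕ.* least m ℕ.≤ 3 ℕ.* (m ℕ.* m) ℕ.+ 1
least-upper m = subst (λ n → 4 ℕ.* least m ℕ.≤ 3 ℕ.* (n ℕ.* n) ℕ.+ 1) (size-total (group {m})) (go _ _ (balanced m))
  where
  go : ∀ k l → k ≡ l ⊎ k ≡ suc l → 4 ℕ.* (k ℕ.* k ℕ.+ k ℕ.* l ℕ.+ l ℕ.* l) ℕ.≤ 3 ℕ.* ((k ℕ.+ l) ℕ.* (k ℕ.+ l)) ℕ.+ 1
  go k .k (inj₁ refl) = ℕₚ.≤-trans (ℕₚ.≤-reflexive (solveℕ 1 (λ k → # 4 ⊗ (k ⊗ k ⊕ k ⊗ k ⊕ k ⊗ k) :=ℕ # 3 ⊗ ((k ⊕ k) ⊗ (k ⊕ k))) refl k))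
    (ℕₚ.m≤m+n _ 1)
  go .(suc l) l (inj₂ refl) = ℕₚ.≤-reflexive (solveℕ 1 (λ l → # 4 ⊗ ((# 1 ⊕ l) ⊗ (# 1 ⊕ l) ⊕ (# 1 ⊕ l) ⊗ l ⊕ l ⊗ l)
    :=ℕ # 3 ⊗ ((# 1 ⊕ l ⊕ l) ⊗ (# 1 ⊕ l ⊕ l)) ⊕ # 1) refl l)

-- Square roots

√-mono : ∀ {p q} → p ≤ q → √ p ≤ᴿ √ q
√-mono p≤q (inj₁ r<0)  = inj₁ r<0
√-mono p≤q (inj₂ r²<p) = inj₂ (<-≤-trans r²<p p≤q)

<⇒≱ : ∀ {p q} → p < q → ¬ q ≤ p
<⇒≱ p<q q≤p = <-irrefl refl (<-≤-trans p<q q≤p)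

square-≥ : ∀ {p r} → 0ℚ ≤ r → 0ℚ ≤ p → r * r ≤ p * p → r ≤ p
square-≥ {p} {r} 0≤r 0≤p h = ≮⇒≥ λ p<r → <⇒≱ (Sqrt.square-< 0ℚ 0≤p p<r) h

square-≤ : ∀ {p r} → 0ℚ ≤ p → p ≤ r → p * p ≤ r * r
square-≤ {p} {r} 0≤p p≤r = ≤-trans
  (*-monoˡ-≤-nonNeg p {{ℚ.nonNegative 0≤p}} p≤r)
  (*-monoʳ-≤-nonNeg r {{ℚ.nonNegative (≤-trans 0≤p p≤r)}} p≤r)

¾ : ℚ
¾ = + 3 / 4

module _ {h q : ℚ} (0≤h : 0ℚ ≤ h) (h≤1 : h ≤ 1ℚ) where
  private
    -- The factor a = 1/10 satisfies 2 a + a² ≤ 1/4, as needed to expand (√¾ + a h)² with √¾ and h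
    -- at most 1.
    d : ℚ
    d = (+ 1 / 10) * h

    0≤d : 0ℚ ≤ d
    0≤d = 0≤* {+ 1 / 10} ⊢≤ 0≤h

    d²≤ : d * d ≤ (+ 1 / 100) * h
    d²≤ = ≤-by ((+ 1 / 100) * (h * (1ℚ - h))) (0≤* {+ 1 / 100} ⊢≤ (0≤* 0≤h (0≤- h≤1)))
      (solve 1 (λ h → con (+ 1 / 100) :* h := con (+ 1 / 10) :* h :* (con (+ 1 / 10) :* h)
        :+ con (+ 1 / 100) :* (h :* (con 1ℚ :- h))) refl h)

  -- (√¾ + h/10)² < ¾ + h/4, because √¾ < 1
  √¾+-≤ : ¾ + (+ 1 / 4) * h ≤ q → √ ¾ +ᴿ d ≤ᴿ √ q
  √¾+-≤ q≥ {p} l = go l (p ℚₚ.<? 0ℚ)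
    where
    s = p - d
    go : s < 0ℚ ⊎ s * s < ¾ → Dec (p < 0ℚ) → p < 0ℚ ⊎ p * p < q
    go _ (yes p<0) = inj₁ p<0
    go (inj₁ s<0) (no p≮0) = inj₂ (≤-<-trans
      (square-≤ (≮⇒≥ p≮0) (≤-by (- s) (neg-antimono-≤ (<⇒≤ s<0)) (solve 2 (λ p d → d := p :+ :- (p :- d)) refl p d)))
      (≤-<-trans d²≤ (<-≤-trans (Sqrt.p<r 0ℚ (¾ + (+ 24 / 100) * h)
        (<-≤-trans (positive⁻¹ ¾) (≤-by ((+ 24 / 100) * h) (0≤* {+ 24 / 100} ⊢≤ 0≤h) refl))
        (solve 1 (λ h → con (+ 1 / 100) :* h :+ (con ¾ :+ con (+ 24 / 100) :* h) := con ¾ :+ con (+ 1 / 4) :* h) refl h)) q≥)))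
    go (inj₂ s²<¾) (no p≮0) = inj₂ (<-≤-trans p²< q≥)
      where
      s≤1 : s ≤ 1ℚ
      s≤1 = ≮⇒≥ λ 1<s → ℚₚ.<-asym s²<¾ (ℚₚ.<-trans (ℚ.*<* (ℤ.+<+ (ℕₚ.≤-refl {4}))) (Sqrt.square-< 0ℚ 0≤1 1<s))
      p²< : p * p < ¾ + (+ 1 / 4) * h
      p²< = subst₂ _<_
        (solve 2 (λ p d → (p :- d) :* (p :- d) :+ (con (ι 2) :* (d :* (p :- d)) :+ d :* d) := p :* p) refl p d)
        refl
        (<-≤-trans (ℚₚ.+-monoˡ-< (ι 2 * (d * s) + d * d) s²<¾)
          (+-monoʳ-≤ ¾ (≤-trans (+-monoʳ-≤ (ι 2 * (d * s)) d²≤)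
            (≤-by ((+ 1 / 25) * h + ι 2 * (d * (1ℚ - s)))
              (0≤+ (0≤* {+ 1 / 25} ⊢≤ 0≤h) (0≤* {ι 2} ⊢≤ (0≤* 0≤d (0≤- s≤1))))
              (solve 2 (λ h s → con (+ 1 / 4) :* h := con (ι 2) :* (con (+ 1 / 10) :* h :* s) :+ con (+ 1 / 100) :* h
                :+ (con (+ 1 / 25) :* h :+ con (ι 2) :* (con (+ 1 / 10) :* h :* (con 1ℚ :- s)))) refl h s)))))

  -- (√¾ + h)² ≥ ¾ + h, because √¾ ≥ ½
  √-≤√¾+ : q ≤ ¾ + (+ 1 / 4) * h → √ q ≤ᴿ √ ¾ +ᴿ 1ℚ * h
  √-≤√¾+ q≤ {p} l = go l (s ℚₚ.<? 0ℚ) (s * s ℚₚ.<? ¾)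
    where
    s = p - 1ℚ * h
    p≡ : p ≡ s + h
    p≡ = solve 2 (λ p h → p := p :- con 1ℚ :* h :+ h) refl p h
    go : p < 0ℚ ⊎ p * p < q → Dec (s < 0ℚ) → Dec (s * s < ¾) → s < 0ℚ ⊎ s * s < ¾
    go _ (yes s<0) _ = inj₁ s<0
    go _ (no _) (yes s²<¾) = inj₂ s²<¾
    go (inj₁ p<0) (no s≮0) (no _) = ⊥-elim (<⇒≱ p<0 (subst (0ℚ ≤_) (sym p≡) (0≤+ (≮⇒≥ s≮0) 0≤h)))
    go (inj₂ p²<q) (no s≮0) (no s²≮¾) = ⊥-elim (<⇒≱ p²<q (≤-trans q≤
      (≤-by ((s * s - ¾) + (ι 2 * (h * (s - ½)) + (+ 3 / 4) * h + h * h))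
        (0≤+ (0≤- ¾≤s²) (0≤+ (0≤+ (0≤* {ι 2} ⊢≤ (0≤* 0≤h (0≤- ½≤s))) (0≤* {+ 3 / 4} ⊢≤ 0≤h)) (0≤* 0≤h 0≤h)))
        (solve 2 (λ p h → p :* p := con ¾ :+ con (+ 1 / 4) :* h
          :+ ((p :- con 1ℚ :* h) :* (p :- con 1ℚ :* h) :- con ¾ :+ (con (ι 2) :* (h :* (p :- con 1ℚ :* h :- con ½)) :+ con (+ 3 / 4) :* h :+ h :* h)))
          refl p h))))
      where
      ¾≤s² : ¾ ≤ s * s
      ¾≤s² = ≮⇒≥ s²≮¾
      ½≤s : ½ ≤ s
      ½≤s = square-≥ {s} {½} (nonNegative⁻¹ ½) (≮⇒≥ s≮0) (≤-trans {½ * ½} {¾} ⊢≤ ¾≤s²)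

-- Fractions and the rounding of x / 4

/-split : ∀ i n .{{_ : NonZero n}} → + i / n ≡ ι i * (+ 1 / n)
/-split i n = trans (sym (*-identityʳ (+ i / n))) (trans (cong ((+ i / n) *_) (sym (ι-1/ 1 n)))
  (trans (solve 3 (λ a b c → a :* (b :* c) := a :* c :* b) refl (+ i / n) (+ 1 / n) (ι n)) (cong (_* (+ 1 / n)) (ι-1/ i n))))

ceiling-neg : ∀ p → ceiling p ≡ ℤ.- floor (- p)
ceiling-neg (ℚ.mkℚ _ _ _) = refl

floor-↥↧ : ∀ p → floor p ℤ.* ↧ p ℤ.≤ ↥ p × ↥ p ℤ.< ℤ.suc (floor p) ℤ.* ↧ p
floor-↥↧ (ℚ.mkℚ a d _) = ℤDivMod.[n/d]*d≤n a (+ suc d) ,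
  subst (λ q → a ℤ.< ℤ.suc q ℤ.* + suc d) (sym (ℤDivMod.div-pos-is-/ℕ a (suc d))) (ℤDivMod.n<s[n/ℕd]*d a (suc d))

module _ {x n : ℕ} (lower : x ℕ.≤ 4 ℕ.* n) (upper : 4 ℕ.* n ℕ.< x ℕ.+ 4) where
  private
    p : ℚ
    p = + x / 4

    F : ℤ.ℤ
    F = floor (- p)

    g : ℕ
    g = ℤ.∣ ℤgcd (+ x) (+ 4) ∣

    D*g≡4 : ↧ (- p) ℤ.* + g ≡ + 4
    D*g≡4 = trans (cong (ℤ._* + g) (ℚₚ.↧-neg p)) (ℚₚ.↧-/ (+ x) 4)

    a*g≡x : ↥ (- p) ℤ.* + g ≡ ℤ.- + x
    a*g≡x = trans (cong (ℤ._* + g) (ℚₚ.↥-neg p)) (trans (sym (ℤₚ.neg-distribˡ-* (↥ p) (+ g))) (cong ℤ.-_ (ℚₚ.↥-/ (+ x) 4)))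

    scale : ∀ i → (i ℤ.* ↧ (- p)) ℤ.* + g ≡ i ℤ.* + 4
    scale i = trans (ℤₚ.*-assoc i (↧ (- p)) (+ g)) (cong (i ℤ.*_) D*g≡4)

    0<g : ℤ.Positive (+ g)
    0<g = positive (λ e → case (trans (sym D*g≡4) (trans (cong (λ k → ↧ (- p) ℤ.* + k) e) (ℤₚ.*-zeroʳ (↧ (- p))))))
      where
      positive : ∀ {k} → k ≢ 0 → ℤ.Positive (+ k)
      positive {zero} k≢0 = ⊥-elim (k≢0 refl)
      positive {suc k} _ = _
      case : + 4 ≢ + 0
      case ()

    F-lower : F ℤ.* + 4 ℤ.≤ ℤ.- + x
    F-lower = subst₂ ℤ._≤_ (scale F) a*g≡x (ℤₚ.*-monoʳ-≤-nonNeg (+ g) (proj₁ (floor-↥↧ (- p))))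

    F-upper : ℤ.- + x ℤ.< ℤ.suc F ℤ.* + 4
    F-upper = subst₂ ℤ._<_ a*g≡x (scale (ℤ.suc F)) (ℤₚ.*-monoʳ-<-pos (+ g) {{0<g}} (proj₂ (floor-↥↧ (- p))))

    n-lower : ℤ.- + n ℤ.* + 4 ℤ.≤ ℤ.- + x
    n-lower = subst (ℤ._≤ ℤ.- + x) (trans (cong ℤ.-_ (trans (ℤₚ.pos-* 4 n) (ℤₚ.*-comm (+ 4) (+ n)))) (ℤₚ.neg-distribˡ-* (+ n) (+ 4)))
      (ℤₚ.neg-mono-≤ (ℤ.+≤+ lower))

    n-upper : ℤ.- + x ℤ.< ℤ.suc (ℤ.- + n) ℤ.* + 4
    n-upper = subst₂ ℤ._<_ eq₁ eq₂ (ℤₚ.+-monoʳ-< (ℤ.- + x ℤ.+ ℤ.- + (4 ℕ.* n)) (ℤ.+<+ upper))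
      where
      eq₁ : (ℤ.- + x ℤ.+ ℤ.- + (4 ℕ.* n)) ℤ.+ + (4 ℕ.* n) ≡ ℤ.- + x
      eq₁ = trans (ℤₚ.+-assoc (ℤ.- + x) _ _) (trans (cong (λ z → ℤ.- + x ℤ.+ z) (ℤₚ.+-inverseˡ (+ (4 ℕ.* n)))) (ℤₚ.+-identityʳ _))
      eq₂ : (ℤ.- + x ℤ.+ ℤ.- + (4 ℕ.* n)) ℤ.+ + (x ℕ.+ 4) ≡ ℤ.suc (ℤ.- + n) ℤ.* + 4
      eq₂ = trans (cong₂ (λ y z → (ℤ.- + x ℤ.+ ℤ.- y) ℤ.+ z) (ℤₚ.pos-* 4 n) (ℤₚ.pos-+ x 4))
        (solveℤ 2 (λ x n → (ℤ:- x ℤ:+ ℤ:- (ℤcon (+ 4) ℤ:* n)) ℤ:+ (x ℤ:+ ℤcon (+ 4)) ℤ:= (ℤcon (+ 1) ℤ:+ ℤ:- n) ℤ:* ℤcon (+ 4)) refl (+ x) (+ n))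

    <suc⇒≤ : ∀ {i j} → i ℤ.< ℤ.suc j → i ℤ.≤ j
    <suc⇒≤ {i} {j} h = subst (i ℤ.≤_) (ℤₚ.pred-suc j) (ℤₚ.i<j⇒i≤pred[j] h)

  -- The ceiling is minus the floor of -x/4. That fraction is stored in lowest terms, so
  -- multiplication by the gcd restores the denominator 4. The floor and -n then both solve 4 z ≤ -x
  -- < 4 (z + 1), which has one integer solution.
  ceiling-quarter : ceiling p ≡ + n
  ceiling-quarter = trans (ceiling-neg p) (trans (cong ℤ.-_ (ℤₚ.≤-antisym
    (<suc⇒≤ (ℤₚ.*-cancelʳ-<-nonNeg (+ 4) (ℤₚ.≤-<-trans F-lower n-upper)))
    (<suc⇒≤ (ℤₚ.*-cancelʳ-<-nonNeg (+ 4) (ℤₚ.≤-<-trans n-lower F-upper))))) (ℤₚ.neg-involutive (+ n)))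

-- The value of ρ and its asymptotics

module Rho (m : ℕ) .{{_ : NonZero m}} where
  instance
    m²≢0 : NonZero (m ^ 2)
    m²≢0 = m^n≢0 m 2

  N : ℕ
  N = least m

  h q : ℚ
  h = + 1 / m ^ 2
  q = + N / m ^ 2

  m² : m ^ 2 ≡ m ℕ.* m
  m² = cong (m ℕ.*_) (ℕₚ.*-identityʳ m)

  N-lower : 3 ℕ.* m ^ 2 ℕ.≤ 4 ℕ.* N
  N-lower = subst (λ k → 3 ℕ.* k ℕ.≤ 4 ℕ.* N) (sym m²) (least-lower m)

  N-upper : 4 ℕ.* N ℕ.≤ 3 ℕ.* m ^ 2 ℕ.+ 1
  N-upper = subst (λ k → 4 ℕ.* N ℕ.≤ 3 ℕ.* k ℕ.+ 1) (sym m²) (least-upper m)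

  rounded : ceiling (+ (3 *ℕ m ^ 2) / 4) / m ^ 2 ≡ q
  rounded = cong (_/ m ^ 2) (ceiling-quarter {3 ℕ.* m ^ 2} {N} N-lower
    (ℕₚ.≤-<-trans N-upper (ℕₚ.+-monoʳ-< (3 ℕ.* m ^ 2) (s≤s (s≤s z≤n)))))

  0≤h : 0ℚ ≤ h
  0≤h = nonNegative⁻¹ h {{normalize-nonNeg 1 (m ^ 2)}}

  q≡ : q ≡ ι N * h
  q≡ = /-split N (m ^ 2)

  h*m² : h * ι (m ^ 2) ≡ 1ℚ
  h*m² = ι-1/ 1 (m ^ 2)

  h≤1 : h ≤ 1ℚ
  h≤1 = subst₂ _≤_ (*-identityʳ h) h*m²
    (*-monoˡ-≤-nonNeg h {{ℚ.nonNegative 0≤h}} (ι-mono {1} (ℕ.>-nonZero⁻¹ (m ^ 2))))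

  scale-h : ∀ {p r} → p ≤ r → p * h ≤ r * h
  scale-h = *-monoʳ-≤-nonNeg h {{ℚ.nonNegative 0≤h}}

  at-least : ∀ T → Triangulates m T → q ≤ totalWeight m T * h
  at-least T tri =
    let (n , 3m²≤4n , ιn≤) = total-lower m T tri in
    subst (_≤ totalWeight m T * h) (sym q≡) (scale-h (≤-trans (ι-mono (N≤ n 3m²≤4n)) ιn≤))
    where
    -- Here 4 N ≤ 3 m² + 1 ≤ 4 n + 1, while N > n would mean 4 N ≥ 4 n + 4.
    N≤ : ∀ n → 3 ℕ.* (m ℕ.* m) ℕ.≤ 4 ℕ.* n → N ℕ.≤ n
    N≤ n le = ℕₚ.≮⇒≥ λ n<N → ℕₚ.<⇒≱ {4 ℕ.* n ℕ.+ 1} {4 ℕ.* N}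
      (ℕₚ.<-≤-trans (ℕₚ.+-monoʳ-< (4 ℕ.* n) (s≤s (s≤s z≤n)))
        (ℕₚ.≤-trans (ℕₚ.≤-reflexive (trans (ℕₚ.+-comm (4 ℕ.* n) 4) (sym (ℕₚ.*-suc 4 n)))) (ℕₚ.*-monoʳ-≤ 4 {suc n} {N} n<N)))
      (ℕₚ.≤-trans (least-upper m) (ℕₚ.+-monoˡ-≤ 1 le))

  at-most : totalWeight m (optimal {m}) * h ≤ q
  at-most = subst (totalWeight m (optimal {m}) * h ≤_) (sym q≡) (scale-h (total-optimal m))

  isRho : IsRho m (√ q)
  isRho = (optimal {m} , optimal-triangulates {m} , √-mono (at-least _ (optimal-triangulates {m})) , √-mono at-most)
        , λ T tri → √-mono (at-least T tri)

  rho-lower : ∀ {ρ} → IsRho m ρ → √ q ≤ᴿ ρ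
  rho-lower ((T , tri , _ , eff≤ρ) , _) l = eff≤ρ (√-mono (at-least T tri) l)

  rho-upper : ∀ {ρ} → IsRho m ρ → ρ ≤ᴿ √ q
  rho-upper (_ , ρ≤) l = √-mono at-most (ρ≤ (optimal {m}) (optimal-triangulates {m}) l)

  q-quarters : ∀ {k} → 4 ℕ.* N ≡ 3 ℕ.* m ^ 2 ℕ.+ k → q ≡ ¾ + (+ 1 / 4) * (ι k * h)
  q-quarters {k} e = trans q≡ (by₂ ((+ 1 / 4) * h) four ¾ h*m²
    (solve 4 (λ n h a k → n :* h := con ¾ :+ con (+ 1 / 4) :* (k :* h)
      :+ con (+ 1 / 4) :* h :* (con (ι 4) :* n :- (con (ι 3) :* a :+ k)) :+ con ¾ :* (h :* a :- con 1ℚ)) refl (ι N) h (ι (m ^ 2)) (ι k)))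
    where
    four : ι 4 * ι N ≡ ι 3 * ι (m ^ 2) + ι k
    four = trans (sym (ι-* 4 N)) (trans (cong ι e) (trans (ι-+ (3 ℕ.* m ^ 2) k) (cong (_+ ι k) (ι-* 3 (m ^ 2)))))

  -- Now 3 m² is a multiple of 4, and so is 4 N, which lies between 3 m² and 3 m² + 1; the two
  -- coincide.
  even : 2 ∣ m → q ≡ ¾
  even (divides k m≡k*2) = trans (q-quarters (trans (ℕₚ.≤-antisym ub N-lower) (sym (ℕₚ.+-identityʳ _))))
    (solve 1 (λ h → con ¾ :+ con (+ 1 / 4) :* (con (ι 0) :* h) := con ¾) refl h)
    where
    3m² : 3 ℕ.* m ^ 2 ≡ 4 ℕ.* (3 ℕ.* (k ℕ.* k))
    3m² = trans (cong (λ m → 3 ℕ.* m ^ 2) m≡k*2)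
      (solveℕ 1 (λ k → # 3 ⊗ ((k ⊗ # 2) ⊗ ((k ⊗ # 2) ⊗ # 1)) :=ℕ # 4 ⊗ (# 3 ⊗ (k ⊗ k))) refl k)
    ub : 4 ℕ.* N ℕ.≤ 3 ℕ.* m ^ 2
    ub = ℕₚ.≤-trans (ℕₚ.*-monoʳ-≤ 4 {N} {j} (ℕₚ.≮⇒≥ λ j<N → ℕₚ.<⇒≱ {4 ℕ.* j ℕ.+ 1} {4 ℕ.* N}
        (ℕₚ.<-≤-trans (ℕₚ.+-monoʳ-< (4 ℕ.* j) (s≤s (s≤s z≤n)))
          (ℕₚ.≤-trans (ℕₚ.≤-reflexive (trans (ℕₚ.+-comm (4 ℕ.* j) 4) (sym (ℕₚ.*-suc 4 j)))) (ℕₚ.*-monoʳ-≤ 4 {suc j} {N} j<N)))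
        (subst (λ x → 4 ℕ.* N ℕ.≤ x ℕ.+ 1) 3m² N-upper)))
      (ℕₚ.≤-reflexive (sym 3m²))
      where j = 3 ℕ.* (k ℕ.* k)

  -- Now 3 m² leaves the remainder 3 modulo 4, so of 3 m² and 3 m² + 1 only the latter can be 4 N.
  odd : 2 ∤ m → q ≡ ¾ + (+ 1 / 4) * h
  odd 2∤m = trans (q-quarters (ℕₚ.≤-antisym N-upper lb)) (cong (λ x → ¾ + (+ 1 / 4) * x) (*-identityˡ h))
    where
    k = m ℕ./ 2
    m≡ : m ≡ 1 ℕ.+ k ℕ.* 2
    m≡ = trans (ℕDivMod.m≡m%n+[m/n]*n m 2) (cong (ℕ._+ k ℕ.* 2) (one (m ℕ.% 2) refl))
      where
      one : ∀ r → m ℕ.% 2 ≡ r → r ≡ 1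
      one 0 e = ⊥-elim (2∤m (m%n≡0⇒n∣m m 2 e))
      one 1 _ = refl
      one (suc (suc r)) e = ⊥-elim (ℕₚ.<⇒≱ (ℕDivMod.m%n<n m 2) (ℕₚ.≤-trans (s≤s (s≤s z≤n)) (ℕₚ.≤-reflexive (sym e))))
    j = 3 ℕ.* k ℕ.+ 3 ℕ.* (k ℕ.* k)
    3m² : 3 ℕ.* m ^ 2 ≡ 4 ℕ.* j ℕ.+ 3
    3m² = trans (cong (λ m → 3 ℕ.* m ^ 2) m≡)
      (solveℕ 1 (λ k → # 3 ⊗ ((# 1 ⊕ k ⊗ # 2) ⊗ ((# 1 ⊕ k ⊗ # 2) ⊗ # 1)) :=ℕ # 4 ⊗ (# 3 ⊗ k ⊕ # 3 ⊗ (k ⊗ k)) ⊕ # 3) refl k)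
    lb : 3 ℕ.* m ^ 2 ℕ.+ 1 ℕ.≤ 4 ℕ.* N
    lb = ℕₚ.≤-trans (ℕₚ.≤-reflexive (trans (cong (ℕ._+ 1) 3m²) (solveℕ 1 (λ j → # 4 ⊗ j ⊕ # 3 ⊕ # 1 :=ℕ # 4 ⊗ (# 1 ⊕ j)) refl j)))
      (ℕₚ.*-monoʳ-≤ 4 {suc j} {N} (ℕₚ.≰⇒> λ N≤j → ℕₚ.<⇒≱ (ℕₚ.m<m+n (4 ℕ.* j) (s≤s z≤n))
        (ℕₚ.≤-trans (subst (ℕ._≤ 4 ℕ.* N) 3m² N-lower) (ℕₚ.*-monoʳ-≤ 4 {N} {j} N≤j))))

theorem7p1 : (∀ m → .{{_ : NonZero m}} → let instance _ = m^n≢0 m 2 in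
    IsRho m (√ (ceiling (+ (3 *ℕ m ^ 2) / 4) / m ^ 2)))
    × (∀ m → .{{_ : NonZero m}} → 2 ∣ m → IsRho m (√ (+ 3 / 4)))
    × (∃[ c ] ∃[ C ] (0ℚ < c × 0ℚ < C ×
    (∀ m → .{{_ : NonZero m}} → 2 ∤ m → ∀ ρ → IsRho m ρ → let instance _ = m^n≢0 m 2 in
    √ (+ 3 / 4) +ᴿ c * (+ 1 / m ^ 2) ≤ᴿ ρ
    × ρ ≤ᴿ √ (+ 3 / 4) +ᴿ C * (+ 1 / m ^ 2))))
theorem7p1 =
    (λ m → subst (λ q → IsRho m (√ q)) (sym (Rho.rounded m)) (Rho.isRho m))
  , (λ m 2∣m → subst (λ q → IsRho m (√ q)) (Rho.even m 2∣m) (Rho.isRho m))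
  , + 1 / 10 , 1ℚ , positive⁻¹ (+ 1 / 10) , positive⁻¹ 1ℚ , λ m 2∤m ρ isρ →
      (λ l → Rho.rho-lower m {ρ} isρ
        (√¾+-≤ (Rho.0≤h m) (Rho.h≤1 m) (≤-reflexive (sym (Rho.odd m 2∤m))) l))
    , (λ l → √-≤√¾+ (Rho.0≤h m) (Rho.h≤1 m) (≤-reflexive (Rho.odd m 2∤m)) (Rho.rho-upper m {ρ} isρ l))
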